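{- There is an absolute constant $K_0$ such that for all integers $N\ge1$ and $K\ge K_0$ there is some residue system $C$ consisting of distinct moduli from $(N,KN]$ such that \[ \delta(C)\le\frac1K\exp\left(-\frac{\log K}{3N}\right). \]
   Context: A residue system is a finite set $C$ of ordered pairs of positive integers $(n,r)$, each interpreted as the residue class $r\pmod n$ with modulus $n$; "distinct moduli" means that each $n$ occurs in at most one pair of $C$. $R(C)$ is the set of integers not congruent to $r\pmod n$ for any $(n,r)\in C$, and $\delta(C)$ is the asymptotic density of $R(C)$ (which exists, since $R(C)$ is a union of residue classes modulo the least common multiple of the moduli). -}

module Defs where

open import Data.Nat as ℕ using (ℕ; zero; suc; z≤n; s≤s)
import Data.Nat.Properties as ℕ
import Data.Nat.DivMod as ℕ
import Data.Nat.Divisibility as ℕ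
open import Data.Nat.ListAction using (product)
open import Data.Nat.ListAction.Properties using (∈⇒∣product; product≢0)
open import Data.Integer as ℤ using (ℤ; +_; -[1+_])
import Data.Integer.Properties as ℤ
import Data.Integer.Divisibility.Signed as ℤ
open import Data.Rational
open import Data.Rational.Properties
open import Data.Rational.Solver using (module +-*-Solver)
open import Data.Rational.Unnormalised.Base as ℚᵘ using (mkℚᵘ)
import Data.Rational.Unnormalised.Properties as ℚᵘ
open import Data.List using (List; []; _∷_; map; filter; length)
open import Data.List.Properties using (length-filter)
open import Data.List.Membership.Propositional using (_∈_)
open import Data.List.Membership.Propositional.Properties using (∈-map⁺)
open import Data.List.Relation.Unary.All as All using (All; all?)
import Data.List.Relation.Unary.All.Properties as All
open import Data.List.Relation.Unary.Unique.Propositional using (Unique)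
open import Data.Product using (∃; _×_; _,_; proj₁; proj₂)
open import Data.Sum using (inj₁; inj₂)
open import Level using (0ℓ)
open import Relation.Nullary using (¬_; yes; no; contradiction; ¬?)
open import Relation.Unary using (Pred; Decidable)
open import Relation.Binary.PropositionalEquality
open +-*-Solver using (solve; _:+_; _:*_; _:-_; :-_; _:=_)

ι : ℕ → ℚ
ι n = + n / 1

inv : ℕ → ℚ
inv n = + 1 / suc n

infix 8 _/ₙ_
_/ₙ_ : (a b : ℕ) .{{_ : ℕ.NonZero b}} → ℚ
a /ₙ b = + a / b

toℚᵘ-/ : ∀ a b → toℚᵘ (+ a / suc b) ℚᵘ.≃ mkℚᵘ (+ a) b
toℚᵘ-/ a b = toℚᵘ-fromℚᵘ (mkℚᵘ (+ a) b)

/-mono-≤ : ∀ a b c d → a ℕ.* suc d ℕ.≤ c ℕ.* suc b → a /ₙ suc b ≤ c /ₙ suc d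
/-mono-≤ a b c d h = toℚᵘ-cancel-≤
  (ℚᵘ.≤-respˡ-≃ (ℚᵘ.≃-sym (toℚᵘ-/ a b)) (ℚᵘ.≤-respʳ-≃ (ℚᵘ.≃-sym (toℚᵘ-/ c d))
    (ℚᵘ.*≤* (subst₂ ℤ._≤_ (ℤ.pos-* a (suc d)) (ℤ.pos-* c (suc b)) (ℤ.+≤+ h)))))

/-+-/ : ∀ a b c d → a /ₙ suc b + c /ₙ suc d ≡ (a ℕ.* suc d ℕ.+ c ℕ.* suc b) /ₙ (suc b ℕ.* suc d)
/-+-/ a b c d = toℚᵘ-injective (ℚᵘ.≃-trans (toℚᵘ-homo-+ (+ a / suc b) (+ c / suc d))
  (ℚᵘ.≃-trans (ℚᵘ.+-cong (toℚᵘ-/ a b) (toℚᵘ-/ c d))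
  (ℚᵘ.≃-trans (ℚᵘ.≃-reflexive (cong (λ z → mkℚᵘ z _) eq)) (ℚᵘ.≃-sym (toℚᵘ-/ _ _)))))
  where
  eq : + a ℤ.* + suc d ℤ.+ + c ℤ.* + suc b ≡ + (a ℕ.* suc d ℕ.+ c ℕ.* suc b)
  eq = cong₂ ℤ._+_ (sym (ℤ.pos-* a (suc d))) (sym (ℤ.pos-* c (suc b)))

/-*-/ : ∀ a b c d → (a /ₙ suc b) * (c /ₙ suc d) ≡ (a ℕ.* c) /ₙ (suc b ℕ.* suc d)
/-*-/ a b c d = toℚᵘ-injective (ℚᵘ.≃-trans (toℚᵘ-homo-* (+ a / suc b) (+ c / suc d))
  (ℚᵘ.≃-trans (ℚᵘ.*-cong (toℚᵘ-/ a b) (toℚᵘ-/ c d))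
  (ℚᵘ.≃-trans (ℚᵘ.≃-reflexive (cong (λ z → mkℚᵘ z _) (sym (ℤ.pos-* a c)))) (ℚᵘ.≃-sym (toℚᵘ-/ _ _)))))

/-cross : ∀ a b c d → a ℕ.* suc d ≡ c ℕ.* suc b → a /ₙ suc b ≡ c /ₙ suc d
/-cross a b c d h = ≤-antisym (/-mono-≤ a b c d (ℕ.≤-reflexive h)) (/-mono-≤ c d a b (ℕ.≤-reflexive (sym h)))

0≤/ : ∀ a b → 0ℚ ≤ a /ₙ suc b
0≤/ a b = /-mono-≤ 0 0 a b z≤n

ι-suc : ∀ n → ι (suc n) ≡ 1ℚ + ι n
ι-suc n = sym (trans (/-+-/ 1 0 n 0) (cong (λ z → z /ₙ 1) (cong suc (ℕ.*-identityʳ n))))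

ι-mono : ∀ {m n} → m ℕ.≤ n → ι m ≤ ι n
ι-mono {m} {n} h = /-mono-≤ m 0 n 0 (ℕ.*-monoˡ-≤ 1 h)

ι*inv : ∀ n → ι (suc n) * inv n ≡ 1ℚ
ι*inv n = trans (/-*-/ (suc n) 0 1 n) (/-cross (suc n ℕ.* 1) (n ℕ.+ 0) 1 0
  (trans (ℕ.*-identityʳ _) (trans (ℕ.*-identityʳ _)
    (sym (trans (ℕ.*-identityˡ _) (ℕ.*-identityˡ (suc n)))))))

inv-anti : ∀ {m n} → m ℕ.≤ n → inv n ≤ inv m
inv-anti {m} {n} h = /-mono-≤ 1 n 1 m (ℕ.*-monoʳ-≤ 1 (s≤s h))

0≤ι : ∀ n → 0ℚ ≤ ι n
0≤ι n = 0≤/ n 0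

0≤inv : ∀ n → 0ℚ ≤ inv n
0≤inv n = 0≤/ 1 n

abs-≤ : ∀ {p r} → p ≤ r → - p ≤ r → ∣ p ∣ ≤ r
abs-≤ {p} h₁ h₂ with ∣p∣≡p∨∣p∣≡-p p
... | inj₁ e = subst (_≤ _) (sym e) h₁
... | inj₂ e = subst (_≤ _) (sym e) h₂

p≤∣p∣ : ∀ p → p ≤ ∣ p ∣
p≤∣p∣ p with ≤-total 0ℚ p
... | inj₁ h = ≤-reflexive (sym (0≤p⇒∣p∣≡p h))
... | inj₂ h = ≤-trans h (0≤∣p∣ p)

∣-∣-comm : ∀ p q → ∣ p - q ∣ ≡ ∣ q - p ∣
∣-∣-comm p q = trans (sym (∣-p∣≡∣p∣ (p - q)))
  (cong ∣_∣ (solve 2 (λ a b → :- (a :- b) := b :- a) refl p q))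

mulʳ : ∀ {p q} r → 0ℚ ≤ r → p ≤ q → p * r ≤ q * r
mulʳ r h = *-monoʳ-≤-nonNeg r {{nonNegative h}}

mulˡ : ∀ {p q} r → 0ℚ ≤ r → p ≤ q → r * p ≤ r * q
mulˡ r h = *-monoˡ-≤-nonNeg r {{nonNegative h}}

mul : ∀ {p q r s} → 0ℚ ≤ q → 0ℚ ≤ r → p ≤ q → r ≤ s → p * r ≤ q * s
mul {p} {q} {r} hq hr h k = ≤-trans (mulʳ r hr h) (mulˡ q hq k)

0≤* : ∀ {p q} → 0ℚ ≤ p → 0ℚ ≤ q → 0ℚ ≤ p * q
0≤* {p} {q} hp hq = subst (_≤ p * q) (*-zeroʳ p) (mulˡ p hp hq)

0≤+ : ∀ {p q} → 0ℚ ≤ p → 0ℚ ≤ q → 0ℚ ≤ p + q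
0≤+ hp hq = +-mono-≤ hp hq

0<* : ∀ {p q} → 0ℚ < p → 0ℚ < q → 0ℚ < p * q
0<* {p} {q} hp hq = subst (_< p * q) (*-zeroʳ p) (*-monoʳ-<-pos p {{positive hp}} hq)

0<1 : 0ℚ < 1ℚ
0<1 = *<* (ℤ.+<+ (s≤s z≤n))

recip : ∀ p → 0ℚ < p → ∃ λ r → 0ℚ < r × p * r ≡ 1ℚ
recip p h = (1/ p) , positive⁻¹ (1/ p) {{1/pos⇒pos p}} , *-inverseʳ p
  where instance
    p>0 = positive h
    p≢0 = pos⇒nonZero p

-≤⇒≤+ : ∀ {p q r} → p - q ≤ r → p ≤ q + r
-≤⇒≤+ {p} {q} {r} h = subst (_≤ q + r)
  (solve 2 (λ a b → b :+ (a :- b) := a) refl p q) (+-monoʳ-≤ q h)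

≤+⇒-≤ : ∀ {p q r} → p ≤ q + r → p - q ≤ r
≤+⇒-≤ {p} {q} {r} h = subst (p - q ≤_)
  (solve 2 (λ b c → b :+ c :- b := c) refl q r) (+-monoˡ-≤ (- q) h)

arch : ∀ q → ∃ λ n → q ≤ ι n
arch (mkℚ (+ a) d c) = a , toℚᵘ-cancel-≤ (ℚᵘ.≤-respʳ-≃ (ℚᵘ.≃-sym (toℚᵘ-/ a 0))
  (ℚᵘ.*≤* (ℤ.*-monoˡ-≤-nonNeg (+ a) (ℤ.+≤+ (s≤s (z≤n {d}))))))
arch (mkℚ -[1+ a ] d c) = 0 , *≤* ℤ.-≤+

/-small : ∀ B ε → 0ℚ < ε → ∃ λ M → ∀ n → M ℕ.≤ n → B * inv n < ε
/-small B ε ε>0 with recip ε ε>0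
... | r , _ , εr≡1 with arch (B * r)
... | M , h = M , λ n M≤n →
  let B≡ : B ≡ (B * r) * ε
      B≡ = trans (sym (*-identityʳ B)) (trans (cong (B *_) (sym εr≡1))
             (solve 3 (λ b e r → b :* (e :* r) := b :* r :* e) refl B ε r))
      B< : B < ι (suc n) * ε
      B< = ≤-<-trans (≤-trans (≤-reflexive B≡) (mulʳ ε (<⇒≤ ε>0) (≤-trans h (ι-mono M≤n))))
             (*-monoˡ-<-pos ε {{positive ε>0}}
               (subst₂ _<_ (+-identityˡ (ι n)) (sym (ι-suc n)) (+-monoˡ-< (ι n) 0<1)))
      eq : ι (suc n) * ε * inv n ≡ ε
      eq = trans (solve 3 (λ a e i → a :* e :* i := e :* (a :* i)) refl (ι (suc n)) ε (inv n))
             (trans (cong (ε *_) (ι*inv n)) (*-identityʳ ε))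
      inv>0 : 0ℚ < inv n
      inv>0 = positive⁻¹ (inv n) {{normalize-pos 1 (suc n)}}
  in subst (B * inv n <_) eq (*-monoˡ-<-pos (inv n) {{positive inv>0}} B<)

*-small : ∀ c ε → 0ℚ ≤ c → 0ℚ < ε →
  ∃ λ ε′ → 0ℚ < ε′ × (∀ d → 0ℚ ≤ d → d < ε′ → c * d < ε)
*-small c ε c≥0 ε>0 = ε * r , 0<* ε>0 r>0 , λ d d≥0 d< → ≤-<-trans (mulʳ d d≥0 c≤k)
  (subst (k * d <_) eq (*-monoʳ-<-pos k {{positive k>0}} d<))
  where
  k = 1ℚ + c
  k>0 : 0ℚ < k
  k>0 = subst (_< k) (+-identityʳ 0ℚ) (+-mono-<-≤ 0<1 c≥0)
  c≤k : c ≤ k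
  c≤k = subst (_≤ k) (+-identityˡ c) (+-monoˡ-≤ c (<⇒≤ 0<1))
  r = proj₁ (recip k k>0)
  r>0 = proj₁ (proj₂ (recip k k>0))
  eq : k * (ε * r) ≡ ε
  eq = trans (solve 3 (λ k e r → k :* (e :* r) := e :* (k :* r)) refl k ε r)
    (trans (cong (ε *_) (proj₂ (proj₂ (recip k k>0)))) (*-identityʳ ε))

Cauchy : (ℕ → ℚ) → Set
Cauchy a = ∀ ε → 0ℚ < ε → ∃ λ M → ∀ m n → M ℕ.≤ m → M ℕ.≤ n → ∣ a m - a n ∣ < ε

cauchy-ordered : ∀ {a} →
  (∀ ε → 0ℚ < ε → ∃ λ M → ∀ m n → M ℕ.≤ m → m ℕ.≤ n → ∣ a m - a n ∣ < ε) → Cauchy a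
cauchy-ordered {a} h ε ε>0 with h ε ε>0
... | M , k = M , go
  where
  go : ∀ m n → M ℕ.≤ m → M ℕ.≤ n → ∣ a m - a n ∣ < ε
  go m n M≤m M≤n with ℕ.≤-total m n
  ... | inj₁ m≤n = k m n M≤m m≤n
  ... | inj₂ n≤m = subst (_< ε) (∣-∣-comm (a n) (a m)) (k n m M≤n n≤m)

cauchy-rate : ∀ {a} B → (∀ m n → m ℕ.≤ n → ∣ a m - a n ∣ ≤ B * inv m) → Cauchy a
cauchy-rate {a} B h = cauchy-ordered {a} λ ε ε>0 →
  let M , k = /-small B ε ε>0 in M , λ m n M≤m m≤n → ≤-<-trans (h m n m≤n) (k m M≤m)

cauchy-bounded : ∀ {a} → Cauchy a → ∃ λ M → ∃ λ B → ∀ n → M ℕ.≤ n → ∣ a n ∣ ≤ B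
cauchy-bounded {a} h with h 1ℚ 0<1
... | M , k = M , ∣ a M ∣ + 1ℚ , λ n M≤n →
  ≤-trans (≤-reflexive (cong ∣_∣ (solve 2 (λ x y → x := y :+ (x :- y)) refl (a n) (a M))))
    (≤-trans (∣p+q∣≤∣p∣+∣q∣ (a M) (a n - a M))
      (+-monoʳ-≤ ∣ a M ∣ (<⇒≤ (k n M M≤n ℕ.≤-refl))))

record ℝ : Set where
  constructor mkℝ
  field
    approx : ℕ → ℚ
    cauchy : Cauchy approx
open ℝ public

infix 4 _≤ᵣ_
-- On limits: the ε makes this independent of the approximating sequences.
_≤ᵣ_ : ℝ → ℝ → Set
x ≤ᵣ y = ∀ ε → 0ℚ < ε → ∃ λ M → ∀ n → M ℕ.≤ n → approx x n ≤ approx y n + ε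

infix 8 -ᵣ_
-ᵣ_ : ℝ → ℝ
-ᵣ x = mkℝ (λ n → - approx x n) λ ε ε>0 →
  let M , h = cauchy x ε ε>0 in M , λ m n M≤m M≤n → subst (_< ε)
    (trans (∣-∣-comm (approx x m) (approx x n))
      (cong ∣_∣ (solve 2 (λ a b → b :- a := :- a :- :- b) refl (approx x m) (approx x n))))
    (h m n M≤m M≤n)

infixr 7 _·_
_·_ : ℚ → ℝ → ℝ
q · x = mkℝ (λ n → q * approx x n) λ ε ε>0 →
  let ε′ , ε′>0 , k = *-small ∣ q ∣ ε (0≤∣p∣ q) ε>0
      M , h = cauchy x ε′ ε′>0
  in M , λ m n M≤m M≤n → subst (_< ε)
    (trans (sym (∣p*q∣≡∣p∣*∣q∣ q (approx x m - approx x n)))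
      (cong ∣_∣ (solve 3 (λ q a b → q :* (a :- b) := q :* a :- q :* b) refl q (approx x m) (approx x n))))
    (k _ (0≤∣p∣ (approx x m - approx x n)) (h m n M≤m M≤n))

infixl 7 _÷ₙ_
_÷ₙ_ : ℝ → (n : ℕ) .{{_ : ℕ.NonZero n}} → ℝ
x ÷ₙ n = (+ 1 / n) · x

Σ[i<_] : ℕ → (ℕ → ℚ) → ℚ
Σ[i< zero ] f = 0ℚ
Σ[i< suc n ] f = Σ[i< n ] f + f n

-- qᵏ / k!
expTerm : ℚ → ℕ → ℚ
expTerm q zero = 1ℚ
expTerm q (suc k) = expTerm q k * (q * (+ 1 / suc k))

expSum : ℚ → ℕ → ℚ
expSum q n = Σ[i< n ] (expTerm q)

∣expTerm∣≤ : ∀ {a B} → ∣ a ∣ ≤ B → ∀ k → ∣ expTerm a k ∣ ≤ expTerm B k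
0≤expTerm : ∀ {B} → 0ℚ ≤ B → ∀ k → 0ℚ ≤ expTerm B k
0≤expTerm h zero = <⇒≤ 0<1
0≤expTerm h (suc k) = 0≤* (0≤expTerm h k) (0≤* h (0≤inv k))
∣expTerm∣≤ h zero = ≤-refl
∣expTerm∣≤ {a} {B} h (suc k) = begin
  ∣ expTerm a k * (a * inv k) ∣      ≡⟨ ∣p*q∣≡∣p∣*∣q∣ (expTerm a k) (a * inv k) ⟩
  ∣ expTerm a k ∣ * ∣ a * inv k ∣    ≡⟨ cong (∣ expTerm a k ∣ *_) (∣p*q∣≡∣p∣*∣q∣ a (inv k)) ⟩
  ∣ expTerm a k ∣ * (∣ a ∣ * ∣ inv k ∣)  ≡⟨ cong (λ z → ∣ expTerm a k ∣ * (∣ a ∣ * z)) (0≤p⇒∣p∣≡p (0≤inv k)) ⟩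
  ∣ expTerm a k ∣ * (∣ a ∣ * inv k)
    ≤⟨ mul (0≤expTerm B≥0 k) (0≤* (0≤∣p∣ a) (0≤inv k)) (∣expTerm∣≤ h k) (mulʳ (inv k) (0≤inv k) h) ⟩
  expTerm B k * (B * inv k) ∎
  where
  open ≤-Reasoning
  B≥0 = ≤-trans (0≤∣p∣ a) h

expTerm-suc : ∀ B k → expTerm B k * B ≡ expTerm B (suc k) * ι (suc k)
expTerm-suc B k = sym (trans
  (solve 4 (λ t b i n → t :* (b :* i) :* n := t :* b :* (n :* i)) refl (expTerm B k) B (inv k) (ι (suc k)))
  (trans (cong (expTerm B k * B *_) (ι*inv k)) (*-identityʳ _)))

expTerm-lipschitz : ∀ {a b B} → ∣ a ∣ ≤ B → ∣ b ∣ ≤ B → ∀ k →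
  ∣ expTerm a (suc k) - expTerm b (suc k) ∣ ≤ ∣ a - b ∣ * expTerm B k
expTerm-lipschitz {a} {b} {B} ha hb zero = ≤-reflexive (trans
  (cong ∣_∣ (trans (cong₂ _-_ (one a) (one b)) refl)) (sym (*-identityʳ _)))
  where
  one : ∀ a → 1ℚ * (a * inv 0) ≡ a
  one a = trans (*-identityˡ _) (*-identityʳ a)
expTerm-lipschitz {a} {b} {B} ha hb (suc k) = begin
  ∣ Ta * (a * i) - Tb * (b * i) ∣
    ≡⟨ cong ∣_∣ (solve 5 (λ s t a b i → s :* (a :* i) :- t :* (b :* i) := (s :* (a :- b) :+ (s :- t) :* b) :* i) refl Ta Tb a b i) ⟩
  ∣ (Ta * (a - b) + (Ta - Tb) * b) * i ∣
    ≡⟨ trans (∣p*q∣≡∣p∣*∣q∣ (Ta * (a - b) + (Ta - Tb) * b) i) (cong (∣ Ta * (a - b) + (Ta - Tb) * b ∣ *_) (0≤p⇒∣p∣≡p i≥0)) ⟩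
  ∣ Ta * (a - b) + (Ta - Tb) * b ∣ * i
    ≤⟨ mulʳ i i≥0 (∣p+q∣≤∣p∣+∣q∣ (Ta * (a - b)) ((Ta - Tb) * b)) ⟩
  (∣ Ta * (a - b) ∣ + ∣ (Ta - Tb) * b ∣) * i
    ≡⟨ cong (_* i) (cong₂ _+_ (∣p*q∣≡∣p∣*∣q∣ Ta (a - b)) (∣p*q∣≡∣p∣*∣q∣ (Ta - Tb) b)) ⟩
  (∣ Ta ∣ * d + ∣ Ta - Tb ∣ * ∣ b ∣) * i
    ≤⟨ mulʳ i i≥0 (+-mono-≤ (mulʳ d d≥0 (∣expTerm∣≤ ha (suc k)))
         (mul (0≤* d≥0 (0≤expTerm B≥0 k)) (0≤∣p∣ b) (expTerm-lipschitz {a} {b} ha hb k) hb)) ⟩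
  (TB * d + d * expTerm B k * B) * i
    ≡⟨ cong (λ z → (TB * d + z) * i) (trans (*-assoc d (expTerm B k) B) (cong (d *_) (expTerm-suc B k))) ⟩
  (TB * d + d * (TB * ι (suc k))) * i
    ≡⟨ cong (λ z → (z + d * (TB * ι (suc k))) * i) (sym (*-identityʳ (TB * d))) ⟩
  (TB * d * 1ℚ + d * (TB * ι (suc k))) * i
    ≡⟨ solve 5 (λ t d o n i → (t :* d :* o :+ d :* (t :* n)) :* i := d :* t :* ((o :+ n) :* i)) refl TB d 1ℚ (ι (suc k)) i ⟩
  d * TB * ((1ℚ + ι (suc k)) * i)
    ≡⟨ cong (d * TB *_) (trans (cong (_* i) (sym (ι-suc (suc k)))) (ι*inv (suc k))) ⟩
  d * TB * 1ℚ
    ≡⟨ *-identityʳ _ ⟩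
  d * TB ∎
  where
  open ≤-Reasoning
  Ta = expTerm a (suc k)
  Tb = expTerm b (suc k)
  TB = expTerm B (suc k)
  i = inv (suc k)
  i≥0 = 0≤inv (suc k)
  d = ∣ a - b ∣
  d≥0 = 0≤∣p∣ (a - b)
  B≥0 = ≤-trans (0≤∣p∣ a) ha

module ExpBound (B : ℚ) (B≥0 : 0ℚ ≤ B) where
  T = expTerm B
  S = expSum B

  T≥0 : ∀ k → 0ℚ ≤ T k
  T≥0 = 0≤expTerm B≥0

  n₀ : ℕ
  n₀ = proj₁ (arch (B + B))

  T-halves : ∀ k → n₀ ℕ.≤ k → T (suc k) + T (suc k) ≤ T k
  T-halves k h = begin
    T k * (B * inv k) + T k * (B * inv k)
      ≡⟨ solve 3 (λ t b i → t :* (b :* i) :+ t :* (b :* i) := t :* ((b :+ b) :* i)) refl (T k) B (inv k) ⟩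
    T k * ((B + B) * inv k)
      ≤⟨ mulˡ (T k) (T≥0 k) (mulʳ (inv k) (0≤inv k)
           (≤-trans (proj₂ (arch (B + B))) (ι-mono (ℕ.≤-trans h (ℕ.n≤1+n k))))) ⟩
    T k * (ι (suc k) * inv k)  ≡⟨ cong (T k *_) (ι*inv k) ⟩
    T k * 1ℚ                   ≡⟨ *-identityʳ (T k) ⟩
    T k ∎
    where open ≤-Reasoning

  S-mono : ∀ n i → S n ≤ S (i ℕ.+ n)
  S-mono n zero = ≤-refl
  S-mono n (suc i) = ≤-trans (S-mono n i)
    (subst (_≤ S (suc i ℕ.+ n)) (+-identityʳ _) (+-monoʳ-≤ (S (i ℕ.+ n)) (T≥0 (i ℕ.+ n))))

  S≤ : ∀ n → n₀ ℕ.≤ n → ∀ i → S (i ℕ.+ n) + (T (i ℕ.+ n) + T (i ℕ.+ n)) ≤ S n + (T n + T n)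
  S≤ n h zero = ≤-refl
  S≤ n h (suc i) = ≤-trans
    (≤-trans (+-monoʳ-≤ (S (suc m)) (T-halves m (ℕ.≤-trans h (ℕ.m≤n+m n i))))
      (≤-reflexive (+-assoc (S m) (T m) (T m))))
    (S≤ n h i)
    where m = i ℕ.+ n

  S-tail : ∀ n → n₀ ℕ.≤ n → ∀ i → S (i ℕ.+ n) ≤ S n + (T n + T n)
  S-tail n h i = ≤-trans
    (subst (_≤ S m + (T m + T m)) (+-identityʳ (S m)) (+-monoʳ-≤ (S m) (0≤+ (T≥0 m) (T≥0 m))))
    (S≤ n h i)
    where m = i ℕ.+ n

  C : ℚ
  C = S n₀ + (T n₀ + T n₀)

  S≤C : ∀ n → S n ≤ C
  S≤C n = ≤-trans (subst (λ m → S n ≤ S m) (ℕ.+-comm n₀ n) (S-mono n n₀)) (S-tail n₀ ℕ.≤-refl n)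

  C≥0 : 0ℚ ≤ C
  C≥0 = S≤C 0

  T-decay′ : ∀ j → ι (suc j) * T (j ℕ.+ n₀) ≤ T n₀
  T-decay′ zero = ≤-reflexive (*-identityˡ (T n₀))
  T-decay′ (suc j) = begin
    ι (suc (suc j)) * T′
      ≤⟨ mulʳ T′ (T≥0 (suc j ℕ.+ n₀)) (≤-trans (≤-reflexive (ι-suc (suc j)))
           (+-monoˡ-≤ (ι (suc j)) (ι-mono {1} {suc j} (s≤s z≤n)))) ⟩
    (ι (suc j) + ι (suc j)) * T′
      ≡⟨ solve 2 (λ a t → (a :+ a) :* t := a :* (t :+ t)) refl (ι (suc j)) T′ ⟩
    ι (suc j) * (T′ + T′)
      ≤⟨ mulˡ (ι (suc j)) (0≤ι (suc j)) (T-halves (j ℕ.+ n₀) (ℕ.m≤n+m n₀ j)) ⟩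
    ι (suc j) * T (j ℕ.+ n₀)
      ≤⟨ T-decay′ j ⟩
    T n₀ ∎
    where
    open ≤-Reasoning
    T′ = T (suc j ℕ.+ n₀)

  T-decay : ∀ j → T (j ℕ.+ n₀) ≤ T n₀ * inv j
  T-decay j = subst (_≤ T n₀ * inv j)
    (trans (solve 3 (λ a t i → a :* t :* i := a :* i :* t) refl (ι (suc j)) (T (j ℕ.+ n₀)) (inv j))
      (trans (cong (_* T (j ℕ.+ n₀)) (ι*inv j)) (*-identityˡ _)))
    (mulʳ (inv j) (0≤inv j) (T-decay′ j))

  T-small : ∀ ε → 0ℚ < ε → ∃ λ M → ∀ n → M ℕ.≤ n → n₀ ℕ.≤ n × T n + T n < ε
  T-small ε ε>0 = M ℕ.+ n₀ , go
    where
    M = proj₁ (/-small (T n₀ + T n₀) ε ε>0)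
    go : ∀ n → M ℕ.+ n₀ ℕ.≤ n → n₀ ℕ.≤ n × T n + T n < ε
    go n M≤n = n₀≤n , ≤-<-trans (+-mono-≤ bound bound)
      (subst (_< ε) (*-distribʳ-+ (inv j) (T n₀) (T n₀)) (proj₂ (/-small (T n₀ + T n₀) ε ε>0) j M≤j))
      where
      j = n ℕ.∸ n₀
      n₀≤n : n₀ ℕ.≤ n
      n₀≤n = ℕ.≤-trans (ℕ.m≤n+m n₀ M) M≤n
      M≤j : M ℕ.≤ j
      M≤j = subst (ℕ._≤ j) (ℕ.m+n∸n≡m M n₀) (ℕ.∸-monoˡ-≤ n₀ M≤n)
      bound : T n ≤ T n₀ * inv j
      bound = subst (λ m → T m ≤ T n₀ * inv j) (ℕ.m∸n+n≡m n₀≤n) (T-decay j)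

  sum-lipschitz : ∀ {a b} → ∣ a ∣ ≤ B → ∣ b ∣ ≤ B → ∀ n →
    ∣ expSum a n - expSum b n ∣ ≤ ∣ a - b ∣ * C
  sum-lipschitz {a} {b} ha hb zero = 0≤* (0≤∣p∣ (a - b)) C≥0
  sum-lipschitz {a} {b} ha hb (suc n) = ≤-trans (go n) (mulˡ _ (0≤∣p∣ (a - b)) (S≤C n))
    where
    go : ∀ n → ∣ expSum a (suc n) - expSum b (suc n) ∣ ≤ ∣ a - b ∣ * S n
    go zero = ≤-reflexive (sym (*-zeroʳ ∣ a - b ∣))
    go (suc n) = begin
      ∣ (Sa + ta) - (Sb + tb) ∣
        ≡⟨ cong ∣_∣ (solve 4 (λ x y u v → (x :+ u) :- (y :+ v) := (x :- y) :+ (u :- v)) refl Sa Sb ta tb) ⟩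
      ∣ (Sa - Sb) + (ta - tb) ∣
        ≤⟨ ∣p+q∣≤∣p∣+∣q∣ (Sa - Sb) (ta - tb) ⟩
      ∣ Sa - Sb ∣ + ∣ ta - tb ∣
        ≤⟨ +-mono-≤ (go n) (expTerm-lipschitz {a} {b} ha hb n) ⟩
      ∣ a - b ∣ * S n + ∣ a - b ∣ * T n
        ≡⟨ sym (*-distribˡ-+ ∣ a - b ∣ (S n) (T n)) ⟩
      ∣ a - b ∣ * S (suc n) ∎
      where
      open ≤-Reasoning
      Sa = expSum a (suc n)
      Sb = expSum b (suc n)
      ta = expTerm a (suc n)
      tb = expTerm b (suc n)

  sum-tail : ∀ {a} → ∣ a ∣ ≤ B → ∀ n → n₀ ℕ.≤ n → ∀ i →
    ∣ expSum a n - expSum a (i ℕ.+ n) ∣ ≤ T n + T n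
  sum-tail {a} ha n h i = ≤-trans (≤-trans (≤-reflexive (∣-∣-comm (expSum a n) _)) (go i)) (≤+⇒-≤ {S (i ℕ.+ n)} {S n} (S-tail n h i))
    where
    go : ∀ i → ∣ expSum a (i ℕ.+ n) - expSum a n ∣ ≤ S (i ℕ.+ n) - S n
    go zero = ≤-reflexive (trans (cong ∣_∣ (+-inverseʳ (expSum a n))) (sym (+-inverseʳ (S n))))
    go (suc i) = begin
      ∣ (x + t) - y ∣  ≡⟨ cong ∣_∣ (solve 3 (λ x t y → x :+ t :- y := (x :- y) :+ t) refl x t y) ⟩
      ∣ (x - y) + t ∣  ≤⟨ ∣p+q∣≤∣p∣+∣q∣ (x - y) t ⟩
      ∣ x - y ∣ + ∣ t ∣  ≤⟨ +-mono-≤ (go i) (∣expTerm∣≤ ha (i ℕ.+ n)) ⟩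
      (S (i ℕ.+ n) - S n) + T (i ℕ.+ n)
        ≡⟨ solve 3 (λ x t y → (x :- y) :+ t := x :+ t :- y) refl (S (i ℕ.+ n)) (T (i ℕ.+ n)) (S n) ⟩
      S (suc i ℕ.+ n) - S n ∎
      where
      open ≤-Reasoning
      x = expSum a (i ℕ.+ n)
      y = expSum a n
      t = expTerm a (i ℕ.+ n)

½+½ : ∀ ε → ½ * ε + ½ * ε ≡ ε
½+½ ε = trans (sym (*-distribʳ-+ ε ½ ½)) (*-identityˡ ε)

exp-cauchy′ : ∀ {a} B (B≥0 : 0ℚ ≤ B) M₁ → (∀ n → M₁ ℕ.≤ n → ∣ a n ∣ ≤ B) →
  Cauchy a → Cauchy (λ n → expSum (a n) n)
exp-cauchy′ {a} B B≥0 M₁ bd h = cauchy-ordered {λ n → expSum (a n) n} go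
  where
  open ExpBound B B≥0
  go : ∀ ε → 0ℚ < ε → ∃ λ M → ∀ m n → M ℕ.≤ m → m ℕ.≤ n →
    ∣ expSum (a m) m - expSum (a n) n ∣ < ε
  go ε ε>0 = M , close
    where
    ε/2>0 : 0ℚ < ½ * ε
    ε/2>0 = 0<* {½} {ε} (positive⁻¹ ½) ε>0
    cs = *-small C (½ * ε) C≥0 ε/2>0
    hc = h (proj₁ cs) (proj₁ (proj₂ cs))
    ts = T-small (½ * ε) ε/2>0
    M₂ = proj₁ hc
    M₃ = proj₁ ts
    M = M₁ ℕ.+ (M₂ ℕ.+ M₃)
    le₁ : M₁ ℕ.≤ M
    le₁ = ℕ.m≤m+n M₁ _
    le₂ : M₂ ℕ.≤ M
    le₂ = ℕ.≤-trans (ℕ.m≤m+n M₂ M₃) (ℕ.m≤n+m _ M₁)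
    le₃ : M₃ ℕ.≤ M
    le₃ = ℕ.≤-trans (ℕ.m≤n+m M₃ M₂) (ℕ.m≤n+m _ M₁)
    close : ∀ m n → M ℕ.≤ m → m ℕ.≤ n → ∣ expSum (a m) m - expSum (a n) n ∣ < ε
    close m n M≤m m≤n = ≤-<-trans
      (≤-trans (≤-reflexive (cong ∣_∣ (solve 3 (λ x y z → x :- z := (x :- y) :+ (y :- z)) refl x y z)))
        (∣p+q∣≤∣p∣+∣q∣ (x - y) (y - z)))
      (<-≤-trans (+-mono-< {∣ x - y ∣} {½ * ε} {∣ y - z ∣} {½ * ε} d₁ d₂) (≤-reflexive (½+½ ε)))
      where
      x = expSum (a m) m
      y = expSum (a n) m
      z = expSum (a n) n
      M≤n : M ℕ.≤ n
      M≤n = ℕ.≤-trans M≤m m≤n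
      bm : ∣ a m ∣ ≤ B
      bm = bd m (ℕ.≤-trans le₁ M≤m)
      bn : ∣ a n ∣ ≤ B
      bn = bd n (ℕ.≤-trans le₁ M≤n)
      d₁ : ∣ x - y ∣ < ½ * ε
      d₁ = ≤-<-trans (≤-trans (sum-lipschitz {a m} {a n} bm bn m) (≤-reflexive (*-comm ∣ a m - a n ∣ C)))
        (proj₂ (proj₂ cs) ∣ a m - a n ∣ (0≤∣p∣ (a m - a n))
          (proj₂ hc m n (ℕ.≤-trans le₂ M≤m) (ℕ.≤-trans le₂ M≤n)))
      tm : n₀ ℕ.≤ m × T m + T m < ½ * ε
      tm = proj₂ ts m (ℕ.≤-trans le₃ M≤m)
      d₂ : ∣ y - z ∣ < ½ * ε
      d₂ = ≤-<-trans (subst (λ k → ∣ y - expSum (a n) k ∣ ≤ T m + T m) (ℕ.m∸n+n≡m m≤n)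
        (sum-tail {a n} bn m (proj₁ tm) (n ℕ.∸ m))) (proj₂ tm)

exp-cauchy : ∀ {a} → Cauchy a → Cauchy (λ n → expSum (a n) n)
exp-cauchy {a} h = exp-cauchy′ {a} B (≤-trans (0≤∣p∣ (a M)) (bd M ℕ.≤-refl)) M bd h
  where
  M = proj₁ (cauchy-bounded {a} h)
  B = proj₁ (proj₂ (cauchy-bounded {a} h))
  bd = proj₂ (proj₂ (cauchy-bounded {a} h))

-- The diagonal sequence converges to exp x because the power series converges
-- uniformly on bounded sets.
exp : ℝ → ℝ
exp x = mkℝ (λ n → expSum (approx x n) n) (exp-cauchy (cauchy x))

recipSum : ℕ → ℕ → ℚ
recipSum s n = Σ[i< n ] (λ i → inv (s ℕ.+ i))

recipSum-+ : ∀ s a b → recipSum s (a ℕ.+ b) ≡ recipSum s a + recipSum (s ℕ.+ a) b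
recipSum-+ s a zero rewrite ℕ.+-identityʳ a = sym (+-identityʳ (recipSum s a))
recipSum-+ s a (suc b) rewrite ℕ.+-suc a b = trans
  (cong₂ _+_ (recipSum-+ s a b) (cong inv (sym (ℕ.+-assoc s a b))))
  (+-assoc (recipSum s a) (recipSum (s ℕ.+ a) b) (inv (s ℕ.+ a ℕ.+ b)))

ι-suc* : ∀ n p → ι (suc n) * p ≡ ι n * p + p
ι-suc* n p = trans (cong (_* p) (ι-suc n))
  (trans (*-distribʳ-+ p 1ℚ (ι n)) (trans (cong (_+ ι n * p) (*-identityˡ p)) (+-comm p (ι n * p))))

recipSum-lower : ∀ s n t → s ℕ.+ n ℕ.≤ suc t → ι n * inv t ≤ recipSum s n
recipSum-lower s zero t h = ≤-reflexive (*-zeroˡ (inv t))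
recipSum-lower s (suc n) t h = ≤-trans (≤-reflexive (ι-suc* n (inv t)))
  (+-mono-≤ (recipSum-lower s n t (ℕ.≤-trans (ℕ.+-monoʳ-≤ s (ℕ.n≤1+n n)) h))
    (inv-anti (ℕ.≤-pred (subst (ℕ._≤ suc t) (ℕ.+-suc s n) h))))

recipSum-upper : ∀ s n t → t ℕ.≤ s → recipSum s n ≤ ι n * inv t
recipSum-upper s zero t h = ≤-reflexive (sym (*-zeroˡ (inv t)))
recipSum-upper s (suc n) t h = ≤-trans
  (+-mono-≤ (recipSum-upper s n t h) (inv-anti (ℕ.≤-trans h (ℕ.m≤m+n s n))))
  (≤-reflexive (sym (ι-suc* n (inv t))))

-- n·1/(sn) = 1/s, shifted to s + 1 and n + 1
inv-refine : ∀ s n → ι (suc n) * inv (n ℕ.+ s ℕ.* suc n) ≡ inv s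
inv-refine s n = trans (/-*-/ (suc n) 0 1 (n ℕ.+ s ℕ.* suc n))
  (/-cross (suc n ℕ.* 1) (n ℕ.+ s ℕ.* suc n ℕ.+ 0) 1 s
    (trans (cong (ℕ._* suc s) (ℕ.*-identityʳ (suc n)))
      (trans (ℕ.*-comm (suc n) (suc s))
        (sym (trans (ℕ.*-identityˡ _) (ℕ.+-identityʳ (suc s ℕ.* suc n)))))))

refineʳ : ∀ n s k → recipSum s k ≤ recipSum (s ℕ.* suc n) (k ℕ.* suc n)
refineʳ n s zero = ≤-refl
refineʳ n s (suc k) = ≤-trans (+-mono-≤ (refineʳ n s k) block)
  (≤-reflexive (sym (trans (cong (recipSum (s ℕ.* suc n)) (ℕ.+-comm (suc n) (k ℕ.* suc n)))
    (trans (recipSum-+ (s ℕ.* suc n) (k ℕ.* suc n) (suc n))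
      (cong (λ t → recipSum (s ℕ.* suc n) (k ℕ.* suc n) + recipSum t (suc n))
        (sym (ℕ.*-distribʳ-+ (suc n) s k)))))))
  where
  t = (s ℕ.+ k) ℕ.* suc n
  block : inv (s ℕ.+ k) ≤ recipSum t (suc n)
  block = ≤-trans (≤-reflexive (sym (inv-refine (s ℕ.+ k) n)))
    (recipSum-lower t (suc n) (n ℕ.+ t) (ℕ.≤-reflexive (ℕ.+-comm t (suc n))))

refineˡ : ∀ n s k → recipSum (n ℕ.+ s ℕ.* suc n) (k ℕ.* suc n) ≤ recipSum s k
refineˡ n s zero = ≤-refl
refineˡ n s (suc k) = ≤-trans
  (≤-reflexive (trans (cong (recipSum (n ℕ.+ s ℕ.* suc n)) (ℕ.+-comm (suc n) (k ℕ.* suc n)))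
    (trans (recipSum-+ (n ℕ.+ s ℕ.* suc n) (k ℕ.* suc n) (suc n))
      (cong (λ t → recipSum (n ℕ.+ s ℕ.* suc n) (k ℕ.* suc n) + recipSum t (suc n))
        (trans (ℕ.+-assoc n (s ℕ.* suc n) (k ℕ.* suc n))
          (cong (n ℕ.+_) (sym (ℕ.*-distribʳ-+ (suc n) s k))))))))
  (+-mono-≤ (refineˡ n s k) block)
  where
  t = n ℕ.+ (s ℕ.+ k) ℕ.* suc n
  block : recipSum t (suc n) ≤ inv (s ℕ.+ k)
  block = ≤-trans (recipSum-upper t (suc n) t ℕ.≤-refl) (≤-reflexive (inv-refine (s ℕ.+ k) n))

recipSum-anti : ∀ s k → recipSum (suc s) k ≤ recipSum s k
recipSum-anti s zero = ≤-refl
recipSum-anti s (suc k) = +-mono-≤ (recipSum-anti s k) (inv-anti (ℕ.n≤1+n (s ℕ.+ k)))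

recipSum-shift : ∀ s k → recipSum s k ≤ recipSum (suc s) k + inv s
recipSum-shift s k = ≤-trans
  (subst (_≤ recipSum s (suc k)) (+-identityʳ _) (+-monoʳ-≤ (recipSum s k) (0≤inv (s ℕ.+ k))))
  (≤-reflexive (trans (recipSum-+ s 1 k)
    (trans (cong₂ _+_ (trans (+-identityˡ _) (cong inv (ℕ.+-identityʳ s)))
        (cong (λ t → recipSum t k) (ℕ.+-comm s 1)))
      (+-comm (inv s) (recipSum (suc s) k)))))

-- Right Riemann sum of ∫ dt/t over [1, 1+k] with mesh 1/N, where N = n + 1: the
-- i-th term is (1/N) · 1/(1 + (i+1)/N) = 1/(N+i+1).
logSum : ℕ → ℕ → ℚ
logSum k n = Σ[i< k ℕ.* suc n ] (λ i → + 1 / suc (suc n ℕ.+ i))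

logSum-close : ∀ k m n → logSum k m ≤ logSum k n + inv n
logSum-close k m n = begin
  recipSum (suc m) (k ℕ.* suc m)
    ≤⟨ refineʳ n (suc m) (k ℕ.* suc m) ⟩
  recipSum (suc m ℕ.* suc n) (k ℕ.* suc m ℕ.* suc n)
    ≤⟨ recipSum-anti (n ℕ.+ m ℕ.* suc n) (k ℕ.* suc m ℕ.* suc n) ⟩
  recipSum (ℕ.pred (suc m ℕ.* suc n)) (k ℕ.* suc m ℕ.* suc n)
    ≡⟨ cong₂ (λ a b → recipSum (ℕ.pred a) b) (ℕ.*-comm (suc m) (suc n)) lem ⟩
  recipSum (m ℕ.+ n ℕ.* suc m) (k ℕ.* suc n ℕ.* suc m)
    ≤⟨ refineˡ m n (k ℕ.* suc n) ⟩
  recipSum n (k ℕ.* suc n)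
    ≤⟨ recipSum-shift n (k ℕ.* suc n) ⟩
  recipSum (suc n) (k ℕ.* suc n) + inv n ∎
  where
  open ≤-Reasoning
  lem : k ℕ.* suc m ℕ.* suc n ≡ k ℕ.* suc n ℕ.* suc m
  lem = trans (ℕ.*-assoc k (suc m) (suc n))
    (trans (cong (k ℕ.*_) (ℕ.*-comm (suc m) (suc n))) (sym (ℕ.*-assoc k (suc n) (suc m))))

logSum-cauchy : ∀ k → Cauchy (logSum k)
logSum-cauchy k = cauchy-rate {logSum k} 1ℚ λ m n m≤n → ≤-trans
  (abs-≤ {logSum k m - logSum k n} {inv m}
    (≤-trans (≤+⇒-≤ {logSum k m} {logSum k n} (logSum-close k m n)) (inv-anti m≤n))
    (≤-trans (≤-reflexive (solve 2 (λ a b → :- (a :- b) := b :- a) refl (logSum k m) (logSum k n)))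
      (≤+⇒-≤ {logSum k n} {logSum k m} (logSum-close k n m))))
  (≤-reflexive (sym (*-identityˡ (inv m))))

-- log K = ∫ dt/t over [1, K]
log : (K : ℕ) .{{_ : ℕ.NonZero K}} → ℝ
log K = mkℝ (logSum (K ℕ.∸ 1)) (logSum-cauchy (K ℕ.∸ 1))

-- a, a+1, …, a+n-1
range : ℤ → ℕ → List ℤ
range a zero = []
range a (suc n) = a ∷ range (ℤ.suc a) n

count : {P : Pred ℤ 0ℓ} → Decidable P → ℤ → ℕ → ℕ
count P? a n = length (filter P? (range a n))

module Counting {P : Pred ℤ 0ℓ} (P? : Decidable P) where

  c : ℤ → ℕ → ℕ
  c = count P?

  count-∷ : ∀ a n → c a (suc n) ≡ c a 1 ℕ.+ c (ℤ.suc a) n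
  count-∷ a n with P? a
  ... | yes _ = refl
  ... | no _ = refl

  count-+ : ∀ m n a → c a (m ℕ.+ n) ≡ c a m ℕ.+ c (a ℤ.+ + m) n
  count-+ zero n a = cong (λ b → c b n) (sym (ℤ.+-identityʳ a))
  count-+ (suc m) n a = begin
    c a (suc m ℕ.+ n)                                  ≡⟨ count-∷ a (m ℕ.+ n) ⟩
    c a 1 ℕ.+ c (ℤ.suc a) (m ℕ.+ n)                    ≡⟨ cong (c a 1 ℕ.+_) (count-+ m n (ℤ.suc a)) ⟩
    c a 1 ℕ.+ (c (ℤ.suc a) m ℕ.+ c (ℤ.suc a ℤ.+ + m) n)  ≡⟨ sym (ℕ.+-assoc (c a 1) _ _) ⟩
    c a 1 ℕ.+ c (ℤ.suc a) m ℕ.+ c (ℤ.suc a ℤ.+ + m) n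
      ≡⟨ cong₂ (λ x b → x ℕ.+ c b n) (sym (count-∷ a m)) shift ⟩
    c a (suc m) ℕ.+ c (a ℤ.+ + suc m) n ∎
    where
    open ≡-Reasoning
    shift : ℤ.suc a ℤ.+ + m ≡ a ℤ.+ + suc m
    shift = trans (cong (ℤ._+ + m) (ℤ.+-comm ℤ.1ℤ a)) (ℤ.+-assoc a ℤ.1ℤ (+ m))

  length-range : ∀ a n → length (range a n) ≡ n
  length-range a zero = refl
  length-range a (suc n) = cong suc (length-range (ℤ.suc a) n)

  count≤ : ∀ a n → c a n ℕ.≤ n
  count≤ a n = subst (c a n ℕ.≤_) (length-range a n) (length-filter P? (range a n))

  module Periodic (l : ℕ)
                  (fwd : ∀ {a} → P a → P (a ℤ.+ + suc l))
                  (bwd : ∀ {a} → P (a ℤ.+ + suc l) → P a) where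

    L : ℕ
    L = suc l

    one : ∀ a → c (a ℤ.+ + L) 1 ≡ c a 1
    one a with P? a | P? (a ℤ.+ + L)
    ... | yes _ | yes _ = refl
    ... | no _  | no _  = refl
    ... | yes p | no ¬p = contradiction (fwd p) ¬p
    ... | no ¬p | yes p = contradiction (bwd p) ¬p

    window-suc : ∀ a → c (ℤ.suc a) L ≡ c a L
    window-suc a = ℕ.+-cancelˡ-≡ (c a 1) _ _ (begin
      c a 1 ℕ.+ c (ℤ.suc a) L        ≡⟨ sym (count-∷ a L) ⟩
      c a (suc L)                    ≡⟨ cong (c a) (ℕ.+-comm 1 L) ⟩
      c a (L ℕ.+ 1)                  ≡⟨ count-+ L 1 a ⟩
      c a L ℕ.+ c (a ℤ.+ + L) 1      ≡⟨ cong (c a L ℕ.+_) (one a) ⟩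
      c a L ℕ.+ c a 1                ≡⟨ ℕ.+-comm (c a L) (c a 1) ⟩
      c a 1 ℕ.+ c a L ∎)
      where open ≡-Reasoning

    S : ℕ
    S = c ℤ.0ℤ L

    window : ∀ a → c a L ≡ S
    window (+ zero) = refl
    window (+ suc n) = trans (window-suc (+ n)) (window (+ n))
    window -[1+ zero ] = sym (window-suc -[1+ 0 ])
    window -[1+ suc n ] = trans (sym (window-suc -[1+ suc n ])) (window -[1+ n ])

    windows : ∀ k a → c a (k ℕ.* L) ≡ k ℕ.* S
    windows zero a = refl
    windows (suc k) a = trans (count-+ L (k ℕ.* L) a)
      (cong₂ ℕ._+_ (window a) (windows k (a ℤ.+ + L)))

    count-split : ∀ a n → ∃ λ k → ∃ λ r → ∃ λ e →
      r ℕ.≤ L × e ℕ.≤ L × n ≡ k ℕ.* L ℕ.+ r × c a n ≡ k ℕ.* S ℕ.+ e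
    count-split a n = k , r , e , ℕ.m%n≤n n L , ℕ.≤-trans (count≤ _ r) (ℕ.m%n≤n n L) , n≡ ,
      trans (cong (c a) n≡) (trans (count-+ (k ℕ.* L) r a) (cong (ℕ._+ e) (windows k a)))
      where
      k = n ℕ./ L
      r = n ℕ.% L
      e = c (a ℤ.+ + (k ℕ.* L)) r
      n≡ : n ≡ k ℕ.* L ℕ.+ r
      n≡ = trans (ℕ.m≡m%n+[m/n]*n n L) (ℕ.+-comm r (k ℕ.* L))

    count-bounds : ∀ a n → c a n ℕ.* L ℕ.≤ S ℕ.* n ℕ.+ L ℕ.* L × S ℕ.* n ℕ.≤ c a n ℕ.* L ℕ.+ L ℕ.* L
    count-bounds a n with count-split a n
    ... | k , r , e , r≤L , e≤L , refl , eq rewrite eq = up , down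
      where
      open ℕ.≤-Reasoning
      up : (k ℕ.* S ℕ.+ e) ℕ.* L ℕ.≤ S ℕ.* (k ℕ.* L ℕ.+ r) ℕ.+ L ℕ.* L
      up = begin
        (k ℕ.* S ℕ.+ e) ℕ.* L           ≡⟨ ℕ.*-distribʳ-+ L (k ℕ.* S) e ⟩
        k ℕ.* S ℕ.* L ℕ.+ e ℕ.* L       ≤⟨ ℕ.+-mono-≤ (ℕ.≤-reflexive kSL) (ℕ.*-monoˡ-≤ L e≤L) ⟩
        S ℕ.* (k ℕ.* L) ℕ.+ L ℕ.* L     ≤⟨ ℕ.+-monoˡ-≤ (L ℕ.* L) (ℕ.*-monoʳ-≤ S (ℕ.m≤m+n (k ℕ.* L) r)) ⟩
        S ℕ.* (k ℕ.* L ℕ.+ r) ℕ.+ L ℕ.* L ∎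
        where
        kSL : k ℕ.* S ℕ.* L ≡ S ℕ.* (k ℕ.* L)
        kSL = trans (cong (ℕ._* L) (ℕ.*-comm k S)) (ℕ.*-assoc S k L)
      down : S ℕ.* (k ℕ.* L ℕ.+ r) ℕ.≤ (k ℕ.* S ℕ.+ e) ℕ.* L ℕ.+ L ℕ.* L
      down = begin
        S ℕ.* (k ℕ.* L ℕ.+ r)           ≡⟨ ℕ.*-distribˡ-+ S (k ℕ.* L) r ⟩
        S ℕ.* (k ℕ.* L) ℕ.+ S ℕ.* r     ≤⟨ ℕ.+-mono-≤ (ℕ.≤-reflexive SkL) (ℕ.*-mono-≤ (count≤ ℤ.0ℤ L) r≤L) ⟩
        k ℕ.* S ℕ.* L ℕ.+ L ℕ.* L       ≤⟨ ℕ.+-monoˡ-≤ (L ℕ.* L) (ℕ.*-monoˡ-≤ L (ℕ.m≤m+n (k ℕ.* S) e)) ⟩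
        (k ℕ.* S ℕ.+ e) ℕ.* L ℕ.+ L ℕ.* L ∎
        where
        SkL : S ℕ.* (k ℕ.* L) ≡ k ℕ.* S ℕ.* L
        SkL = trans (sym (ℕ.*-assoc S k L)) (cong (ℕ._* L) (ℕ.*-comm S k))

    density-close : ∀ a n → ∣ c a (suc n) /ₙ suc n - S /ₙ L ∣ ≤ L /ₙ suc n
    density-close a n = abs-≤ {x - y} {z}
      (≤+⇒-≤ {x} {y} (subst (x ≤_) (sym (/-+-/ S l L n)) (/-mono-≤ C n (S ℕ.* N ℕ.+ L ℕ.* L) (n ℕ.+ l ℕ.* N) up)))
      (≤-trans (≤-reflexive (solve 2 (λ a b → :- (a :- b) := b :- a) refl x y))
        (≤+⇒-≤ {y} {x} (subst (y ≤_) (sym (/-+-/ C n L n)) (/-mono-≤ S l (C ℕ.* N ℕ.+ L ℕ.* N) (n ℕ.+ n ℕ.* N) down))))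
      where
      N = suc n
      C = c a N
      x = C /ₙ N
      y = S /ₙ L
      z = L /ₙ N
      open ℕ.≤-Reasoning
      up : C ℕ.* (L ℕ.* N) ℕ.≤ (S ℕ.* N ℕ.+ L ℕ.* L) ℕ.* N
      up = begin
        C ℕ.* (L ℕ.* N)  ≡⟨ sym (ℕ.*-assoc C L N) ⟩
        C ℕ.* L ℕ.* N    ≤⟨ ℕ.*-monoˡ-≤ N (proj₁ (count-bounds a N)) ⟩
        (S ℕ.* N ℕ.+ L ℕ.* L) ℕ.* N ∎
      down : S ℕ.* (N ℕ.* N) ℕ.≤ (C ℕ.* N ℕ.+ L ℕ.* N) ℕ.* L
      down = begin
        S ℕ.* (N ℕ.* N)                       ≡⟨ sym (ℕ.*-assoc S N N) ⟩
        S ℕ.* N ℕ.* N                         ≤⟨ ℕ.*-monoˡ-≤ N (proj₂ (count-bounds a N)) ⟩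
        (C ℕ.* L ℕ.+ L ℕ.* L) ℕ.* N           ≡⟨ cong (ℕ._* N) (sym (ℕ.*-distribʳ-+ L C L)) ⟩
        (C ℕ.+ L) ℕ.* L ℕ.* N                 ≡⟨ ℕ.*-assoc (C ℕ.+ L) L N ⟩
        (C ℕ.+ L) ℕ.* (L ℕ.* N)               ≡⟨ cong ((C ℕ.+ L) ℕ.*_) (ℕ.*-comm L N) ⟩
        (C ℕ.+ L) ℕ.* (N ℕ.* L)               ≡⟨ sym (ℕ.*-assoc (C ℕ.+ L) N L) ⟩
        (C ℕ.+ L) ℕ.* N ℕ.* L                 ≡⟨ cong (ℕ._* L) (ℕ.*-distribʳ-+ N C L) ⟩
        (C ℕ.* N ℕ.+ L ℕ.* N) ℕ.* L ∎

    /ₙ-rate : ∀ m n → m ℕ.≤ n → L /ₙ suc (2 ℕ.* n) ≤ ι L * inv m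
    /ₙ-rate m n m≤n = subst (L /ₙ suc (2 ℕ.* n) ≤_) (sym (/-*-/ L 0 1 m))
      (/-mono-≤ L (2 ℕ.* n) (L ℕ.* 1) (m ℕ.+ 0)
        (ℕ.*-mono-≤ (ℕ.≤-reflexive (sym (ℕ.*-identityʳ L)))
          (s≤s (ℕ.≤-trans (ℕ.≤-reflexive (ℕ.+-identityʳ m)) (ℕ.≤-trans m≤n (ℕ.m≤m+n n _))))))

    density-cauchy : Cauchy (λ X → c (ℤ.- + X) (suc (2 ℕ.* X)) /ₙ suc (2 ℕ.* X))
    density-cauchy = cauchy-rate {f} (ι L + ι L) bound
      where
      f : ℕ → ℚ
      f X = c (ℤ.- + X) (suc (2 ℕ.* X)) /ₙ suc (2 ℕ.* X)
      y = S /ₙ L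
      bound : ∀ m n → m ℕ.≤ n → ∣ f m - f n ∣ ≤ (ι L + ι L) * inv m
      bound m n m≤n = begin
        ∣ f m - f n ∣
          ≡⟨ cong ∣_∣ (solve 3 (λ u v w → u :- w := (u :- v) :+ (v :- w)) refl (f m) y (f n)) ⟩
        ∣ (f m - y) + (y - f n) ∣     ≤⟨ ∣p+q∣≤∣p∣+∣q∣ (f m - y) (y - f n) ⟩
        ∣ f m - y ∣ + ∣ y - f n ∣     ≡⟨ cong (_+_ ∣ f m - y ∣) (∣-∣-comm y (f n)) ⟩
        ∣ f m - y ∣ + ∣ f n - y ∣
          ≤⟨ +-mono-≤ (≤-trans (density-close (ℤ.- + m) (2 ℕ.* m)) (/ₙ-rate m m ℕ.≤-refl))
                      (≤-trans (density-close (ℤ.- + n) (2 ℕ.* n)) (/ₙ-rate m n m≤n)) ⟩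
        ι L * inv m + ι L * inv m     ≡⟨ sym (*-distribʳ-+ (inv m) (ι L) (ι L)) ⟩
        (ι L + ι L) * inv m ∎
        where open ≤-Reasoning

record ResidueClass : Set where
  field
    modulus residue : ℕ
    .{{modulus≢0}} : ℕ.NonZero modulus
    .{{residue≢0}} : ℕ.NonZero residue
open ResidueClass public

-- A list stands for the finite set of its entries; R does not depend on order or
-- repetition, and distinct moduli exclude repetition.
ResidueSystem : Set
ResidueSystem = List ResidueClass

DistinctModuli : ResidueSystem → Set
DistinctModuli C = Unique (map modulus C)

ModuliFrom⟨_,_] : ℕ → ℕ → ResidueSystem → Set
ModuliFrom⟨ a , b ] C = All (λ c → a ℕ.< modulus c × modulus c ℕ.≤ b) C

infix 4 _≡_[mod_]
_≡_[mod_] : ℤ → ℤ → ℕ → Set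
a ≡ b [mod n ] = + n ℤ.∣ a ℤ.- b

-- The integers covered by no class of C.
R : ResidueSystem → Pred ℤ 0ℓ
R C m = All (λ c → ¬ m ≡ + residue c [mod modulus c ]) C

R? : ∀ C → Decidable (R C)
R? C m = all? (λ c → ¬? (+ modulus c ℤ.∣? (m ℤ.- + residue c))) C

R-shift : ∀ C P → (∀ {c} → c ∈ C → + modulus c ℤ.∣ P) →
  (∀ {a} → R C a → R C (a ℤ.+ P)) × (∀ {a} → R C (a ℤ.+ P) → R C a)
R-shift C P h = (λ {a} ra → All.tabulate λ {c} c∈C d → All.lookup ra c∈C
                   (ℤ.∣m+n∣n⇒∣m (subst (+ modulus c ℤ.∣_) (eq a c) d) (h c∈C)))
              , (λ {a} ra → All.tabulate λ {c} c∈C d → All.lookup ra c∈C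
                   (subst (+ modulus c ℤ.∣_) (sym (eq a c)) (ℤ.∣m∣n⇒∣m+n d (h c∈C))))
  where
  eq : ∀ a c → a ℤ.+ P ℤ.- + residue c ≡ a ℤ.- + residue c ℤ.+ P
  eq a c = trans (ℤ.+-assoc a P (ℤ.- + residue c))
    (trans (cong (ℤ._+_ a) (ℤ.+-comm P (ℤ.- + residue c))) (sym (ℤ.+-assoc a (ℤ.- + residue c) P)))

period : ∀ C → ∃ λ l → ∀ {c} → c ∈ C → + modulus c ℤ.∣ + suc l
period C with product (map modulus C) in eq
            | product≢0 {map modulus C} (All.map⁺ (All.universal modulus≢0′ C))
  where
  modulus≢0′ : ∀ c → ℕ.NonZero (modulus c)
  modulus≢0′ c = ℕ.≢-nonZero (ℕ.≢-nonZero⁻¹ (modulus c))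
... | suc l | _ = l , λ {c} c∈C →
  ℤ.∣ᵤ⇒∣ (subst (ℕ._∣_ (modulus c)) eq (∈⇒∣product (∈-map⁺ modulus c∈C)))

-- Asymptotic density of R C: the limit of #(R C ∩ [-X, X]) / (2X+1).
δ : ResidueSystem → ℝ
δ C = mkℝ (λ X → + count (R? C) (ℤ.- + X) (suc (2 ℕ.* X)) / suc (2 ℕ.* X))
  (Counting.Periodic.density-cauchy (R? C) (proj₁ (period C))
    (λ {a} → proj₁ sh {a}) (λ {a} → proj₂ sh {a}))
  where sh = R-shift C (+ suc (proj₁ (period C))) (proj₂ (period C))

{-# OPTIONS --safe #-}
-- Choosing for each modulus n the residue class that meets the uncovered set most
-- multiplies the uncovered density by at most 1 - 1/n, and ∏ (1 - 1/n) over (N, KN]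
-- is exactly 1/K. The extra factor comes from residues mod n that are already
-- covered: if the divisors of n in D = (N, N + κ₀] have classes covering a proportion
-- γ of the residues mod n, the density drops by at least the factor
-- 1 - (1 + γ)/n = (1 - 1/n)(1 - γ/(n-1)). By Bonferroni γ is at least
-- Σ 1/d - Σ 1/lcm(d, d′) over the d < d′ in D dividing n, whatever classes were
-- chosen, so summing γ/(n-1) over n gives (A - O) log K + O(A), where A = Σ 1/d² and
-- O = Σ 1/lcm(d, d′)² over D. With κ₀ about N one has N (A - O) > 1/3.
module Submission where

open import Defs
open import Data.Nat as ℕ using (ℕ; zero; suc; z≤n; s≤s)
open import Data.Nat.Base using (_!)
import Data.Nat.Properties as ℕ
import Data.Nat.DivMod as ℕ
import Data.Nat.Divisibility as ℕ
import Data.Nat.GCD as ℕ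
import Data.Nat.LCM as ℕ
open import Data.Nat.Tactic.RingSolver using (solve-∀)
import Data.Integer as ℤ
import Data.Integer.Properties as ℤ
import Data.Integer.Divisibility.Signed as ℤ
open import Data.Rational
open import Data.Rational.Properties
open import Data.Rational.Solver using (module +-*-Solver)
open import Data.List using ([]; _∷_)
open import Data.List.Membership.Propositional using (_∈_)
open import Data.List.Relation.Unary.All as All using (All; []; _∷_)
import Data.List.Relation.Unary.All.Properties as All
open import Data.List.Relation.Unary.AllPairs using ([]; _∷_)
open import Data.Product using (∃; _×_; _,_; proj₁; proj₂)
open import Data.Sum using (_⊎_; inj₁; inj₂)
open import Relation.Nullary
open import Relation.Nullary.Decidable using (from-yes)
open import Relation.Binary.PropositionalEquality
open +-*-Solver using (solve; _:+_; _:*_; _:-_; :-_; _:=_; con)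

-- Finite sums and reciprocals

-- The factor 1 + γ arises because the uncovered integers occupy at most (1 - γ)n residues mod n, so
-- the fullest residue holds at least a share 1/((1 - γ)n) ≥ (1 + γ)/n of them. The margin is thin.
-- For κ₀ = N the product NA tends to only 1/2, and sorting pairs by their common divisors bounds NO
-- by 18/121 for every N. From N = 28 on, NA ≥ 46/95, which leaves a little more than 1/3. The
-- finitely many smaller N are settled by evaluation with κ₀ = N + 3. All counting takes place in
-- the window [0, (KN)!), a common period of the classes, so densities are exact fractions.
-- Logarithms enter only through the upper bound log K ≤ H K + 1. The inequality 1 - x ≤ exp(-x) is
-- proved for truncated series, and the functional equation of exp is replaced by an estimate for
-- products of truncations.

ι-+ : ∀ m n → ι (m ℕ.+ n) ≡ ι m + ι n
ι-+ m n = sym (trans (/-+-/ m 0 n 0) (cong (_/ₙ 1) (cong₂ ℕ._+_ (ℕ.*-identityʳ m) (ℕ.*-identityʳ n))))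

ι-* : ∀ m n → ι (m ℕ.* n) ≡ ι m * ι n
ι-* m n = sym (/-*-/ m 0 n 0)

opaque
  -- a / (b + 1), opaque because unfolding normalised fractions blocks unification
  frac : ℕ → ℕ → ℚ
  frac a b = a /ₙ suc b

  frac-+ : ∀ a b c d → frac a b + frac c d ≡ frac (a ℕ.* suc d ℕ.+ c ℕ.* suc b) (d ℕ.+ b ℕ.* suc d)
  frac-+ = /-+-/

  frac-* : ∀ a b c d → frac a b * frac c d ≡ frac (a ℕ.* c) (d ℕ.+ b ℕ.* suc d)
  frac-* = /-*-/

  frac-≤ : ∀ a b c d → a ℕ.* suc d ℕ.≤ c ℕ.* suc b → frac a b ≤ frac c d
  frac-≤ = /-mono-≤

  frac-≡ : ∀ a b c d → a ℕ.* suc d ≡ c ℕ.* suc b → frac a b ≡ frac c d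
  frac-≡ = /-cross

  frac-/ : ∀ a b → frac a b ≡ a /ₙ suc b
  frac-/ a b = refl

  rcp : ℕ → ℚ
  rcp zero = 0ℚ
  rcp (suc n) = inv n

  rcp-zero : rcp 0 ≡ 0ℚ
  rcp-zero = refl

  rcp-suc : ∀ n → rcp (suc n) ≡ frac 1 n
  rcp-suc n = refl

  rcp-inv : ∀ n → rcp (suc n) ≡ inv n
  rcp-inv n = refl

  0≤rcp : ∀ n → 0ℚ ≤ rcp n
  0≤rcp zero = ≤-refl
  0≤rcp (suc n) = 0≤inv n

  ι*rcp : ∀ n → .{{ℕ.NonZero n}} → ι n * rcp n ≡ 1ℚ
  ι*rcp (suc n) = ι*inv n

  rcp-* : ∀ m n → rcp (m ℕ.* n) ≡ rcp m * rcp n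
  rcp-* zero n = sym (*-zeroˡ (rcp n))
  rcp-* (suc m) zero rewrite ℕ.*-zeroʳ m = sym (*-zeroʳ (rcp (suc m)))
  rcp-* (suc m) (suc n) = sym (/-*-/ 1 m 1 n)

  rcp-anti : ∀ {m n} → .{{ℕ.NonZero m}} → m ℕ.≤ n → rcp n ≤ rcp m
  rcp-anti {suc m} {suc n} (s≤s h) = inv-anti h

  rcp≤1 : ∀ n → rcp n ≤ 1ℚ
  rcp≤1 zero = <⇒≤ 0<1
  rcp≤1 (suc n) = inv-anti {0} {n} z≤n

0≤-gap : ∀ {p q} → p ≤ q → 0ℚ ≤ q - p
0≤-gap {p} {q} h = subst (_≤ q - p) (+-inverseʳ p) (+-monoˡ-≤ (- p) h)

gap-≤ : ∀ {p q} → 0ℚ ≤ q - p → p ≤ q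
gap-≤ {p} {q} h = subst₂ _≤_ (+-identityʳ p) (solve 2 (λ p q → p :+ (q :- p) := q) refl p q) (+-monoʳ-≤ p h)

*-cancelʳ-ι : ∀ {p q} n → .{{ℕ.NonZero n}} → p * ι n ≤ q * ι n → p ≤ q
*-cancelʳ-ι {p} {q} n h = subst₂ _≤_ (e p) (e q) (mulʳ (rcp n) (0≤rcp n) h)
  where
  e : ∀ p → p * ι n * rcp n ≡ p
  e p = trans (*-assoc p (ι n) (rcp n)) (trans (cong (p *_) (ι*rcp n)) (*-identityʳ p))

Σ-cong : ∀ n {f g : ℕ → ℚ} → (∀ i → i ℕ.< n → f i ≡ g i) → Σ[i< n ] f ≡ Σ[i< n ] g
Σ-cong zero h = refl
Σ-cong (suc n) h = cong₂ _+_ (Σ-cong n λ i l → h i (ℕ.m<n⇒m<1+n l)) (h n ℕ.≤-refl)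

Σ-mono : ∀ n {f g : ℕ → ℚ} → (∀ i → i ℕ.< n → f i ≤ g i) → Σ[i< n ] f ≤ Σ[i< n ] g
Σ-mono zero h = ≤-refl
Σ-mono (suc n) h = +-mono-≤ (Σ-mono n λ i l → h i (ℕ.m<n⇒m<1+n l)) (h n ℕ.≤-refl)

Σ-zero : ∀ n → Σ[i< n ] (λ _ → 0ℚ) ≡ 0ℚ
Σ-zero zero = refl
Σ-zero (suc n) = trans (+-identityʳ _) (Σ-zero n)

Σ-0 : ∀ n {f : ℕ → ℚ} → (∀ i → i ℕ.< n → f i ≡ 0ℚ) → Σ[i< n ] f ≡ 0ℚ
Σ-0 n h = trans (Σ-cong n h) (Σ-zero n)

Σ-const : ∀ n c → Σ[i< n ] (λ _ → c) ≡ ι n * c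
Σ-const zero c = sym (*-zeroˡ c)
Σ-const (suc n) c = trans (cong (_+ c) (Σ-const n c)) (sym (ι-suc* n c))

Σ-≥0 : ∀ n {f : ℕ → ℚ} → (∀ i → i ℕ.< n → 0ℚ ≤ f i) → 0ℚ ≤ Σ[i< n ] f
Σ-≥0 n {f} h = subst (_≤ Σ[i< n ] f) (Σ-zero n) (Σ-mono n h)

Σ-+ : ∀ n (f g : ℕ → ℚ) → Σ[i< n ] (λ i → f i + g i) ≡ Σ[i< n ] f + Σ[i< n ] g
Σ-+ zero f g = refl
Σ-+ (suc n) f g = trans (cong (_+ (f n + g n)) (Σ-+ n f g))
  (solve 4 (λ a b c d → a :+ b :+ (c :+ d) := a :+ c :+ (b :+ d)) refl (Σ[i< n ] f) (Σ[i< n ] g) (f n) (g n))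

Σ-*ˡ : ∀ n c (f : ℕ → ℚ) → Σ[i< n ] (λ i → c * f i) ≡ c * Σ[i< n ] f
Σ-*ˡ zero c f = sym (*-zeroʳ c)
Σ-*ˡ (suc n) c f = trans (cong (_+ c * f n) (Σ-*ˡ n c f)) (sym (*-distribˡ-+ c (Σ[i< n ] f) (f n)))

Σ-*ʳ : ∀ n c (f : ℕ → ℚ) → Σ[i< n ] (λ i → f i * c) ≡ Σ[i< n ] f * c
Σ-*ʳ n c f = trans (Σ-cong n λ i _ → *-comm (f i) c) (trans (Σ-*ˡ n c f) (*-comm c _))

Σ-neg : ∀ n (f : ℕ → ℚ) → Σ[i< n ] (λ i → - f i) ≡ - Σ[i< n ] f
Σ-neg zero f = refl
Σ-neg (suc n) f = trans (cong (_- f n) (Σ-neg n f)) (sym (neg-distrib-+ (Σ[i< n ] f) (f n)))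

Σ-- : ∀ n (f g : ℕ → ℚ) → Σ[i< n ] (λ i → f i - g i) ≡ Σ[i< n ] f - Σ[i< n ] g
Σ-- n f g = trans (Σ-+ n f (λ i → - g i)) (cong (Σ[i< n ] f +_) (Σ-neg n g))

Σ-swap : ∀ m n (f : ℕ → ℕ → ℚ) → Σ[i< m ] (λ i → Σ[i< n ] (f i)) ≡ Σ[i< n ] (λ j → Σ[i< m ] (λ i → f i j))
Σ-swap zero n f = sym (Σ-zero n)
Σ-swap (suc m) n f = trans (cong (_+ Σ[i< n ] (f m)) (Σ-swap m n f)) (sym (Σ-+ n _ (f m)))

Σ-split : ∀ m n (f : ℕ → ℚ) → Σ[i< m ℕ.+ n ] f ≡ Σ[i< m ] f + Σ[i< n ] (λ i → f (m ℕ.+ i))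
Σ-split m zero f rewrite ℕ.+-identityʳ m = sym (+-identityʳ _)
Σ-split m (suc n) f rewrite ℕ.+-suc m n = trans (cong (_+ f (m ℕ.+ n)) (Σ-split m n f)) (+-assoc (Σ[i< m ] f) _ _)

Σ-first : ∀ n (f : ℕ → ℚ) → Σ[i< suc n ] f ≡ f 0 + Σ[i< n ] (λ i → f (suc i))
Σ-first n f = trans (Σ-split 1 n f) (cong (_+ Σ[i< n ] (λ i → f (suc i))) (+-identityˡ (f 0)))

Σ-extend : ∀ {m n} (f : ℕ → ℚ) → m ℕ.≤ n → (∀ i → 0ℚ ≤ f i) → Σ[i< m ] f ≤ Σ[i< n ] f
Σ-extend {m} {n} f m≤n h with ℕ.m≤n⇒∃[o]m+o≡n m≤n
... | o , refl = subst₂ _≤_ (+-identityʳ _) (sym (Σ-split m o f)) (+-monoʳ-≤ (Σ[i< m ] f) (Σ-≥0 o λ i _ → h (m ℕ.+ i)))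

Σ-block : ∀ X n (f : ℕ → ℚ) → Σ[i< X ℕ.* n ] f ≡ Σ[i< X ] (λ a → Σ[i< n ] (λ i → f (a ℕ.* n ℕ.+ i)))
Σ-block zero n f = refl
Σ-block (suc X) n f = trans (cong (λ m → Σ[i< m ] f) (ℕ.+-comm n (X ℕ.* n)))
  (trans (Σ-split (X ℕ.* n) n f) (cong (_+ Σ[i< n ] (λ i → f (X ℕ.* n ℕ.+ i))) (Σ-block X n f)))

-- Indicators of decidable propositions

𝟙 : ∀ {a} {P : Set a} → Dec P → ℚ
𝟙 (yes _) = 1ℚ
𝟙 (no _) = 0ℚ

𝟙-yes : ∀ {a} {P : Set a} (d : Dec P) → P → 𝟙 d ≡ 1ℚ
𝟙-yes (yes _) _ = refl
𝟙-yes (no ¬p) p = contradiction p ¬p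

𝟙-no : ∀ {a} {P : Set a} (d : Dec P) → ¬ P → 𝟙 d ≡ 0ℚ
𝟙-no (yes p) ¬p = contradiction p ¬p
𝟙-no (no _) _ = refl

𝟙-cong : ∀ {a b} {P : Set a} {Q : Set b} (d : Dec P) (e : Dec Q) → (P → Q) → (Q → P) → 𝟙 d ≡ 𝟙 e
𝟙-cong (yes p) e f g = sym (𝟙-yes e (f p))
𝟙-cong (no ¬p) e f g = sym (𝟙-no e λ q → ¬p (g q))

0≤𝟙 : ∀ {a} {P : Set a} (d : Dec P) → 0ℚ ≤ 𝟙 d
0≤𝟙 (yes _) = <⇒≤ 0<1
0≤𝟙 (no _) = ≤-refl

𝟙≤1 : ∀ {a} {P : Set a} (d : Dec P) → 𝟙 d ≤ 1ℚ
𝟙≤1 (yes _) = ≤-refl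
𝟙≤1 (no _) = <⇒≤ 0<1

𝟙-mono : ∀ {a b} {P : Set a} {Q : Set b} (d : Dec P) (e : Dec Q) → (P → Q) → 𝟙 d ≤ 𝟙 e
𝟙-mono (yes p) e f = ≤-reflexive (sym (𝟙-yes e (f p)))
𝟙-mono (no ¬p) e f = 0≤𝟙 e

Σ-delta : ∀ n r → r ℕ.< n → Σ[i< n ] (λ i → 𝟙 (i ℕ.≟ r)) ≡ 1ℚ
Σ-delta (suc n) r r<1+n with n ℕ.≟ r
... | yes refl = trans (cong (_+ 1ℚ) (Σ-0 n λ i i<n → 𝟙-no (i ℕ.≟ n) (ℕ.<⇒≢ i<n))) (+-identityˡ 1ℚ)
... | no n≢r = trans (+-identityʳ _) (Σ-delta n r (ℕ.≤∧≢⇒< (ℕ.≤-pred r<1+n) (λ e → n≢r (sym e))))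

-- The second elementary symmetric polynomial of `f 0`, ..., `f (k - 1)`. Pair sums over moduli and
-- the pair term of Bonferroni's inequality both take this form.
PS : ℕ → (ℕ → ℚ) → ℚ
PS k f = Σ[i< k ] (λ i → f i * Σ[i< i ] f)

-- The surplus Σ 1/d² − Σ 1/lcm(d, d′)² of an initial interval of moduli

Σ-single : ∀ n i {f : ℕ → ℚ} → (∀ i → 0ℚ ≤ f i) → i ℕ.< n → f i ≤ Σ[i< n ] f
Σ-single n i {f} h i<n = ≤-trans
  (subst (_≤ Σ[i< suc i ] f) (+-identityˡ (f i)) (+-monoˡ-≤ (f i) (Σ-≥0 i λ j _ → h j)))
  (Σ-extend f i<n h)

-- Each block of `g` indices starting at a multiple of `g` contains no other multiple.
Σ-multiples : ∀ X g (f : ℕ → ℚ) .{{_ : ℕ.NonZero g}} → (∀ n → ¬ g ℕ.∣ n → f n ≡ 0ℚ) →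
  Σ[i< X ℕ.* g ] f ≡ Σ[i< X ] (λ a → f (a ℕ.* g))
Σ-multiples X g@(suc g′) f h = trans (Σ-block X g f) (Σ-cong X λ a _ →
  trans (Σ-first g′ (λ i → f (a ℕ.* g ℕ.+ i)))
    (trans (cong₂ _+_ (cong f (ℕ.+-identityʳ (a ℕ.* g)))
        (Σ-0 g′ λ i i<g′ → h (a ℕ.* g ℕ.+ suc i) λ d →
          ℕ.>⇒∤ (s≤s i<g′) (ℕ.∣m+n∣m⇒∣n d (ℕ.n∣m*n a))))
      (+-identityʳ (f (a ℕ.* g)))))

PS-mono : ∀ k {f g : ℕ → ℚ} → (∀ i → 0ℚ ≤ f i) → (∀ i → i ℕ.< k → f i ≤ g i) → PS k f ≤ PS k g
PS-mono k {f} {g} f≥0 f≤g = Σ-mono k λ i i<k →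
  mul (≤-trans (f≥0 i) (f≤g i i<k)) (Σ-≥0 i λ j _ → f≥0 j) (f≤g i i<k)
    (Σ-mono i λ j j<i → f≤g j (ℕ.<-trans j<i i<k))

PS-extend : ∀ {m n} (f : ℕ → ℚ) → m ℕ.≤ n → (∀ i → 0ℚ ≤ f i) → PS m f ≤ PS n f
PS-extend f h f≥0 = Σ-extend _ h λ i → 0≤* (f≥0 i) (Σ-≥0 i λ j _ → f≥0 j)

PS-scale : ∀ k c (f : ℕ → ℚ) → PS k (λ i → c * f i) ≡ c * c * PS k f
PS-scale k c f = trans (Σ-cong k λ i _ → trans (cong (c * f i *_) (Σ-*ˡ i c f))
    (solve 3 (λ c a b → c :* a :* (c :* b) := c :* c :* (a :* b)) refl c (f i) (Σ[i< i ] f)))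
  (Σ-*ˡ k (c * c) _)

PS-shift : ∀ a k (f : ℕ → ℚ) → (∀ i → i ℕ.< a → f i ≡ 0ℚ) → PS (a ℕ.+ k) f ≡ PS k (λ i → f (a ℕ.+ i))
PS-shift a k f h = trans (Σ-split a k _) (trans (cong₂ _+_
    (Σ-0 a λ i i<a → trans (cong (_* Σ[i< i ] f) (h i i<a)) (*-zeroˡ (Σ[i< i ] f)))
    (Σ-cong k λ i _ → cong (f (a ℕ.+ i) *_) (trans (Σ-split a i f)
      (trans (cong (_+ Σ[i< i ] (λ j → f (a ℕ.+ j))) (Σ-0 a h)) (+-identityˡ (Σ[i< i ] (λ j → f (a ℕ.+ j))))))))
  (+-identityˡ (PS k (λ i → f (a ℕ.+ i)))))

PS-multiples : ∀ X g (f : ℕ → ℚ) .{{_ : ℕ.NonZero g}} → (∀ n → ¬ g ℕ.∣ n → f n ≡ 0ℚ) →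
  PS (X ℕ.* g) f ≡ PS X (λ a → f (a ℕ.* g))
PS-multiples X g f h = trans
  (Σ-multiples X g _ λ n ∤n → trans (cong (_* Σ[i< n ] f) (h n ∤n)) (*-zeroˡ (Σ[i< n ] f)))
  (Σ-cong X λ a _ → cong (f (a ℕ.* g) *_) (Σ-multiples a g f h))

PS-square : ∀ k (f : ℕ → ℚ) → PS k f + PS k f + Σ[i< k ] (λ i → f i * f i) ≡ Σ[i< k ] f * Σ[i< k ] f
PS-square zero f = refl
PS-square (suc k) f = trans
  (solve 4 (λ p q s x → p :+ x :* s :+ (p :+ x :* s) :+ (q :+ x :* x) := p :+ p :+ q :+ (x :* s :+ x :* s :+ x :* x)) refl
    (PS k f) (Σ[i< k ] (λ i → f i * f i)) (Σ[i< k ] f) (f k))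
  (trans (cong (_+ (f k * Σ[i< k ] f + f k * Σ[i< k ] f + f k * f k)) (PS-square k f))
    (solve 2 (λ s x → s :* s :+ (x :* s :+ x :* s :+ x :* x) := (s :+ x) :* (s :+ x)) refl (Σ[i< k ] f) (f k)))

0≤sq : ∀ {p} → 0ℚ ≤ p → 0ℚ ≤ p * p
0≤sq h = 0≤* h h

-- The square of the sum contains every pair twice, besides a nonnegative diagonal.
PS≤½square : ∀ k (f : ℕ → ℚ) B → (∀ i → 0ℚ ≤ f i) → Σ[i< k ] f ≤ B → PS k f ≤ ½ * (B * B)
PS≤½square k f B f≥0 h = begin
  PS k f                      ≡⟨ sym (½+½ (PS k f)) ⟩
  ½ * PS k f + ½ * PS k f     ≡⟨ sym (*-distribˡ-+ ½ (PS k f) (PS k f)) ⟩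
  ½ * (PS k f + PS k f)
    ≤⟨ mulˡ ½ (<⇒≤ (positive⁻¹ ½)) (≤-trans (subst (_≤ PS k f + PS k f + Σ[i< k ] (λ i → f i * f i)) (+-identityʳ (PS k f + PS k f))
         (+-monoʳ-≤ (PS k f + PS k f) (Σ-≥0 k {λ i → f i * f i} λ i _ → 0≤sq (f≥0 i))))
         (≤-trans (≤-reflexive (PS-square k f)) (mul (≤-trans S≥0 h) S≥0 h h))) ⟩
  ½ * (B * B) ∎
  where
  open ≤-Reasoning
  S≥0 = Σ-≥0 k λ i _ → f≥0 i

sq : ℕ → ℚ
sq n = rcp n * rcp n

0≤sq-rcp : ∀ n → 0ℚ ≤ sq n
0≤sq-rcp n = 0≤sq (0≤rcp n)

sq-* : ∀ m n → sq (m ℕ.* n) ≡ sq m * sq n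
sq-* m n = trans (cong₂ _*_ (rcp-* m n) (rcp-* m n))
  (solve 2 (λ a b → a :* b :* (a :* b) := a :* a :* (b :* b)) refl (rcp m) (rcp n))

sq-suc : ∀ b → sq (suc b) ≡ frac 1 (b ℕ.+ b ℕ.* suc b)
sq-suc b = trans (cong₂ _*_ (rcp-suc b) (rcp-suc b)) (frac-* 1 b 1 b)

recipSq : ℕ → ℕ → ℚ
recipSq N k = Σ[i< k ] (λ i → sq (suc (N ℕ.+ i)))

lcmSq : ℕ → ℕ → ℚ
lcmSq N k = Σ[i< k ] (λ i → Σ[i< i ] (λ j → sq (ℕ.lcm (suc (N ℕ.+ i)) (suc (N ℕ.+ j)))))

-- 18/121 = ½ (6/11)², from the bound 6/11 · 1/(m+1) on the sum in hull-sum.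
κ : ℚ
κ = ℤ.+ 18 / 121

≤-slack : ∀ {a b} c → a ℕ.+ c ≡ b → a ℕ.≤ b
≤-slack {a} c refl = ℕ.m≤m+n a c

-- With n = b + 1 this is 1/n² ≤ 1/(n - 1/2) - 1/(n + 1/2), where the right side equals 1/(n² -
-- 1/4).
sq-upper : ∀ b → sq (suc b) + frac 2 (2 ℕ.+ 2 ℕ.* b) ≤ frac 2 (2 ℕ.* b)
sq-upper b = subst (_≤ frac 2 (2 ℕ.* b))
  (sym (trans (cong (_+ frac 2 (2 ℕ.+ 2 ℕ.* b)) (sq-suc b)) (frac-+ 1 _ 2 _)))
  (frac-≤ _ _ 2 (2 ℕ.* b) (≤-slack 1 (e b)))
  where
  e : ∀ b → (1 ℕ.* suc (2 ℕ.+ 2 ℕ.* b) ℕ.+ 2 ℕ.* (suc b ℕ.* suc b)) ℕ.* suc (2 ℕ.* b) ℕ.+ 1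
            ≡ 2 ℕ.* (suc b ℕ.* suc b ℕ.* suc (2 ℕ.+ 2 ℕ.* b))
  e = solve-∀

-- With n = b + 2, the difference 1/(n - 2/5) - 1/(n + 3/5) equals 1/(n² + n/5 - 6/25), at most 1/n²
-- once n ≥ 6/5. The shift 2/5 in place of 1/2 reverses the inequality and still telescopes.
sq-lower : ∀ b → frac 5 (7 ℕ.+ 5 ℕ.* b) ≤ sq (2 ℕ.+ b) + frac 5 (12 ℕ.+ 5 ℕ.* b)
sq-lower b = subst (frac 5 (7 ℕ.+ 5 ℕ.* b) ≤_)
  (sym (trans (cong (_+ frac 5 (12 ℕ.+ 5 ℕ.* b)) (sq-suc (suc b))) (frac-+ 1 _ 5 _)))
  (frac-≤ 5 (7 ℕ.+ 5 ℕ.* b) _ _ (≤-slack (4 ℕ.+ 5 ℕ.* b) (e b)))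
  where
  e : ∀ b → 5 ℕ.* ((2 ℕ.+ b) ℕ.* (2 ℕ.+ b) ℕ.* suc (12 ℕ.+ 5 ℕ.* b)) ℕ.+ (4 ℕ.+ 5 ℕ.* b)
            ≡ (1 ℕ.* suc (12 ℕ.+ 5 ℕ.* b) ℕ.+ 5 ℕ.* ((2 ℕ.+ b) ℕ.* (2 ℕ.+ b))) ℕ.* suc (7 ℕ.+ 5 ℕ.* b)
  e = solve-∀

recipSq-upper : ∀ m k → recipSq m k + frac 2 (2 ℕ.* (m ℕ.+ k)) ≤ frac 2 (2 ℕ.* m)
recipSq-upper m zero = ≤-reflexive (trans (+-identityˡ _) (cong (λ n → frac 2 (2 ℕ.* n)) (ℕ.+-identityʳ m)))
recipSq-upper m (suc k) = begin
  recipSq m k + sq (suc (m ℕ.+ k)) + frac 2 (2 ℕ.* (m ℕ.+ suc k))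
    ≡⟨ +-assoc (recipSq m k) (sq (suc (m ℕ.+ k))) (frac 2 (2 ℕ.* (m ℕ.+ suc k))) ⟩
  recipSq m k + (sq (suc (m ℕ.+ k)) + frac 2 (2 ℕ.* (m ℕ.+ suc k)))
    ≡⟨ cong (λ n → recipSq m k + (sq (suc (m ℕ.+ k)) + frac 2 n)) (e m k) ⟩
  recipSq m k + (sq (suc (m ℕ.+ k)) + frac 2 (2 ℕ.+ 2 ℕ.* (m ℕ.+ k)))
    ≤⟨ +-monoʳ-≤ (recipSq m k) (sq-upper (m ℕ.+ k)) ⟩
  recipSq m k + frac 2 (2 ℕ.* (m ℕ.+ k))
    ≤⟨ recipSq-upper m k ⟩
  frac 2 (2 ℕ.* m) ∎
  where
  open ≤-Reasoning
  e : ∀ m k → 2 ℕ.* (m ℕ.+ suc k) ≡ 2 ℕ.+ 2 ℕ.* (m ℕ.+ k)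
  e = solve-∀

recipSq-lower : ∀ n k → frac 5 (7 ℕ.+ 5 ℕ.* n) ≤ recipSq (suc n) k + frac 5 (7 ℕ.+ 5 ℕ.* (n ℕ.+ k))
recipSq-lower n zero = ≤-reflexive (sym (trans (+-identityˡ _) (cong (λ n → frac 5 (7 ℕ.+ 5 ℕ.* n)) (ℕ.+-identityʳ n))))
recipSq-lower n (suc k) = begin
  frac 5 (7 ℕ.+ 5 ℕ.* n)
    ≤⟨ recipSq-lower n k ⟩
  recipSq (suc n) k + frac 5 (7 ℕ.+ 5 ℕ.* (n ℕ.+ k))
    ≤⟨ +-monoʳ-≤ (recipSq (suc n) k) (sq-lower (n ℕ.+ k)) ⟩
  recipSq (suc n) k + (sq (2 ℕ.+ (n ℕ.+ k)) + frac 5 (12 ℕ.+ 5 ℕ.* (n ℕ.+ k)))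
    ≡⟨ cong (λ j → recipSq (suc n) k + (sq (2 ℕ.+ (n ℕ.+ k)) + frac 5 j)) (e n k) ⟩
  recipSq (suc n) k + (sq (2 ℕ.+ (n ℕ.+ k)) + frac 5 (7 ℕ.+ 5 ℕ.* (n ℕ.+ suc k)))
    ≡⟨ sym (+-assoc (recipSq (suc n) k) (sq (2 ℕ.+ (n ℕ.+ k))) (frac 5 (7 ℕ.+ 5 ℕ.* (n ℕ.+ suc k)))) ⟩
  recipSq (suc n) (suc k) + frac 5 (7 ℕ.+ 5 ℕ.* (n ℕ.+ suc k)) ∎
  where
  open ≤-Reasoning
  e : ∀ n k → 12 ℕ.+ 5 ℕ.* (n ℕ.+ k) ≡ 7 ℕ.+ 5 ℕ.* (n ℕ.+ suc k)
  e = solve-∀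

-- The pairs of multiples of g in (N, 2N] are g times the pairs a < b in (x, 2x] with
-- x = N/g; this sum contains the latter for every x with ⌊x⌋ = m.
hull-pairs : ℕ → ℚ
hull-pairs m = PS (suc m) (λ i → sq (suc (m ℕ.+ i)))

opaque
  unfolding rcp
  hull-pairs-small : ∀ {m} → m ℕ.< 8 → hull-pairs m ≤ κ * sq (suc m)
  hull-pairs-small = from-yes (ℕ.allUpTo? (λ m → hull-pairs m ≤? κ * sq (suc m)) 8)

-- Telescoping gives 2/(2m + 1) - 2/(4m + 3), roughly 1/(2m). This is below (6/11)/(m + 1) from m =
-- 8 on but not at m = 7, hence the split in `hull-pairs≤`.
hull-sum : ∀ t → recipSq (8 ℕ.+ t) (9 ℕ.+ t) ≤ frac 6 (10 ℕ.+ 11 ℕ.* (8 ℕ.+ t))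
hull-sum t = begin
  recipSq m (suc m)
    ≤⟨ subst (_≤ frac 2 (2 ℕ.* m) - r) (solve 2 (λ a b → a :+ b :- b := a) refl (recipSq m (suc m)) r)
         (+-monoˡ-≤ (- r) (recipSq-upper m (suc m))) ⟩
  frac 2 (2 ℕ.* m) - r
    ≤⟨ ≤+⇒-≤ {frac 2 (2 ℕ.* m)} {r} (subst (frac 2 (2 ℕ.* m) ≤_) (sym (frac-+ 2 (2 ℕ.* (m ℕ.+ suc m)) 6 (10 ℕ.+ 11 ℕ.* m)))
         (frac-≤ 2 (2 ℕ.* m) _ _ (≤-slack (6 ℕ.+ 36 ℕ.* t ℕ.+ 4 ℕ.* t ℕ.* t) (e t)))) ⟩
  frac 6 (10 ℕ.+ 11 ℕ.* m) ∎
  where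
  open ≤-Reasoning
  m = 8 ℕ.+ t
  r = frac 2 (2 ℕ.* (m ℕ.+ suc m))
  e : ∀ t → 2 ℕ.* (suc (2 ℕ.* (8 ℕ.+ t ℕ.+ suc (8 ℕ.+ t))) ℕ.* suc (10 ℕ.+ 11 ℕ.* (8 ℕ.+ t))) ℕ.+ (6 ℕ.+ 36 ℕ.* t ℕ.+ 4 ℕ.* t ℕ.* t)
    ≡ (2 ℕ.* suc (10 ℕ.+ 11 ℕ.* (8 ℕ.+ t)) ℕ.+ 6 ℕ.* suc (2 ℕ.* (8 ℕ.+ t ℕ.+ suc (8 ℕ.+ t)))) ℕ.* suc (2 ℕ.* (8 ℕ.+ t))
  e = solve-∀

hull-pairs-large : ∀ t → hull-pairs (8 ℕ.+ t) ≤ κ * sq (9 ℕ.+ t)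
hull-pairs-large t = ≤-trans (PS≤½square (9 ℕ.+ t) (λ i → sq (suc (8 ℕ.+ t ℕ.+ i))) (c * r) (λ i → 0≤sq-rcp (suc (8 ℕ.+ t ℕ.+ i)))
    (≤-trans (hull-sum t) (≤-reflexive (sym (trans (cong₂ _*_ (sym (frac-/ 6 10)) (rcp-suc (8 ℕ.+ t)))
      (trans (frac-* 6 10 1 (8 ℕ.+ t)) (frac-≡ 6 _ 6 _ (cong (6 ℕ.*_) (e t)))))))))
  (≤-reflexive (solve 3 (λ h c r → h :* (c :* r :* (c :* r)) := h :* c :* c :* (r :* r)) refl ½ c r))
  where
  c = ℤ.+ 6 / 11
  r = rcp (9 ℕ.+ t)
  e : ∀ t → suc (10 ℕ.+ 11 ℕ.* (8 ℕ.+ t)) ≡ 11 ℕ.* (9 ℕ.+ t)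
  e = solve-∀

hull-pairs≤ : ∀ m → hull-pairs m ≤ κ * sq (suc m)
hull-pairs≤ m with 8 ℕ.≤? m
... | no h = hull-pairs-small (ℕ.≰⇒> h)
... | yes h with ℕ.m≤n⇒∃[o]m+o≡n h
...   | t , refl = hull-pairs-large t

-- For g = gcd d e the product gcdTerm g d * gcdTerm g e is 1/lcm(d, e)²; summing it
-- over all g bounds 1/lcm² by products in which d and e are separated.
gcdTerm : ℕ → ℕ → ℚ
gcdTerm g d = 𝟙 (g ℕ.∣? d) * (ι g * sq d)

0≤gcdTerm : ∀ g d → 0ℚ ≤ gcdTerm g d
0≤gcdTerm g d = 0≤* (0≤𝟙 (g ℕ.∣? d)) (0≤* (0≤ι g) (0≤sq-rcp d))

rcp-lcm : ∀ d e → .{{ℕ.NonZero d}} → rcp (ℕ.lcm d e) ≡ ι (ℕ.gcd d e) * (rcp d * rcp e)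
rcp-lcm d e = begin
  rcp (ℕ.lcm d e)                       ≡⟨ sym (*-identityˡ _) ⟩
  1ℚ * rcp (ℕ.lcm d e)                  ≡⟨ cong (_* rcp (ℕ.lcm d e)) (sym (ι*rcp g)) ⟩
  ι g * rcp g * rcp (ℕ.lcm d e)         ≡⟨ *-assoc (ι g) (rcp g) (rcp (ℕ.lcm d e)) ⟩
  ι g * (rcp g * rcp (ℕ.lcm d e))       ≡⟨ cong (ι g *_) (sym (rcp-* g (ℕ.lcm d e))) ⟩
  ι g * rcp (g ℕ.* ℕ.lcm d e)           ≡⟨ cong (λ n → ι g * rcp n) (ℕ.gcd*lcm d e) ⟩
  ι g * rcp (d ℕ.* e)                   ≡⟨ cong (ι g *_) (rcp-* d e) ⟩
  ι g * (rcp d * rcp e) ∎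
  where
  open ≡-Reasoning
  g = ℕ.gcd d e
  instance
    g≢0 : ℕ.NonZero g
    g≢0 = ℕ.≢-nonZero λ g≡0 → ℕ.≢-nonZero⁻¹ d (ℕ.gcd[m,n]≡0⇒m≡0 g≡0)

sq-lcm : ∀ d e → .{{ℕ.NonZero d}} → sq (ℕ.lcm d e) ≡ gcdTerm (ℕ.gcd d e) d * gcdTerm (ℕ.gcd d e) e
sq-lcm d e = begin
  sq (ℕ.lcm d e)
    ≡⟨ cong₂ _*_ (rcp-lcm d e) (rcp-lcm d e) ⟩
  ι g * (rcp d * rcp e) * (ι g * (rcp d * rcp e))
    ≡⟨ solve 3 (λ g a b → g :* (a :* b) :* (g :* (a :* b)) := g :* (a :* a) :* (g :* (b :* b))) refl (ι g) (rcp d) (rcp e) ⟩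
  ι g * sq d * (ι g * sq e)
    ≡⟨ sym (cong₂ _*_ (*-identityˡ (ι g * sq d)) (*-identityˡ (ι g * sq e))) ⟩
  1ℚ * (ι g * sq d) * (1ℚ * (ι g * sq e))
    ≡⟨ sym (cong₂ (λ x y → x * (ι g * sq d) * (y * (ι g * sq e)))
         (𝟙-yes (g ℕ.∣? d) (ℕ.gcd[m,n]∣m d e)) (𝟙-yes (g ℕ.∣? e) (ℕ.gcd[m,n]∣n d e))) ⟩
  gcdTerm g d * gcdTerm g e ∎
  where
  open ≡-Reasoning
  g = ℕ.gcd d e

-- The gcd divides the difference `i - j` of the two moduli.
gcd<gap : ∀ N i j → j ℕ.< i → ℕ.gcd (suc (N ℕ.+ i)) (suc (N ℕ.+ j)) ℕ.≤ i
gcd<gap N i j j<i with ℕ.m≤n⇒∃[o]m+o≡n j<i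
... | o , refl = ℕ.≤-trans (ℕ.∣⇒≤ g∣) (ℕ.≤-trans (s≤s (ℕ.m≤n+m o j)) ℕ.≤-refl)
  where
  g = ℕ.gcd (suc (N ℕ.+ i)) (suc (N ℕ.+ j))
  e : ∀ N j o → suc (N ℕ.+ (suc j ℕ.+ o)) ≡ suc (N ℕ.+ j) ℕ.+ suc o
  e = solve-∀
  g∣ : g ℕ.∣ suc o
  g∣ = ℕ.∣m+n∣m⇒∣n (subst (g ℕ.∣_) (e N j o) (ℕ.gcd[m,n]∣m (suc (N ℕ.+ i)) (suc (N ℕ.+ j))))
    (ℕ.gcd[m,n]∣n (suc (N ℕ.+ i)) (suc (N ℕ.+ j)))

lcmSq≤ : ∀ N → lcmSq N N ≤ Σ[i< N ] (λ g → PS N (λ i → gcdTerm g (suc (N ℕ.+ i))))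
lcmSq≤ N = begin
  lcmSq N N
    ≤⟨ Σ-mono N (λ i i<N → Σ-mono i λ j j<i → ≤-trans (≤-reflexive (sq-lcm (d i) (d j)))
         (Σ-single N (ℕ.gcd (d i) (d j)) {λ g → gcdTerm g (d i) * gcdTerm g (d j)}
           (λ g → 0≤* (0≤gcdTerm g (d i)) (0≤gcdTerm g (d j)))
           (ℕ.≤-<-trans (gcd<gap N i j j<i) i<N))) ⟩
  Σ[i< N ] (λ i → Σ[i< i ] (λ j → Σ[i< N ] (λ g → gcdTerm g (d i) * gcdTerm g (d j))))
    ≡⟨ Σ-cong N (λ i _ → trans (Σ-swap i N (λ j g → gcdTerm g (d i) * gcdTerm g (d j)))
         (Σ-cong N λ g _ → Σ-*ˡ i (gcdTerm g (d i)) (λ j → gcdTerm g (d j)))) ⟩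
  Σ[i< N ] (λ i → Σ[i< N ] (λ g → gcdTerm g (d i) * Σ[i< i ] (λ j → gcdTerm g (d j))))
    ≡⟨ Σ-swap N N (λ i g → gcdTerm g (d i) * Σ[i< i ] (λ j → gcdTerm g (d j))) ⟩
  Σ[i< N ] (λ g → PS N (λ i → gcdTerm g (d i))) ∎
  where
  open ≤-Reasoning
  d : ℕ → ℕ
  d i = suc (N ℕ.+ i)

gcdTerm-multiple : ∀ g a → .{{ℕ.NonZero g}} → gcdTerm g (a ℕ.* g) ≡ rcp g * sq a
gcdTerm-multiple g a = begin
  𝟙 (g ℕ.∣? (a ℕ.* g)) * (ι g * sq (a ℕ.* g))
    ≡⟨ cong₂ (λ x y → x * (ι g * y)) (𝟙-yes (g ℕ.∣? (a ℕ.* g)) (ℕ.n∣m*n a)) (sq-* a g) ⟩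
  1ℚ * (ι g * (sq a * (rcp g * rcp g)))
    ≡⟨ trans (*-identityˡ (ι g * (sq a * (rcp g * rcp g))))
         (solve 3 (λ i a r → i :* (a :* (r :* r)) := i :* r :* (r :* a)) refl (ι g) (sq a) (rcp g)) ⟩
  ι g * rcp g * (rcp g * sq a)
    ≡⟨ trans (cong (_* (rcp g * sq a)) (ι*rcp g)) (*-identityˡ (rcp g * sq a)) ⟩
  rcp g * sq a ∎
  where open ≡-Reasoning

-- Writing the multiples of `g` as `a * g` turns the pair sum into at most `sq g * hull-pairs m`
-- with `m = N / g`. Since g(m + 1) > N, the factor `sq g` is absorbed and the bound is uniform in
-- `g`, so summing over `g` costs only a factor N.
PS-gcdTerm : ∀ N g → .{{ℕ.NonZero N}} → .{{ℕ.NonZero g}} → PS N (λ i → gcdTerm g (suc (N ℕ.+ i))) ≤ κ * sq N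
PS-gcdTerm N g = begin
  PS N (λ i → gcdTerm g (suc (N ℕ.+ i)))
    ≡⟨ Σ-cong N (λ i _ → cong₂ _*_ (sym (F-large i)) (Σ-cong i λ j _ → sym (F-large j))) ⟩
  PS N (λ i → F (suc N ℕ.+ i))
    ≡⟨ sym (PS-shift (suc N) N F λ i i≤N → trans (cong (_* gcdTerm g i) (𝟙-no (N ℕ.<? i) (ℕ.≤⇒≯ (ℕ.≤-pred i≤N)))) (*-zeroˡ (gcdTerm g i))) ⟩
  PS (suc N ℕ.+ N) F
    ≤⟨ PS-extend F bound 0≤F ⟩
  PS ((suc m ℕ.+ suc m) ℕ.* g) F
    ≡⟨ PS-multiples (suc m ℕ.+ suc m) g F (λ n ∤n → trans
         (cong (λ x → 𝟙 (N ℕ.<? n) * (x * (ι g * sq n))) (𝟙-no (g ℕ.∣? n) ∤n))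
         (trans (cong (𝟙 (N ℕ.<? n) *_) (*-zeroˡ (ι g * sq n))) (*-zeroʳ (𝟙 (N ℕ.<? n))))) ⟩
  PS (suc m ℕ.+ suc m) (λ a → F (a ℕ.* g))
    ≤⟨ PS-mono (suc m ℕ.+ suc m) (λ a → 0≤F (a ℕ.* g)) (λ a _ → F≤ a) ⟩
  PS (suc m ℕ.+ suc m) (λ a → rcp g * G a)
    ≡⟨ PS-scale (suc m ℕ.+ suc m) (rcp g) G ⟩
  sq g * PS (suc m ℕ.+ suc m) G
    ≡⟨ cong (sq g *_) (trans (PS-shift (suc m) (suc m) G λ i i≤m →
           trans (cong (_* sq i) (𝟙-no (m ℕ.<? i) (ℕ.≤⇒≯ (ℕ.≤-pred i≤m)))) (*-zeroˡ (sq i)))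
         (Σ-cong (suc m) λ i _ → cong₂ _*_ (G-large i) (Σ-cong i λ j _ → G-large j))) ⟩
  sq g * hull-pairs m
    ≤⟨ mulˡ (sq g) (0≤sq-rcp g) (hull-pairs≤ m) ⟩
  sq g * (κ * sq (suc m))
    ≡⟨ trans (solve 3 (λ a b c → a :* (b :* c) := b :* (a :* c)) refl (sq g) κ (sq (suc m)))
         (cong (κ *_) (sym (sq-* g (suc m)))) ⟩
  κ * sq (g ℕ.* suc m)
    ≤⟨ mulˡ κ (<⇒≤ (positive⁻¹ κ)) (mul (0≤rcp N) (0≤rcp (g ℕ.* suc m)) rN rN) ⟩
  κ * sq N ∎
  where
  open ≤-Reasoning
  m = N ℕ./ g
  -- The cutoff N < n lets the sum start at 0, where it splits into blocks beginning at multiples of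
  -- `g`.
  F : ℕ → ℚ
  F n = 𝟙 (N ℕ.<? n) * gcdTerm g n
  0≤F : ∀ n → 0ℚ ≤ F n
  0≤F n = 0≤* (0≤𝟙 (N ℕ.<? n)) (0≤gcdTerm g n)
  G : ℕ → ℚ
  G a = 𝟙 (m ℕ.<? a) * sq a
  F-large : ∀ i → F (suc N ℕ.+ i) ≡ gcdTerm g (suc N ℕ.+ i)
  F-large i = trans (cong (_* gcdTerm g (suc N ℕ.+ i)) (𝟙-yes (N ℕ.<? suc N ℕ.+ i) (s≤s (ℕ.m≤m+n N i)))) (*-identityˡ (gcdTerm g (suc N ℕ.+ i)))
  G-large : ∀ i → G (suc m ℕ.+ i) ≡ sq (suc (m ℕ.+ i))
  G-large i = trans (cong (_* sq (suc m ℕ.+ i)) (𝟙-yes (m ℕ.<? suc m ℕ.+ i) (s≤s (ℕ.m≤m+n m i)))) (*-identityˡ (sq (suc m ℕ.+ i)))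
  N< : N ℕ.< suc m ℕ.* g
  N< = subst (ℕ._< suc m ℕ.* g) (sym (ℕ.m≡m%n+[m/n]*n N g)) (ℕ.+-monoˡ-< (m ℕ.* g) (ℕ.m%n<n N g))
  bound : suc N ℕ.+ N ℕ.≤ (suc m ℕ.+ suc m) ℕ.* g
  bound = ℕ.≤-trans (ℕ.+-mono-≤ N< (ℕ.<⇒≤ N<)) (ℕ.≤-reflexive (sym (ℕ.*-distribʳ-+ g (suc m) (suc m))))
  rN : rcp (g ℕ.* suc m) ≤ rcp N
  rN = rcp-anti (ℕ.<⇒≤ (subst (N ℕ.<_) (ℕ.*-comm (suc m) g) N<))
  F≤ : ∀ a → F (a ℕ.* g) ≤ rcp g * G a
  F≤ a = ≤-trans (≤-reflexive (cong (𝟙 (N ℕ.<? a ℕ.* g) *_) (gcdTerm-multiple g a)))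
    (≤-trans (mulʳ (rcp g * sq a) (0≤* (0≤rcp g) (0≤sq-rcp a))
        (𝟙-mono (N ℕ.<? a ℕ.* g) (m ℕ.<? a) λ N<ag → ℕ.≰⇒> λ a≤m →
          ℕ.<⇒≱ N<ag (ℕ.≤-trans (ℕ.*-monoˡ-≤ g a≤m) (ℕ.m/n*n≤m N g))))
      (≤-reflexive (solve 3 (λ x y z → x :* (y :* z) := y :* (x :* z)) refl (𝟙 (m ℕ.<? a)) (rcp g) (sq a))))

lcmSq-bound : ∀ N → .{{ℕ.NonZero N}} → ι N * lcmSq N N ≤ κ
lcmSq-bound N = begin
  ι N * lcmSq N N
    ≤⟨ mulˡ (ι N) (0≤ι N) (≤-trans (lcmSq≤ N) (≤-trans (Σ-mono N term) (≤-reflexive (Σ-const N (κ * sq N))))) ⟩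
  ι N * (ι N * (κ * (rcp N * rcp N)))
    ≡⟨ solve 3 (λ n k r → n :* (n :* (k :* (r :* r))) := n :* r :* (n :* r :* k)) refl (ι N) κ (rcp N) ⟩
  ι N * rcp N * (ι N * rcp N * κ)
    ≡⟨ cong (λ x → x * (x * κ)) (ι*rcp N) ⟩
  1ℚ * (1ℚ * κ)
    ≡⟨⟩
  κ ∎
  where
  open ≤-Reasoning
  term : ∀ g → g ℕ.< N → PS N (λ i → gcdTerm g (suc (N ℕ.+ i))) ≤ κ * sq N
  term (suc g) _ = PS-gcdTerm N (suc g)
  term zero _ = ≤-trans (≤-reflexive (Σ-0 N λ i _ → trans (cong (_* Σ[i< i ] f) (z i)) (*-zeroˡ (Σ[i< i ] f))))
    (0≤* (<⇒≤ (positive⁻¹ κ)) (0≤sq-rcp N))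
    where
    f : ℕ → ℚ
    f i = gcdTerm 0 (suc (N ℕ.+ i))
    z : ∀ i → f i ≡ 0ℚ
    z i = trans (cong (𝟙 (0 ℕ.∣? suc (N ℕ.+ i)) *_) (*-zeroˡ (sq (suc (N ℕ.+ i))))) (*-zeroʳ (𝟙 (0 ℕ.∣? suc (N ℕ.+ i))))

-- The margin 1/500 over 1/3 absorbs the O(A) once log K is large.
c₀ : ℚ
c₀ = ℤ.+ 1 / 3 + ℤ.+ 1 / 500

opaque
  unfolding rcp
  -- The initial interval has N + 3 elements here. The interval (N, 2N] would fail at N = 1, where
  -- the modulus 2 alone gives 1/4.
  surplus-small : ∀ {n} → n ℕ.< 27 → c₀ ≤ ι (suc n) * (recipSq (suc n) (4 ℕ.+ n) - lcmSq (suc n) (4 ℕ.+ n))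
  surplus-small = from-yes (ℕ.allUpTo? (λ n → c₀ ≤? ι (suc n) * (recipSq (suc n) (4 ℕ.+ n) - lcmSq (suc n) (4 ℕ.+ n))) 27)

-- The fraction 46/95 lies between `c₀ + κ` and the value of N/(N + 3/5) - N/(2N + 3/5), the
-- telescoped bound, at N = 28. At N = 27 that value is still below `c₀ + κ`, which fixes the
-- threshold.
recipSq≥ : ∀ t → let N = 28 ℕ.+ t in ℤ.+ 46 / 95 * rcp N ≤ recipSq N N
recipSq≥ t = ≤-trans (≤-reflexive (solve 2 (λ a b → a := b :+ a :- b) refl (c * rcp N) r))
  (≤+⇒-≤ {r + c * rcp N} {r} {recipSq N N} (≤-trans (≤-reflexive (trans (cong (r +_) (trans (cong₂ _*_ (sym (frac-/ 46 94)) (rcp-suc n)) (frac-* 46 94 1 n)))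
      (frac-+ 5 (7 ℕ.+ 5 ℕ.* (n ℕ.+ N)) 46 (n ℕ.+ 94 ℕ.* suc n))))
    (≤-trans (frac-≤ _ _ 5 (7 ℕ.+ 5 ℕ.* n) (≤-slack (426 ℕ.+ 2130 ℕ.* t ℕ.+ 75 ℕ.* t ℕ.* t) (e t)))
      (≤-trans (recipSq-lower n N) (≤-reflexive (+-comm (recipSq N N) r))))))
  where
  N = 28 ℕ.+ t
  n = 27 ℕ.+ t
  r = frac 5 (7 ℕ.+ 5 ℕ.* (n ℕ.+ N))
  c = ℤ.+ 46 / 95
  e : ∀ t → (5 ℕ.* suc (27 ℕ.+ t ℕ.+ 94 ℕ.* suc (27 ℕ.+ t)) ℕ.+ 46 ℕ.* suc (7 ℕ.+ 5 ℕ.* (27 ℕ.+ t ℕ.+ (28 ℕ.+ t)))) ℕ.* suc (7 ℕ.+ 5 ℕ.* (27 ℕ.+ t))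
      ℕ.+ (426 ℕ.+ 2130 ℕ.* t ℕ.+ 75 ℕ.* t ℕ.* t)
    ≡ 5 ℕ.* (suc (7 ℕ.+ 5 ℕ.* (27 ℕ.+ t ℕ.+ (28 ℕ.+ t))) ℕ.* suc (27 ℕ.+ t ℕ.+ 94 ℕ.* suc (27 ℕ.+ t)))
  e = solve-∀

surplus-large : ∀ N → .{{ℕ.NonZero N}} → 28 ℕ.≤ N → c₀ ≤ ι N * (recipSq N N - lcmSq N N)
surplus-large N 28≤N = begin
  c₀                                    ≡⟨⟩
  c₀ + κ - κ                            ≤⟨ +-mono-≤ main (neg-antimono-≤ (lcmSq-bound N)) ⟩
  ι N * recipSq N N - ι N * lcmSq N N
    ≡⟨ solve 3 (λ n a b → n :* a :- n :* b := n :* (a :- b)) refl (ι N) (recipSq N N) (lcmSq N N) ⟩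
  ι N * (recipSq N N - lcmSq N N) ∎
  where
  open ≤-Reasoning
  c = ℤ.+ 46 / 95
  lower : c * rcp N ≤ recipSq N N
  lower = subst (λ N → c * rcp N ≤ recipSq N N) (ℕ.m+[n∸m]≡n 28≤N) (recipSq≥ (N ℕ.∸ 28))
  main : c₀ + κ ≤ ι N * recipSq N N
  main = begin
    c₀ + κ                  ≤⟨ from-yes (c₀ + κ ≤? c) ⟩
    c                       ≡⟨ sym (trans (cong (_* c) (ι*rcp N)) (*-identityˡ c)) ⟩
    ι N * rcp N * c         ≡⟨ trans (*-assoc (ι N) (rcp N) c) (cong (ι N *_) (*-comm (rcp N) c)) ⟩
    ι N * (c * rcp N)       ≤⟨ mulˡ (ι N) (0≤ι N) lower ⟩
    ι N * recipSq N N ∎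

-- k is the number of moduli in the initial interval D = (N, N + k].
surplus : ∀ N → .{{ℕ.NonZero N}} → ∃ λ k → k ℕ.≤ 4 ℕ.* N × c₀ ≤ ι N * (recipSq N k - lcmSq N k)
surplus N@(suc n) with 27 ℕ.≤? n
... | no h = 4 ℕ.+ n , ≤-slack (3 ℕ.* n) (e n) , surplus-small (ℕ.≰⇒> h)
  where
  e : ∀ n → 4 ℕ.+ n ℕ.+ 3 ℕ.* n ≡ 4 ℕ.* suc n
  e = solve-∀
... | yes h = N , ℕ.m≤n*m N 4 , surplus-large N (s≤s h)

-- The exponential function

-- Σ F i j over i + j = n
antidiag : (ℕ → ℕ → ℚ) → ℕ → ℚ
antidiag F zero = F 0 0
antidiag F (suc n) = F 0 (suc n) + antidiag (λ i → F (suc i)) n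

antidiag-cong : ∀ n {F G : ℕ → ℕ → ℚ} → (∀ i j → i ℕ.+ j ≡ n → F i j ≡ G i j) → antidiag F n ≡ antidiag G n
antidiag-cong zero h = h 0 0 refl
antidiag-cong (suc n) h = cong₂ _+_ (h 0 (suc n) refl) (antidiag-cong n λ i j e → h (suc i) j (cong suc e))

antidiag-+ : ∀ n (F G : ℕ → ℕ → ℚ) → antidiag (λ i j → F i j + G i j) n ≡ antidiag F n + antidiag G n
antidiag-+ zero F G = refl
antidiag-+ (suc n) F G = trans (cong (F 0 (suc n) + G 0 (suc n) +_) (antidiag-+ n (λ i → F (suc i)) (λ i → G (suc i))))
  (solve 4 (λ a b c d → a :+ b :+ (c :+ d) := a :+ c :+ (b :+ d)) refl
    (F 0 (suc n)) (G 0 (suc n)) (antidiag (λ i → F (suc i)) n) (antidiag (λ i → G (suc i)) n))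

antidiag-* : ∀ n c (F : ℕ → ℕ → ℚ) → antidiag (λ i j → c * F i j) n ≡ c * antidiag F n
antidiag-* zero c F = refl
antidiag-* (suc n) c F = trans (cong (c * F 0 (suc n) +_) (antidiag-* n c (λ i → F (suc i))))
  (sym (*-distribˡ-+ c (F 0 (suc n)) (antidiag (λ i → F (suc i)) n)))

antidiag-last : ∀ n (F : ℕ → ℕ → ℚ) → antidiag F (suc n) ≡ antidiag (λ i j → F i (suc j)) n + F (suc n) 0
antidiag-last zero F = refl
antidiag-last (suc n) F = trans (cong (F 0 (suc (suc n)) +_) (antidiag-last n (λ i → F (suc i))))
  (sym (+-assoc (F 0 (suc (suc n))) (antidiag (λ i j → F (suc i) (suc j)) n) (F (suc (suc n)) 0)))

module _ (a b : ℚ) where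

  private
    F : ℕ → ℕ → ℚ
    F i j = expTerm a i * expTerm b j

  antidiag-row : ∀ n → antidiag (λ i j → ι i * F i j) (suc n) ≡ a * antidiag F n
  antidiag-row n = begin
    0ℚ * F 0 (suc n) + antidiag (λ i j → ι (suc i) * F (suc i) j) n
      ≡⟨ cong₂ _+_ (*-zeroˡ (F 0 (suc n))) (antidiag-cong n λ i j _ → trans
           (solve 3 (λ n s t → n :* (s :* t) := s :* n :* t) refl (ι (suc i)) (expTerm a (suc i)) (expTerm b j))
           (trans (cong (_* expTerm b j) (sym (expTerm-suc a i)))
             (solve 3 (λ s a t → s :* a :* t := a :* (s :* t)) refl (expTerm a i) a (expTerm b j)))) ⟩
    0ℚ + antidiag (λ i j → a * F i j) n
      ≡⟨ trans (+-identityˡ _) (antidiag-* n a F) ⟩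
    a * antidiag F n ∎
    where open ≡-Reasoning

  antidiag-column : ∀ n → antidiag (λ i j → ι j * F i j) (suc n) ≡ b * antidiag F n
  antidiag-column n = begin
    antidiag (λ i j → ι j * F i j) (suc n)
      ≡⟨ antidiag-last n (λ i j → ι j * F i j) ⟩
    antidiag (λ i j → ι (suc j) * F i (suc j)) n + 0ℚ * F (suc n) 0
      ≡⟨ cong₂ _+_ (antidiag-cong n λ i j _ → trans
           (solve 3 (λ n s t → n :* (s :* t) := s :* (t :* n)) refl (ι (suc j)) (expTerm a i) (expTerm b (suc j)))
           (trans (cong (expTerm a i *_) (sym (expTerm-suc b j)))
             (solve 3 (λ s b t → s :* (t :* b) := b :* (s :* t)) refl (expTerm a i) b (expTerm b j))))
           (*-zeroˡ (F (suc n) 0)) ⟩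
    antidiag (λ i j → b * F i j) n + 0ℚ
      ≡⟨ trans (+-identityʳ _) (antidiag-* n b F) ⟩
    b * antidiag F n ∎
    where open ≡-Reasoning

  -- The binomial theorem without binomial coefficients: on the antidiagonal i + j = n + 1, multiply
  -- by n + 1 and split it as i + j. The weight i yields `a` times the previous antidiagonal and the
  -- weight j yields `b` times it.
  expTerm-+ : ∀ n → antidiag F n ≡ expTerm (a + b) n
  expTerm-+ zero = refl
  expTerm-+ (suc n) = ≤-antisym (cancel (≤-reflexive e)) (cancel (≤-reflexive (sym e)))
    where
    cancel : ∀ {p q} → p * ι (suc n) ≤ q * ι (suc n) → p ≤ q
    cancel = *-cancelʳ-ι (suc n)
    e : antidiag F (suc n) * ι (suc n) ≡ expTerm (a + b) (suc n) * ι (suc n)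
    e = begin
      antidiag F (suc n) * ι (suc n)
        ≡⟨ trans (*-comm (antidiag F (suc n)) (ι (suc n))) (sym (antidiag-* (suc n) (ι (suc n)) F)) ⟩
      antidiag (λ i j → ι (suc n) * F i j) (suc n)
        ≡⟨ antidiag-cong (suc n) (λ i j e → trans (cong (_* F i j) (trans (cong ι (sym e)) (ι-+ i j)))
             (*-distribʳ-+ (F i j) (ι i) (ι j))) ⟩
      antidiag (λ i j → ι i * F i j + ι j * F i j) (suc n)
        ≡⟨ antidiag-+ (suc n) (λ i j → ι i * F i j) (λ i j → ι j * F i j) ⟩
      antidiag (λ i j → ι i * F i j) (suc n) + antidiag (λ i j → ι j * F i j) (suc n)
        ≡⟨ cong₂ _+_ (antidiag-row n) (antidiag-column n) ⟩
      a * antidiag F n + b * antidiag F n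
        ≡⟨ trans (sym (*-distribʳ-+ (antidiag F n) a b)) (trans (cong ((a + b) *_) (expTerm-+ n)) (*-comm (a + b) (expTerm (a + b) n))) ⟩
      expTerm (a + b) n * (a + b)
        ≡⟨ expTerm-suc (a + b) n ⟩
      expTerm (a + b) (suc n) * ι (suc n) ∎
      where open ≡-Reasoning

-- Products of truncated exponential series

rect : (ℕ → ℕ → ℚ) → ℕ → ℕ → ℚ
rect F p q = Σ[i< p ] (λ i → Σ[i< q ] (F i))

-- Σ F i j over i + j < m
triangle : (ℕ → ℕ → ℚ) → ℕ → ℚ
triangle F zero = 0ℚ
triangle F (suc m) = Σ[i< suc m ] (F 0) + triangle (λ i → F (suc i)) m

triangle-antidiag : ∀ m F → triangle F m ≡ Σ[i< m ] (antidiag F)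
triangle-antidiag zero F = refl
triangle-antidiag (suc m) F = begin
  Σ[i< suc m ] (F 0) + triangle F′ m
    ≡⟨ cong₂ _+_ (Σ-first m (F 0)) (triangle-antidiag m F′) ⟩
  F 0 0 + Σ[i< m ] (λ i → F 0 (suc i)) + Σ[i< m ] (antidiag F′)
    ≡⟨ trans (+-assoc (F 0 0) _ _) (cong (F 0 0 +_) (sym (Σ-+ m (λ i → F 0 (suc i)) (antidiag F′)))) ⟩
  F 0 0 + Σ[i< m ] (λ i → antidiag F (suc i))
    ≡⟨ sym (Σ-first m (antidiag F)) ⟩
  Σ[i< suc m ] (antidiag F) ∎
  where
  open ≡-Reasoning
  F′ = λ i → F (suc i)

Σ-abs : ∀ n {f g : ℕ → ℚ} → (∀ i → ∣ f i ∣ ≤ g i) → ∣ Σ[i< n ] f ∣ ≤ Σ[i< n ] g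
Σ-abs zero h = ≤-refl
Σ-abs (suc n) {f} {g} h = ≤-trans (∣p+q∣≤∣p∣+∣q∣ (Σ[i< n ] f) (f n)) (+-mono-≤ (Σ-abs n h) (h n))

Σ-tail-abs : ∀ {m n} {f g : ℕ → ℚ} → m ℕ.≤ n → (∀ i → ∣ f i ∣ ≤ g i) →
  ∣ Σ[i< n ] f - Σ[i< m ] f ∣ ≤ Σ[i< n ] g - Σ[i< m ] g
Σ-tail-abs {m} {n} {f} {g} m≤n h with ℕ.m≤n⇒∃[o]m+o≡n m≤n
... | o , refl = subst₂ _≤_ (cong ∣_∣ (e f)) (e g) (Σ-abs o (λ i → h (m ℕ.+ i)))
  where
  e : ∀ f → Σ[i< o ] (λ i → f (m ℕ.+ i)) ≡ Σ[i< m ℕ.+ o ] f - Σ[i< m ] f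
  e f = trans (solve 2 (λ a b → b := a :+ b :- a) refl (Σ[i< m ] f) (Σ[i< o ] (λ i → f (m ℕ.+ i))))
    (cong (_- Σ[i< m ] f) (sym (Σ-split m o f)))

-- Both differences run over the same entries, those of the rectangle outside the triangle, and
-- there `F` is dominated by `G`. The induction removes the first row.
rect-triangle : ∀ m {p q} {F G : ℕ → ℕ → ℚ} → m ℕ.≤ p → m ℕ.≤ q → (∀ i j → ∣ F i j ∣ ≤ G i j) →
  ∣ rect F p q - triangle F m ∣ ≤ rect G p q - triangle G m
rect-triangle zero {p} {q} {F} {G} _ _ h = subst₂ _≤_
  (cong ∣_∣ (sym (+-identityʳ (rect F p q)))) (sym (+-identityʳ (rect G p q))) (Σ-abs p λ i → Σ-abs q (h i))
rect-triangle (suc m) {suc p} {q} {F} {G} (s≤s m≤p) m<q h = begin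
  ∣ rect F (suc p) q - triangle F (suc m) ∣
    ≡⟨ cong ∣_∣ (e F) ⟩
  ∣ (Σ[i< q ] (F 0) - Σ[i< suc m ] (F 0)) + (rect F′ p q - triangle F′ m) ∣
    ≤⟨ ∣p+q∣≤∣p∣+∣q∣ (Σ[i< q ] (F 0) - Σ[i< suc m ] (F 0)) (rect F′ p q - triangle F′ m) ⟩
  ∣ Σ[i< q ] (F 0) - Σ[i< suc m ] (F 0) ∣ + ∣ rect F′ p q - triangle F′ m ∣
    ≤⟨ +-mono-≤ (Σ-tail-abs m<q (h 0)) (rect-triangle m {F = F′} m≤p (ℕ.<⇒≤ m<q) (λ i → h (suc i))) ⟩
  (Σ[i< q ] (G 0) - Σ[i< suc m ] (G 0)) + (rect G′ p q - triangle G′ m)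
    ≡⟨ sym (e G) ⟩
  rect G (suc p) q - triangle G (suc m) ∎
  where
  open ≤-Reasoning
  F′ = λ i → F (suc i)
  G′ = λ i → G (suc i)
  e : ∀ F → let F′ = λ i → F (suc i) in rect F (suc p) q - triangle F (suc m) ≡
    (Σ[i< q ] (F 0) - Σ[i< suc m ] (F 0)) + (rect F′ p q - triangle F′ m)
  e F = trans (cong (_- triangle F (suc m)) (Σ-first p (λ i → Σ[i< q ] (F i))))
    (solve 4 (λ a r b t → a :+ r :- (b :+ t) := (a :- b) :+ (r :- t)) refl
      (Σ[i< q ] (F 0)) (rect (λ i → F (suc i)) p q) (Σ[i< suc m ] (F 0)) (triangle (λ i → F (suc i)) m))

0≤triangle : ∀ m {F : ℕ → ℕ → ℚ} → (∀ i j → 0ℚ ≤ F i j) → 0ℚ ≤ triangle F m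
0≤triangle zero h = ≤-refl
0≤triangle (suc m) h = 0≤+ (Σ-≥0 (suc m) λ j _ → h 0 j) (0≤triangle m λ i → h (suc i))

rect≤triangle : ∀ p q {F : ℕ → ℕ → ℚ} → (∀ i j → 0ℚ ≤ F i j) → rect F p q ≤ triangle F (p ℕ.+ q)
rect≤triangle zero q h = 0≤triangle q h
rect≤triangle (suc p) q {F} h = ≤-trans (≤-reflexive (Σ-first p (λ i → Σ[i< q ] (F i))))
  (+-mono-≤ (Σ-extend (F 0) (ℕ.m≤n⇒m≤1+n (ℕ.m≤n+m q p)) (h 0)) (rect≤triangle p q λ i → h (suc i)))

expSum-* : ∀ a b m → expSum a m * expSum b m ≡ rect (λ i j → expTerm a i * expTerm b j) m m
expSum-* a b m = sym (trans (Σ-cong m λ i _ → Σ-*ˡ m (expTerm a i) (expTerm b))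
  (Σ-*ʳ m (expSum b m) (expTerm a)))

expSum-+ : ∀ a b m → triangle (λ i j → expTerm a i * expTerm b j) m ≡ expSum (a + b) m
expSum-+ a b m = trans (triangle-antidiag m (λ i j → expTerm a i * expTerm b j)) (Σ-cong m λ i _ → expTerm-+ a b i)

-- The product of the truncations sums over an m by m square, which contains the triangle of size m
-- and lies in that of size 2m. The error is therefore a stretch of the series for `A + B`, which
-- tends to 0.
expSum-product : ∀ {a b A B} → ∣ a ∣ ≤ A → ∣ b ∣ ≤ B → ∀ m →
  ∣ expSum a m * expSum b m - expSum (a + b) m ∣ ≤ expSum (A + B) (m ℕ.+ m) - expSum (A + B) m
expSum-product {a} {b} {A} {B} ha hb m = begin
  ∣ expSum a m * expSum b m - expSum (a + b) m ∣
    ≡⟨ cong ∣_∣ (cong₂ _-_ (expSum-* a b m) (sym (expSum-+ a b m))) ⟩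
  ∣ rect F m m - triangle F m ∣
    ≤⟨ rect-triangle m {F = F} {G} ℕ.≤-refl ℕ.≤-refl F≤G ⟩
  rect G m m - triangle G m
    ≤⟨ +-monoˡ-≤ (- triangle G m) (rect≤triangle m m λ i j → 0≤* (0≤expTerm A≥0 i) (0≤expTerm B≥0 j)) ⟩
  triangle G (m ℕ.+ m) - triangle G m
    ≡⟨ cong₂ _-_ (expSum-+ A B (m ℕ.+ m)) (expSum-+ A B m) ⟩
  expSum (A + B) (m ℕ.+ m) - expSum (A + B) m ∎
  where
  open ≤-Reasoning
  A≥0 = ≤-trans (0≤∣p∣ a) ha
  B≥0 = ≤-trans (0≤∣p∣ b) hb
  F = λ i j → expTerm a i * expTerm b j
  G = λ i j → expTerm A i * expTerm B j
  F≤G : ∀ i j → ∣ F i j ∣ ≤ G i j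
  F≤G i j = ≤-trans (≤-reflexive (∣p*q∣≡∣p∣*∣q∣ (expTerm a i) (expTerm b j)))
    (mul (0≤expTerm A≥0 i) (0≤∣p∣ (expTerm b j)) (∣expTerm∣≤ ha i) (∣expTerm∣≤ hb j))

0≤p² : ∀ p → 0ℚ ≤ p * p
0≤p² p with ≤-total 0ℚ p
... | inj₁ h = 0≤* h h
... | inj₂ h = subst (0ℚ ≤_) (solve 1 (λ p → :- p :* :- p := p :* p) refl p)
  (0≤* (neg-antimono-≤ h) (neg-antimono-≤ h))

-- For b ≥ -1 the terms from the second on pair up to b²ʲ/(2j)! · (1 + b/(2j+1)) ≥ 0.
1+b≤expSum : ∀ b → - 1ℚ ≤ b → ∀ n → 2 ℕ.≤ n → 1ℚ + b ≤ expSum b n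
1+b≤expSum b b≥-1 (suc (suc m)) (s≤s (s≤s _)) = finish m (go m)
  where
  Even : ℕ → Set
  Even k = 0ℚ ≤ expTerm b k × 1ℚ + b ≤ expSum b k
  term-sq : ∀ k → 0ℚ ≤ expTerm b k → 0ℚ ≤ expTerm b (suc (suc k))
  term-sq k h = subst (0ℚ ≤_)
    (solve 4 (λ t b i j → t :* (b :* b) :* (i :* j) := t :* (b :* i) :* (b :* j)) refl (expTerm b k) b (inv k) (inv (suc k)))
    (0≤* (0≤* h (0≤p² b)) (0≤* (0≤inv k) (0≤inv (suc k))))
  0≤1+b/ : ∀ k → 0ℚ ≤ 1ℚ + b * inv k
  0≤1+b/ k = begin
    0ℚ                         ≡⟨ sym (+-inverseʳ 1ℚ) ⟩
    1ℚ - 1ℚ                    ≤⟨ +-monoʳ-≤ 1ℚ (neg-antimono-≤ (inv-anti {0} {k} z≤n)) ⟩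
    1ℚ - inv k                 ≡⟨ cong (1ℚ +_) (trans (cong -_ (sym (*-identityˡ (inv k)))) (neg-distribˡ-* 1ℚ (inv k))) ⟩
    1ℚ + - 1ℚ * inv k          ≤⟨ +-monoʳ-≤ 1ℚ (mulʳ (inv k) (0≤inv k) b≥-1) ⟩
    1ℚ + b * inv k ∎
    where open ≤-Reasoning
  step : ∀ k → Even k → Even (suc (suc k))
  step k (t≥0 , h) = term-sq k t≥0 , (begin
    1ℚ + b                                            ≤⟨ h ⟩
    expSum b k                                        ≡⟨ sym (+-identityʳ (expSum b k)) ⟩
    expSum b k + 0ℚ                                   ≤⟨ +-monoʳ-≤ (expSum b k) (0≤* t≥0 (0≤1+b/ k)) ⟩
    expSum b k + expTerm b k * (1ℚ + b * inv k)
      ≡⟨ trans (cong (expSum b k +_) (trans (*-distribˡ-+ (expTerm b k) 1ℚ (b * inv k))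
             (cong (_+ expTerm b k * (b * inv k)) (*-identityʳ (expTerm b k)))))
           (sym (+-assoc (expSum b k) (expTerm b k) (expTerm b k * (b * inv k)))) ⟩
    expSum b (suc (suc k)) ∎)
    where open ≤-Reasoning
  even₂ : Even 2
  even₂ = term-sq 0 (<⇒≤ 0<1) , ≤-reflexive (sym (cong₂ _+_ (+-identityˡ 1ℚ) (trans (*-identityˡ (b * inv 0)) (*-identityʳ b))))
  -- As `step` advances by two, the invariant is available at one of any two consecutive lengths.
  -- For the shorter one, `finish` adds a single nonnegative term.
  go : ∀ m → Even (2 ℕ.+ m) ⊎ Even (1 ℕ.+ m)
  go zero = inj₁ even₂
  go (suc m) with go m
  ... | inj₁ e = inj₂ e
  ... | inj₂ e = inj₁ (step (suc m) e)
  finish : ∀ m → Even (2 ℕ.+ m) ⊎ Even (1 ℕ.+ m) → 1ℚ + b ≤ expSum b (2 ℕ.+ m)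
  finish m (inj₁ (_ , h)) = h
  finish m (inj₂ (t≥0 , h)) = ≤-trans h (subst (_≤ expSum b (2 ℕ.+ m)) (+-identityʳ (expSum b (1 ℕ.+ m))) (+-monoʳ-≤ (expSum b (1 ℕ.+ m)) t≥0))

infix 4 _≲_
-- q ≤ lim f
_≲_ : ℚ → (ℕ → ℚ) → Set
q ≲ f = ∀ ε → 0ℚ < ε → ∃ λ M → ∀ n → M ℕ.≤ n → q ≤ f n + ε

-- The exponents depend on n because the exponential of a real is a diagonal sequence. The uniform
-- bounds `A` and `B` control the error of `expSum-product`, which takes one half of ε. The other
-- half pays for the slack in the first factor, multiplied by the bounded second factor.
≲-exp-* : ∀ {p q A B} {a b : ℕ → ℚ} → 0ℚ ≤ p → 0ℚ ≤ q → (∀ n → ∣ a n ∣ ≤ A) → (∀ n → ∣ b n ∣ ≤ B) →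
  p ≲ (λ n → expSum (a n) n) → (∀ n → 2 ℕ.≤ n → q ≤ expSum (b n) n) → p * q ≲ (λ n → expSum (a n + b n) n)
≲-exp-* {p} {q} {A} {B} {a} {b} p≥0 q≥0 ha hb hp hq ε ε>0 = M , bound
  where
  A≥0 = ≤-trans (0≤∣p∣ (a 0)) (ha 0)
  B≥0 = ≤-trans (0≤∣p∣ (b 0)) (hb 0)
  module EB = ExpBound B B≥0
  module E = ExpBound (A + B) (0≤+ A≥0 B≥0)
  ε/2>0 : 0ℚ < ½ * ε
  ε/2>0 = 0<* {½} {ε} (positive⁻¹ ½) ε>0
  cs = *-small EB.C (½ * ε) EB.C≥0 ε/2>0
  -- Halved because `*-small` asks for a strict inequality.
  ε₁ = ½ * proj₁ cs
  ε₁>0 : 0ℚ < ε₁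
  ε₁>0 = 0<* {½} {proj₁ cs} (positive⁻¹ ½) (proj₁ (proj₂ cs))
  ε₁<ε′ : ε₁ < proj₁ cs
  ε₁<ε′ = subst₂ _<_ (+-identityʳ ε₁) (½+½ (proj₁ cs)) (+-monoʳ-< ε₁ ε₁>0)
  ts = E.T-small (½ * ε) ε/2>0
  M₁ = proj₁ (hp ε₁ ε₁>0)
  M₂ = proj₁ ts
  M = 2 ℕ.+ (M₁ ℕ.+ M₂)
  bound : ∀ n → M ℕ.≤ n → p * q ≤ expSum (a n + b n) n + ε
  bound n M≤n = begin
    p * q                              ≤⟨ mulˡ p p≥0 q≤ ⟩
    p * Eb                             ≤⟨ mulʳ Eb (≤-trans q≥0 q≤) (proj₂ (hp ε₁ ε₁>0) n M₁≤n) ⟩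
    (Ea + ε₁) * Eb                     ≡⟨ *-distribʳ-+ Eb Ea ε₁ ⟩
    Ea * Eb + ε₁ * Eb                  ≤⟨ +-mono-≤ product≤ (mulˡ ε₁ (<⇒≤ ε₁>0) Eb≤C) ⟩
    (Eab + ½ * ε) + ε₁ * EB.C
      ≤⟨ +-monoʳ-≤ (Eab + ½ * ε) (≤-trans (≤-reflexive (*-comm ε₁ EB.C)) (<⇒≤ (proj₂ (proj₂ cs) ε₁ (<⇒≤ ε₁>0) ε₁<ε′))) ⟩
    (Eab + ½ * ε) + ½ * ε              ≡⟨ trans (+-assoc Eab (½ * ε) (½ * ε)) (cong (Eab +_) (½+½ ε)) ⟩
    Eab + ε ∎
    where
    open ≤-Reasoning
    Ea = expSum (a n) n
    Eb = expSum (b n) n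
    Eab = expSum (a n + b n) n
    2≤n = ℕ.m+n≤o⇒m≤o 2 M≤n
    M₁₂≤n = ℕ.m+n≤o⇒n≤o 2 M≤n
    M₁≤n = ℕ.m+n≤o⇒m≤o M₁ M₁₂≤n
    M₂≤n = ℕ.m+n≤o⇒n≤o M₁ M₁₂≤n
    q≤ : q ≤ Eb
    q≤ = hq n 2≤n
    Eb≤C : Eb ≤ EB.C
    Eb≤C = ≤-trans (p≤∣p∣ Eb) (≤-trans (Σ-abs n (∣expTerm∣≤ (hb n))) (EB.S≤C n))
    product≤ : Ea * Eb ≤ Eab + ½ * ε
    product≤ = -≤⇒≤+ {Ea * Eb} {Eab} (≤-trans (p≤∣p∣ (Ea * Eb - Eab)) (≤-trans (expSum-product (ha n) (hb n) n)
      (≤-trans (≤+⇒-≤ {expSum (A + B) (n ℕ.+ n)} {expSum (A + B) n} (E.S-tail n (proj₁ (proj₂ ts n M₂≤n)) n))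
        (<⇒≤ (proj₂ (proj₂ ts n M₂≤n))))))

-- Products of factors 1 - x against the exponential

Π[i<_] : ℕ → (ℕ → ℚ) → ℚ
Π[i< zero ] f = 1ℚ
Π[i< suc n ] f = Π[i< n ] f * f n

Π-≥0 : ∀ n {f : ℕ → ℚ} → (∀ i → 0ℚ ≤ f i) → 0ℚ ≤ Π[i< n ] f
Π-≥0 zero h = <⇒≤ 0<1
Π-≥0 (suc n) h = 0≤* (Π-≥0 n h) (h n)

≲-resp : ∀ {p q} {f g : ℕ → ℚ} → p ≡ q → (∀ n → f n ≡ g n) → p ≲ f → q ≲ g
≲-resp refl e h ε ε>0 = proj₁ (h ε ε>0) , λ n M≤n → subst (λ x → _ ≤ x + ε) (e n) (proj₂ (h ε ε>0) n M≤n)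

-- The inequalities 1 - x ≤ exp(-x) are multiplied. The hypothesis x ≤ 1 keeps the factors
-- nonnegative and puts -x in the range of `1+b≤expSum`; x may be negative.
Π≲exp : ∀ k (x : ℕ → ℚ) → (∀ i → x i ≤ 1ℚ) → Π[i< k ] (λ i → 1ℚ - x i) ≲ (λ n → expSum (- Σ[i< k ] x) n)
Π≲exp zero x h ε ε>0 = 2 , λ n 2≤n → ≤-trans (1+b≤expSum 0ℚ (from-yes (- 1ℚ ≤? 0ℚ)) n 2≤n)
  (subst (_≤ expSum 0ℚ n + ε) (+-identityʳ (expSum 0ℚ n)) (+-monoʳ-≤ (expSum 0ℚ n) (<⇒≤ ε>0)))
Π≲exp (suc k) x h = ≲-resp {p = P * (1ℚ - x k)} {f = λ n → expSum (- S + - x k) n} refl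
  (λ n → cong (λ z → expSum z n) (sym (neg-distrib-+ S (x k))))
  (≲-exp-* {P} {1ℚ - x k} {∣ - S ∣} {∣ - x k ∣} {λ _ → - S} {λ _ → - x k} (Π-≥0 k λ i → 0≤-gap (h i)) (0≤-gap (h k)) (λ _ → ≤-refl) (λ _ → ≤-refl)
    (Π≲exp k x h) λ n → 1+b≤expSum (- x k) (neg-antimono-≤ (h k)) n)
  where
  P = Π[i< k ] (λ i → 1ℚ - x i)
  S = Σ[i< k ] x

-- Monotonicity of exp takes the form of one more factor 1 ≤ exp(S - y n), which raises the exponent
-- from -S to -y n.
Π≲exp-neg : ∀ k (x y : ℕ → ℚ) → (∀ i → x i ≤ 1ℚ) → (∀ n → 0ℚ ≤ y n) → (∀ n → y n ≤ Σ[i< k ] x) →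
  Π[i< k ] (λ i → 1ℚ - x i) ≲ (λ n → expSum (- y n) n)
Π≲exp-neg k x y h y≥0 y≤ = ≲-resp {p = P * 1ℚ} {f = λ n → expSum (- S + (S - y n)) n} (*-identityʳ P)
  (λ n → cong (λ z → expSum z n) (solve 2 (λ s y → :- s :+ (s :- y) := :- y) refl S (y n)))
  (≲-exp-* {P} {1ℚ} {∣ - S ∣} {S} {λ _ → - S} {λ n → S - y n} (Π-≥0 k λ i → 0≤-gap (h i)) (<⇒≤ 0<1) (λ _ → ≤-refl)
    (λ n → ≤-trans (≤-reflexive (0≤p⇒∣p∣≡p (0≤-gap (y≤ n)))) (subst (S - y n ≤_) (+-identityʳ S) (+-monoʳ-≤ S (neg-antimono-≤ (y≥0 n)))))
    (Π≲exp k x h) λ n 2≤n → ≤-trans (subst (_≤ 1ℚ + (S - y n)) (+-identityʳ 1ℚ) (+-monoʳ-≤ 1ℚ (0≤-gap (y≤ n))))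
      (1+b≤expSum (S - y n) (≤-trans (from-yes (- 1ℚ ≤? 0ℚ)) (0≤-gap (y≤ n))) n 2≤n))
  where
  P = Π[i< k ] (λ i → 1ℚ - x i)
  S = Σ[i< k ] x

-- Harmonic sums

-- Since `rcp 0` is 0, this is the harmonic number 1 + 1/2 + ... + 1/(X - 1).
H : ℕ → ℚ
H X = Σ[i< X ] rcp

H-mono : ∀ {m n} → m ℕ.≤ n → H m ≤ H n
H-mono h = Σ-extend rcp h 0≤rcp

0≤H : ∀ n → 0ℚ ≤ H n
0≤H n = Σ-≥0 n λ i _ → 0≤rcp i

H-double : ∀ X → .{{ℕ.NonZero X}} → H X + ½ ≤ H (X ℕ.+ X)
H-double X = begin
  H X + ½
    ≡⟨ cong (H X +_) half ⟩
  H X + ι X * rcp (X ℕ.+ X)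
    ≡⟨ cong (H X +_) (sym (Σ-const X (rcp (X ℕ.+ X)))) ⟩
  H X + Σ[i< X ] (λ _ → rcp (X ℕ.+ X))
    ≤⟨ +-monoʳ-≤ (H X) (Σ-mono X λ i i<X → rcp-anti {X ℕ.+ i} {{ℕ.>-nonZero (ℕ.≤-trans (ℕ.>-nonZero⁻¹ X) (ℕ.m≤m+n X i))}} (ℕ.+-monoʳ-≤ X (ℕ.<⇒≤ i<X))) ⟩
  H X + Σ[i< X ] (λ i → rcp (X ℕ.+ i))
    ≡⟨ sym (Σ-split X X rcp) ⟩
  H (X ℕ.+ X) ∎
  where
  open ≤-Reasoning
  half : ½ ≡ ι X * rcp (X ℕ.+ X)
  half = sym (trans (cong (λ n → ι X * rcp n) (trans (cong (X ℕ.+_) (sym (ℕ.+-identityʳ X))) (ℕ.*-comm 2 X)))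
    (trans (cong (ι X *_) (rcp-* X 2)) (trans (sym (*-assoc (ι X) (rcp X) (rcp 2)))
      (trans (cong (_* rcp 2) (ι*rcp X)) (trans (*-identityˡ (rcp 2)) (rcp-inv 1))))))

opaque
  -- Doubling the length adds at least 1/2. Opaque because the witness for q = 29000 is 8 · 2^58000,
  -- where the 8 secures 5 ≤ K.
  H-unbounded : ∀ q → ∃ λ K → 5 ℕ.≤ K × q ≤ H K
  H-unbounded q = 8 ℕ.* pow n , five n , ≤-trans q≤ (≤-trans (grow n) (H-mono (ℕ.m≤n*m (pow n) 8)))
    where
    pow : ℕ → ℕ
    pow zero = 1
    pow (suc j) = pow j ℕ.+ pow j
    pow≥1 : ∀ j → 1 ℕ.≤ pow j
    pow≥1 zero = ℕ.≤-refl
    pow≥1 (suc j) = ℕ.≤-trans (pow≥1 j) (ℕ.m≤m+n (pow j) (pow j))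
    five : ∀ j → 5 ℕ.≤ 8 ℕ.* pow j
    five j = ℕ.≤-trans (ℕ.m≤m+n 5 3) (ℕ.*-monoʳ-≤ 8 (pow≥1 j))
    grow : ∀ j → ι j * ½ ≤ H (pow j)
    grow zero = subst (_≤ H 1) (sym (*-zeroˡ ½)) (0≤H 1)
    grow (suc j) = ≤-trans (≤-reflexive (ι-suc* j ½)) (≤-trans (+-monoˡ-≤ ½ (grow j)) (H-double (pow j) {{ℕ.>-nonZero (pow≥1 j)}}))
    n : ℕ
    n = proj₁ (arch (q + q))
    q≤ : q ≤ ι n * ½
    q≤ = ≤-trans (≤-reflexive (trans (sym (½+½ q)) (trans (sym (*-distribˡ-+ ½ q q)) (*-comm ½ (q + q)))))
      (mulʳ ½ (<⇒≤ (positive⁻¹ ½)) (proj₂ (arch (q + q))))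

-- With X = K / 5, at most 4X + 5 ≤ 9X terms are dropped, each at most 1/X.
H-fifth : ∀ K → 5 ℕ.≤ K → H K ≤ H (K ℕ./ 5) + ι 9
H-fifth K 5≤K = begin
  H K
    ≤⟨ H-mono K≤ ⟩
  H (X ℕ.+ (4 ℕ.* X ℕ.+ 5))
    ≡⟨ Σ-split X (4 ℕ.* X ℕ.+ 5) rcp ⟩
  H X + Σ[i< 4 ℕ.* X ℕ.+ 5 ] (λ i → rcp (X ℕ.+ i))
    ≤⟨ +-monoʳ-≤ (H X) (≤-trans (Σ-mono (4 ℕ.* X ℕ.+ 5) λ i _ → rcp-anti (ℕ.m≤m+n X i)) (≤-reflexive (Σ-const (4 ℕ.* X ℕ.+ 5) (rcp X)))) ⟩
  H X + ι (4 ℕ.* X ℕ.+ 5) * rcp X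
    ≤⟨ +-monoʳ-≤ (H X) (mulʳ (rcp X) (0≤rcp X) (ι-mono nine)) ⟩
  H X + ι (9 ℕ.* X) * rcp X
    ≡⟨ cong (H X +_) (trans (cong (_* rcp X) (ι-* 9 X)) (trans (*-assoc (ι 9) (ι X) (rcp X)) (trans (cong (ι 9 *_) (ι*rcp X)) (*-identityʳ (ι 9))))) ⟩
  H X + ι 9 ∎
  where
  open ≤-Reasoning
  X = K ℕ./ 5
  1≤X : 1 ℕ.≤ X
  1≤X = ℕ./-monoˡ-≤ 5 5≤K
  instance
    X≢0 : ℕ.NonZero X
    X≢0 = ℕ.>-nonZero 1≤X
  nine : 4 ℕ.* X ℕ.+ 5 ℕ.≤ 9 ℕ.* X
  nine = ℕ.≤-trans (ℕ.+-monoʳ-≤ (4 ℕ.* X) (ℕ.*-monoʳ-≤ 5 1≤X)) (ℕ.≤-reflexive (sym (ℕ.*-distribʳ-+ X 4 5)))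
  e : ∀ X → 5 ℕ.+ X ℕ.* 5 ≡ X ℕ.+ (4 ℕ.* X ℕ.+ 5)
  e = solve-∀
  K≤ : K ℕ.≤ X ℕ.+ (4 ℕ.* X ℕ.+ 5)
  K≤ = ℕ.≤-trans (ℕ.≤-reflexive (ℕ.m≡m%n+[m/n]*n K 5)) (ℕ.≤-trans (ℕ.+-monoˡ-≤ (X ℕ.* 5) (ℕ.m%n≤n K 5)) (ℕ.≤-reflexive (e X)))

opaque
  unfolding rcp
  H6≤3 : H 6 ≤ ι 3
  H6≤3 = from-yes (H 6 ≤? ι 3)

-- Comparison with the Riemann sum of mesh 1, which is 1/2 + ... + 1/(k + 1), costs at most 1.
logSum≤H : ∀ k m → logSum k m ≤ H (suc k) + 1ℚ
logSum≤H k m = begin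
  logSum k m            ≤⟨ logSum-close k m 0 ⟩
  logSum k 0 + 1ℚ       ≤⟨ +-monoˡ-≤ 1ℚ tail ⟩
  H (suc k) + 1ℚ ∎
  where
  open ≤-Reasoning
  tail : logSum k 0 ≤ H (suc k)
  tail = begin
    Σ[i< k ℕ.* 1 ] (λ i → inv (suc i))  ≡⟨ cong (λ n → Σ[i< n ] (λ i → inv (suc i))) (ℕ.*-identityʳ k) ⟩
    Σ[i< k ] (λ i → inv (suc i))        ≤⟨ Σ-mono k (λ i _ → ≤-trans (inv-anti (ℕ.n≤1+n i)) (≤-reflexive (sym (rcp-inv i)))) ⟩
    Σ[i< k ] (λ i → rcp (suc i))        ≡⟨ sym (trans (Σ-first k rcp) (trans (cong (_+ Σ[i< k ] (λ i → rcp (suc i))) rcp-zero) (+-identityˡ (Σ[i< k ] (λ i → rcp (suc i)))))) ⟩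
    H (suc k) ∎

0≤logSum : ∀ k m → 0ℚ ≤ logSum k m
0≤logSum k m = Σ-≥0 (k ℕ.* suc m) λ i _ → 0≤inv (suc m ℕ.+ i)

-- Reciprocals over the multiples of a modulus

multipleRcp : ℕ → ℕ → ℚ
multipleRcp d n = 𝟙 (d ℕ.∣? n) * rcp n

0≤multipleRcp : ∀ d n → 0ℚ ≤ multipleRcp d n
0≤multipleRcp d n = 0≤* (0≤𝟙 (d ℕ.∣? n)) (0≤rcp n)

Σ-multipleRcp : ∀ d X → .{{ℕ.NonZero d}} → Σ[i< X ℕ.* d ] (multipleRcp d) ≡ rcp d * H X
Σ-multipleRcp d X = trans
  (Σ-multiples X d (multipleRcp d) λ n ∤n → trans (cong (_* rcp n) (𝟙-no (d ℕ.∣? n) ∤n)) (*-zeroˡ (rcp n)))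
  (trans (Σ-cong X λ a _ → trans (cong₂ _*_ (𝟙-yes (d ℕ.∣? (a ℕ.* d)) (ℕ.n∣m*n a)) (rcp-* a d))
      (trans (*-identityˡ (rcp a * rcp d)) (*-comm (rcp a) (rcp d))))
    (Σ-*ˡ X (rcp d) rcp))

-- Predecessors occur because γ enters the density factor as γ/(n - 1).
multiplePred : ℕ → ℕ → ℚ
multiplePred l n = 𝟙 (l ℕ.∣? n) * rcp (ℕ.pred n)

0≤multiplePred : ∀ l n → 0ℚ ≤ multiplePred l n
0≤multiplePred l n = 0≤* (0≤𝟙 (l ℕ.∣? n)) (0≤rcp (ℕ.pred n))

-- For a ≥ 2, 1/(al - 1) ≤ 1/((a - 1)l), and these sum to `rcp l * H X`. The first multiple uses
-- 1/(l - 1) ≤ 2/l, and the multiple 0 contributes `rcp 0`, which is 0.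
Σ-multiplePred : ∀ l X → 2 ℕ.≤ l → Σ[i< suc X ℕ.* l ] (multiplePred l) ≤ rcp l * (ι 2 + H X)
Σ-multiplePred l@(suc (suc l′)) X (s≤s (s≤s _)) = begin
  Σ[i< suc X ℕ.* l ] (multiplePred l)
    ≡⟨ Σ-multiples (suc X) l (multiplePred l) (λ n ∤n → trans (cong (_* rcp (ℕ.pred n)) (𝟙-no (l ℕ.∣? n) ∤n)) (*-zeroˡ (rcp (ℕ.pred n)))) ⟩
  Σ[i< suc X ] (λ a → multiplePred l (a ℕ.* l))
    ≤⟨ Σ-mono (suc X) (λ a _ → ≤-trans (mulʳ (rcp (ℕ.pred (a ℕ.* l))) (0≤rcp _) (𝟙≤1 (l ℕ.∣? (a ℕ.* l)))) (≤-reflexive (*-identityˡ (rcp (ℕ.pred (a ℕ.* l)))))) ⟩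
  Σ[i< suc X ] (λ a → rcp (ℕ.pred (a ℕ.* l)))
    ≡⟨ trans (Σ-first X (λ a → rcp (ℕ.pred (a ℕ.* l)))) (trans (cong (_+ Q X) rcp-zero) (+-identityˡ (Q X))) ⟩
  Q X
    ≤⟨ bound X ⟩
  rcp l * (ι 2 + H X) ∎
  where
  open ≤-Reasoning
  Q : ℕ → ℚ
  Q X = Σ[i< X ] (λ a → rcp (ℕ.pred (suc a ℕ.* l)))
  one : rcp (ℕ.pred l) ≤ rcp l * ι 2
  one = subst₂ _≤_ refl (*-comm (ι 2) (rcp l)) (*-cancelʳ-ι (suc l′)
    (≤-trans (≤-reflexive (trans (*-comm (rcp (suc l′)) (ι (suc l′))) (ι*rcp (suc l′))))
      (subst (1ℚ ≤_) (trans (cong (rcp l *_) (ι-* 2 (suc l′))) (solve 3 (λ r a b → r :* (a :* b) := a :* r :* b) refl (rcp l) (ι 2) (ι (suc l′))))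
        (subst (_≤ rcp l * ι (2 ℕ.* suc l′)) (trans (*-comm (rcp l) (ι l)) (ι*rcp l))
          (mulˡ (rcp l) (0≤rcp l) (ι-mono (≤-slack l′ (e l′))))))))
    where
    e : ∀ l → suc (suc l) ℕ.+ l ≡ 2 ℕ.* suc l
    e = solve-∀
  bound : ∀ X → Q X ≤ rcp l * (ι 2 + H X)
  bound zero = 0≤* (0≤rcp l) (0≤+ (0≤ι 2) ≤-refl)
  bound (suc zero) = ≤-trans (≤-reflexive (trans (+-identityˡ _) (cong (λ n → rcp (ℕ.pred n)) (ℕ.+-identityʳ l))))
    (≤-trans one (mulˡ (rcp l) (0≤rcp l) (subst (_≤ ι 2 + H 1) (+-identityʳ (ι 2)) (+-monoʳ-≤ (ι 2) (0≤H 1)))))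
  bound (suc (suc X)) = begin
    Q (suc X) + rcp (ℕ.pred (suc (suc X) ℕ.* l))
      ≤⟨ +-mono-≤ (bound (suc X)) (rcp-anti (ℕ.m≤n+m (suc X ℕ.* l) (suc l′))) ⟩
    rcp l * (ι 2 + H (suc X)) + rcp (suc X ℕ.* l)
      ≡⟨ cong (rcp l * (ι 2 + H (suc X)) +_) (rcp-* (suc X) l) ⟩
    rcp l * (ι 2 + H (suc X)) + rcp (suc X) * rcp l
      ≡⟨ solve 4 (λ r t h s → r :* (t :+ h) :+ s :* r := r :* (t :+ (h :+ s))) refl (rcp l) (ι 2) (H (suc X)) (rcp (suc X)) ⟩
    rcp l * (ι 2 + H (suc (suc X))) ∎

-- The total relative gain

-- Lower bound for the density of the residues mod n covered by the classes whose
-- moduli divide n and lie in (N, N + k].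
gain : ℕ → ℕ → ℕ → ℚ
gain N k n = Σ[i< k ] (λ i → 𝟙 (suc (N ℕ.+ i) ℕ.∣? n) * rcp (suc (N ℕ.+ i)))
  - Σ[i< k ] (λ i → Σ[i< i ] (λ j → 𝟙 (ℕ.lcm (suc (N ℕ.+ i)) (suc (N ℕ.+ j)) ℕ.∣? n) * rcp (ℕ.lcm (suc (N ℕ.+ i)) (suc (N ℕ.+ j)))))

-- This is γ/(n - 1) for n = N + 1 + t. The indicator keeps the n beyond the initial interval, by
-- which time all classes of that interval are chosen.
relativeGain : ℕ → ℕ → ℕ → ℚ
relativeGain N k t = 𝟙 (k ℕ.≤? t) * (gain N k (suc (N ℕ.+ t)) * rcp (N ℕ.+ t))

lcm-lower : ∀ d e → .{{ℕ.NonZero d}} → .{{ℕ.NonZero e}} → d ℕ.≤ ℕ.lcm d e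
lcm-lower d e = ℕ.∣⇒≤ {{ℕ.≢-nonZero λ l≡0 → ℕ.≢-nonZero⁻¹ (d ℕ.* e) {{ℕ.m*n≢0 d e}}
  (trans (sym (ℕ.gcd*lcm d e)) (trans (cong (ℕ.gcd d e ℕ.*_) l≡0) (ℕ.*-zeroʳ (ℕ.gcd d e))))}} (ℕ.m∣lcm[m,n] d e)

module _ (N k κ₀ : ℕ) .{{_ : ℕ.NonZero N}} (4≤k : 4 ℕ.≤ k) (κ₀≤ : κ₀ ℕ.≤ 4 ℕ.* N) where

  private
    -- With K = k + 1, the moduli in (N, KN] are N + 1 + t for t < T.
    T = k ℕ.* N
    d : ℕ → ℕ
    d i = suc (N ℕ.+ i)
    l : ℕ → ℕ → ℕ
    l i j = ℕ.lcm (d i) (d j)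
    a : ℕ → ℚ
    a t = 𝟙 (κ₀ ℕ.≤? t) * rcp (N ℕ.+ t)
    -- The sum of 1/(n - 1) over the multiples n of `m` past the initial interval. It is the
    -- coefficient of `rcp m` once the sums over n and over moduli are exchanged.
    U : ℕ → ℚ
    U m = Σ[i< T ] (λ t → a t * 𝟙 (m ℕ.∣? suc (N ℕ.+ t)))
    N+t≢0 : ∀ t → ℕ.NonZero (N ℕ.+ t)
    N+t≢0 t = ℕ.>-nonZero (ℕ.≤-trans (ℕ.>-nonZero⁻¹ N) (ℕ.m≤m+n N t))

  Σ-relativeGain : Σ[i< T ] (relativeGain N κ₀) ≡
    Σ[i< κ₀ ] (λ i → rcp (d i) * U (d i)) - Σ[i< κ₀ ] (λ i → Σ[i< i ] (λ j → rcp (l i j) * U (l i j)))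
  Σ-relativeGain = begin
    Σ[i< T ] (relativeGain N κ₀)
      ≡⟨ Σ-cong T (λ t _ → solve 4 (λ x p q r → x :* ((p :- q) :* r) := x :* r :* p :- x :* r :* q) refl
           (𝟙 (κ₀ ℕ.≤? t)) (P t) (Q t) (rcp (N ℕ.+ t))) ⟩
    Σ[i< T ] (λ t → a t * P t - a t * Q t)
      ≡⟨ Σ-- T (λ t → a t * P t) (λ t → a t * Q t) ⟩
    Σ[i< T ] (λ t → a t * P t) - Σ[i< T ] (λ t → a t * Q t)
      ≡⟨ cong₂ _-_
           (trans (expand κ₀ d) (Σ-cong κ₀ λ i _ → term (d i)))
           (trans (Σ-cong T λ t _ → sym (Σ-*ˡ κ₀ (a t) (λ i → Σ[i< i ] (λ j → h (l i j) t))))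
             (trans (Σ-swap T κ₀ (λ t i → a t * Σ[i< i ] (λ j → h (l i j) t)))
               (Σ-cong κ₀ λ i _ → trans (expand i (l i)) (Σ-cong i λ j _ → term (l i j))))) ⟩
    Σ[i< κ₀ ] (λ i → rcp (d i) * U (d i)) - Σ[i< κ₀ ] (λ i → Σ[i< i ] (λ j → rcp (l i j) * U (l i j))) ∎
    where
    open ≡-Reasoning
    h : ℕ → ℕ → ℚ
    h m t = 𝟙 (m ℕ.∣? suc (N ℕ.+ t)) * rcp m
    P Q : ℕ → ℚ
    P t = Σ[i< κ₀ ] (λ i → h (d i) t)
    Q t = Σ[i< κ₀ ] (λ i → Σ[i< i ] (λ j → h (l i j) t))
    expand : ∀ n (f : ℕ → ℕ) → Σ[i< T ] (λ t → a t * Σ[i< n ] (λ i → h (f i) t)) ≡ Σ[i< n ] (λ i → Σ[i< T ] (λ t → a t * h (f i) t))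
    expand n f = trans (Σ-cong T λ t _ → sym (Σ-*ˡ n (a t) (λ i → h (f i) t))) (Σ-swap T n (λ t i → a t * h (f i) t))
    term : ∀ m → Σ[i< T ] (λ t → a t * h m t) ≡ rcp m * U m
    term m = trans (Σ-cong T λ t _ → sym (*-assoc (a t) (𝟙 (m ℕ.∣? suc (N ℕ.+ t))) (rcp m)))
      (trans (Σ-*ʳ T (rcp m) (λ t → a t * 𝟙 (m ℕ.∣? suc (N ℕ.+ t)))) (*-comm (U m) (rcp m)))

  multiples-upper : ∀ m → suc N ℕ.≤ m → U m ≤ rcp m * (ι 2 + H (suc k))
  multiples-upper m N<m = begin
    U m
      ≤⟨ Σ-mono T (λ t _ → ≤-trans (mulʳ (𝟙 (m ℕ.∣? suc (N ℕ.+ t))) (0≤𝟙 (m ℕ.∣? suc (N ℕ.+ t))) (mulʳ (rcp (N ℕ.+ t)) (0≤rcp (N ℕ.+ t)) (𝟙≤1 (κ₀ ℕ.≤? t))))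
           (≤-reflexive (trans (cong (_* 𝟙 (m ℕ.∣? suc (N ℕ.+ t))) (*-identityˡ (rcp (N ℕ.+ t)))) (*-comm (rcp (N ℕ.+ t)) (𝟙 (m ℕ.∣? suc (N ℕ.+ t))))))) ⟩
    Σ[i< T ] (λ t → f (suc N ℕ.+ t))
      ≤⟨ subst (_≤ Σ[i< suc N ] f + Σ[i< T ] (λ t → f (suc N ℕ.+ t))) (+-identityˡ (Σ[i< T ] (λ t → f (suc N ℕ.+ t))))
           (+-monoˡ-≤ (Σ[i< T ] (λ t → f (suc N ℕ.+ t))) (Σ-≥0 (suc N) λ n _ → 0≤multiplePred m n)) ⟩
    Σ[i< suc N ] f + Σ[i< T ] (λ t → f (suc N ℕ.+ t))
      ≡⟨ sym (Σ-split (suc N) T f) ⟩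
    Σ[i< suc N ℕ.+ T ] f
      ≤⟨ Σ-extend f (ℕ.+-mono-≤ N<m (ℕ.*-monoʳ-≤ k (ℕ.<⇒≤ N<m) )) (0≤multiplePred m) ⟩
    Σ[i< m ℕ.+ k ℕ.* m ] f
      ≤⟨ Σ-extend f (ℕ.m≤n+m (suc k ℕ.* m) m) (0≤multiplePred m) ⟩
    Σ[i< suc (suc k) ℕ.* m ] f
      ≤⟨ Σ-multiplePred m (suc k) (ℕ.≤-trans (s≤s (ℕ.>-nonZero⁻¹ N)) N<m) ⟩
    rcp m * (ι 2 + H (suc k)) ∎
    where
    open ≤-Reasoning
    f = multiplePred m

  -- As m ≤ 5N, the multiples `a * m` with a < K/5 stay below KN, and their reciprocals sum to
  -- `rcp m * H X`. Those not past the initial interval are below 6m and account for at most 3/m.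
  multiples-lower : ∀ i → i ℕ.< κ₀ → rcp (d i) * (H (suc k ℕ./ 5) - ι 3) ≤ U (d i)
  multiples-lower i i<κ₀ = begin
    rcp m * (H X - ι 3)
      ≡⟨ solve 3 (λ r h c → r :* (h :- c) := r :* h :- r :* c) refl (rcp m) (H X) (ι 3) ⟩
    rcp m * H X - rcp m * ι 3
      ≤⟨ +-mono-≤ total (neg-antimono-≤ initial) ⟩
    Σ[i< suc N ℕ.+ κ₀ ℕ.+ T′ ] f - Σ[i< suc N ℕ.+ κ₀ ] f
      ≡⟨ trans (cong (_- Σ[i< suc N ℕ.+ κ₀ ] f) (Σ-split (suc N ℕ.+ κ₀) T′ f))
           (solve 2 (λ a b → a :+ b :- a := b) refl (Σ[i< suc N ℕ.+ κ₀ ] f) (Σ[i< T′ ] (λ t → f (suc N ℕ.+ κ₀ ℕ.+ t)))) ⟩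
    Σ[i< T′ ] (λ t → f (suc N ℕ.+ κ₀ ℕ.+ t))
      ≤⟨ Σ-mono T′ (λ t _ → final t) ⟩
    Σ[i< T′ ] (λ t → b (κ₀ ℕ.+ t))
      ≤⟨ subst (_≤ Σ[i< κ₀ ] b + Σ[i< T′ ] (λ t → b (κ₀ ℕ.+ t))) (+-identityˡ (Σ[i< T′ ] (λ t → b (κ₀ ℕ.+ t))))
           (+-monoˡ-≤ (Σ[i< T′ ] (λ t → b (κ₀ ℕ.+ t))) (Σ-≥0 κ₀ λ t _ → 0≤* (0≤* (0≤𝟙 (κ₀ ℕ.≤? t)) (0≤rcp (N ℕ.+ t))) (0≤𝟙 (m ℕ.∣? suc (N ℕ.+ t))))) ⟩
    Σ[i< κ₀ ] b + Σ[i< T′ ] (λ t → b (κ₀ ℕ.+ t))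
      ≡⟨ trans (sym (Σ-split κ₀ T′ b)) (cong (λ n → Σ[i< n ] b) T≡) ⟩
    U m ∎
    where
    open ≤-Reasoning
    m = d i
    X = suc k ℕ./ 5
    f = multipleRcp m
    b : ℕ → ℚ
    b t = a t * 𝟙 (m ℕ.∣? suc (N ℕ.+ t))
    T′ = T ℕ.∸ κ₀
    T≡ : κ₀ ℕ.+ T′ ≡ T
    T≡ = ℕ.m+[n∸m]≡n (ℕ.≤-trans κ₀≤ (ℕ.*-monoˡ-≤ N 4≤k))
    m≤5N : m ℕ.≤ 5 ℕ.* N
    m≤5N = ℕ.≤-trans (ℕ.≤-reflexive (sym (ℕ.+-suc N i))) (ℕ.+-monoʳ-≤ N (ℕ.≤-trans i<κ₀ κ₀≤))
    total : rcp m * H X ≤ Σ[i< suc N ℕ.+ κ₀ ℕ.+ T′ ] f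
    total = ≤-trans (≤-reflexive (sym (Σ-multipleRcp m X))) (Σ-extend f (ℕ.≤-trans Xm≤ (ℕ.≤-trans (ℕ.n≤1+n (suc k ℕ.* N))
      (ℕ.≤-reflexive (cong suc (sym (trans (ℕ.+-assoc N κ₀ T′) (cong (N ℕ.+_) T≡))))))) (0≤multipleRcp m))
      where
      Xm≤ : X ℕ.* m ℕ.≤ suc k ℕ.* N
      Xm≤ = ℕ.≤-trans (ℕ.*-monoʳ-≤ X m≤5N) (ℕ.≤-trans (ℕ.≤-reflexive (sym (ℕ.*-assoc X 5 N))) (ℕ.*-monoˡ-≤ N (ℕ.m/n*n≤m (suc k) 5)))
    initial : Σ[i< suc N ℕ.+ κ₀ ] f ≤ rcp m * ι 3
    initial = ≤-trans (Σ-extend f le (0≤multipleRcp m)) (≤-trans (≤-reflexive (Σ-multipleRcp m 6)) (mulˡ (rcp m) (0≤rcp m) H6≤3))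
      where
      le : suc N ℕ.+ κ₀ ℕ.≤ 6 ℕ.* m
      le = ℕ.+-mono-≤ {suc N} {m} (s≤s (ℕ.m≤m+n N i)) (ℕ.≤-trans κ₀≤ (ℕ.*-mono-≤ {4} {5} (ℕ.n≤1+n 4) (ℕ.≤-trans (ℕ.m≤m+n N i) (ℕ.n≤1+n (N ℕ.+ i)))))
    final : ∀ t → f (suc N ℕ.+ κ₀ ℕ.+ t) ≤ b (κ₀ ℕ.+ t)
    final t = subst (λ n → multipleRcp m (suc n) ≤ b (κ₀ ℕ.+ t)) (sym (ℕ.+-assoc N κ₀ t)) (begin
      𝟙 (m ℕ.∣? suc s) * rcp (suc s)
        ≤⟨ mulˡ (𝟙 (m ℕ.∣? suc s)) (0≤𝟙 (m ℕ.∣? suc s)) (rcp-anti {{N+t≢0 (κ₀ ℕ.+ t)}} (ℕ.n≤1+n s)) ⟩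
      𝟙 (m ℕ.∣? suc s) * rcp s
        ≡⟨ trans (*-comm (𝟙 (m ℕ.∣? suc s)) (rcp s)) (cong (_* 𝟙 (m ℕ.∣? suc s)) (sym (trans (cong (_* rcp s) (𝟙-yes (κ₀ ℕ.≤? κ₀ ℕ.+ t) (ℕ.m≤m+n κ₀ t))) (*-identityˡ (rcp s))))) ⟩
      a (κ₀ ℕ.+ t) * 𝟙 (m ℕ.∣? suc s) ∎)
      where s = N ℕ.+ (κ₀ ℕ.+ t)

  Σ-relativeGain-lower : recipSq N κ₀ * (H (suc k ℕ./ 5) - ι 3) - lcmSq N κ₀ * (ι 2 + H (suc k)) ≤ Σ[i< T ] (relativeGain N κ₀)
  Σ-relativeGain-lower = begin
    recipSq N κ₀ * p - lcmSq N κ₀ * q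
      ≡⟨ cong₂ _-_ (sym (Σ-*ʳ κ₀ p (λ i → sq (d i))))
           (trans (sym (Σ-*ʳ κ₀ q (λ i → Σ[i< i ] (λ j → sq (l i j))))) (Σ-cong κ₀ λ i _ → sym (Σ-*ʳ i q (λ j → sq (l i j))))) ⟩
    Σ[i< κ₀ ] (λ i → sq (d i) * p) - Σ[i< κ₀ ] (λ i → Σ[i< i ] (λ j → sq (l i j) * q))
      ≤⟨ +-mono-≤ (Σ-mono κ₀ λ i i<κ₀ → ≤-trans (≤-reflexive (*-assoc (rcp (d i)) (rcp (d i)) p)) (mulˡ (rcp (d i)) (0≤rcp (d i)) (multiples-lower i i<κ₀)))
           (neg-antimono-≤ (Σ-mono κ₀ λ i _ → Σ-mono i λ j _ → ≤-trans
             (mulˡ (rcp (l i j)) (0≤rcp (l i j)) (multiples-upper (l i j) (ℕ.≤-trans (s≤s (ℕ.m≤m+n N i)) (lcm-lower (d i) (d j)))))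
             (≤-reflexive (sym (*-assoc (rcp (l i j)) (rcp (l i j)) q))))) ⟩
    Σ[i< κ₀ ] (λ i → rcp (d i) * U (d i)) - Σ[i< κ₀ ] (λ i → Σ[i< i ] (λ j → rcp (l i j) * U (l i j)))
      ≡⟨ sym Σ-relativeGain ⟩
    Σ[i< T ] (relativeGain N κ₀) ∎
    where
    open ≤-Reasoning
    p = H (suc k ℕ./ 5) - ι 3
    q = ι 2 + H (suc k)

/-rcp : ∀ n → .{{_ : ℕ.NonZero n}} → ℤ.+ 1 / n ≡ rcp n
/-rcp (suc n) = sym (rcp-inv n)

recipSq≤ : ∀ N k → .{{ℕ.NonZero N}} → k ℕ.≤ 4 ℕ.* N → ι N * recipSq N k ≤ ι 4
recipSq≤ N k k≤ = begin
  ι N * recipSq N k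
    ≤⟨ mulˡ (ι N) (0≤ι N) (≤-trans (Σ-mono k λ i _ → mul (0≤rcp N) (0≤rcp (suc (N ℕ.+ i))) (le i) (le i)) (≤-reflexive (Σ-const k (sq N)))) ⟩
  ι N * (ι k * sq N)
    ≤⟨ mulˡ (ι N) (0≤ι N) (mulʳ (sq N) (0≤sq-rcp N) (≤-trans (ι-mono k≤) (≤-reflexive (ι-* 4 N)))) ⟩
  ι N * (ι 4 * ι N * (rcp N * rcp N))
    ≡⟨ solve 3 (λ n c r → n :* (c :* n :* (r :* r)) := n :* r :* (n :* r :* c)) refl (ι N) (ι 4) (rcp N) ⟩
  ι N * rcp N * (ι N * rcp N * ι 4)
    ≡⟨ cong (λ x → x * (x * ι 4)) (ι*rcp N) ⟩
  1ℚ * (1ℚ * ι 4)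
    ≡⟨ trans (*-identityˡ (1ℚ * ι 4)) (*-identityˡ (ι 4)) ⟩
  ι 4 ∎
  where
  open ≤-Reasoning
  le : ∀ i → rcp (suc (N ℕ.+ i)) ≤ rcp N
  le i = rcp-anti (ℕ.≤-trans (ℕ.m≤m+n N i) (ℕ.n≤1+n (N ℕ.+ i)))

recipSq≥0 : ∀ N k → 0ℚ ≤ recipSq N k
recipSq≥0 N k = Σ-≥0 k λ i _ → 0≤sq-rcp (suc (N ℕ.+ i))

-- Multiply by N and write h for `H (suc k)`. Since NA ≤ 4, and NO ≤ NA because the surplus is
-- positive, the lower bound is at least c₀h - 12 · 4 - 2 · 4, where 12 is 3 plus the 9 of
-- `H-fifth`. The margin h/500 ≥ 58 exceeds 56 + 1/3.
Σ-relativeGain≥log : ∀ N k κ₀ → .{{_ : ℕ.NonZero N}} → 4 ℕ.≤ k → κ₀ ℕ.≤ 4 ℕ.* N →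
  c₀ ≤ ι N * (recipSq N κ₀ - lcmSq N κ₀) → ι 29000 ≤ H (suc k) →
  rcp (3 ℕ.* N) * (H (suc k) + 1ℚ) ≤ Σ[i< k ℕ.* N ] (relativeGain N κ₀)
Σ-relativeGain≥log N k κ₀ 4≤k κ₀≤ sur big = ≤-trans
  (*-cancelʳ-ι N (subst₂ _≤_ (*-comm (ι N) (rcp (3 ℕ.* N) * (h + 1ℚ))) (*-comm (ι N) (A * (h - ι 12) - O * (ι 2 + h))) scaled))
  (≤-trans (+-monoˡ-≤ (- (O * (ι 2 + h))) (mulˡ A (recipSq≥0 N κ₀) hX)) (Σ-relativeGain-lower N k κ₀ 4≤k κ₀≤))
  where
  open ≤-Reasoning
  h = H (suc k)
  A = recipSq N κ₀
  O = lcmSq N κ₀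
  hX : h - ι 12 ≤ H (suc k ℕ./ 5) - ι 3
  hX = begin
    h - ι 12                            ≤⟨ +-monoˡ-≤ (- ι 12) (H-fifth (suc k) (s≤s 4≤k)) ⟩
    H (suc k ℕ./ 5) + ι 9 - ι 12        ≡⟨ +-assoc (H (suc k ℕ./ 5)) (ι 9) (- ι 12) ⟩
    H (suc k ℕ./ 5) + (ι 9 - ι 12)      ≡⟨⟩
    H (suc k ℕ./ 5) - ι 3 ∎
  NO≤ : ι N * O ≤ ι 4
  NO≤ = begin
    ι N * O                     ≡⟨ solve 3 (λ n a o → n :* o := n :* a :- n :* (a :- o)) refl (ι N) A O ⟩
    ι N * A - ι N * (A - O)     ≤⟨ +-monoʳ-≤ (ι N * A) (neg-antimono-≤ (≤-trans (from-yes (0ℚ ≤? c₀)) sur)) ⟩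
    ι N * A - 0ℚ                ≡⟨ +-identityʳ (ι N * A) ⟩
    ι N * A                     ≤⟨ recipSq≤ N κ₀ κ₀≤ ⟩
    ι 4 ∎
  third : ι N * (rcp (3 ℕ.* N) * (h + 1ℚ)) ≡ rcp 3 * (h + 1ℚ)
  third = begin-equality
    ι N * (rcp (3 ℕ.* N) * (h + 1ℚ))      ≡⟨ cong (λ r → ι N * (r * (h + 1ℚ))) (rcp-* 3 N) ⟩
    ι N * (rcp 3 * rcp N * (h + 1ℚ))      ≡⟨ solve 4 (λ n t r y → n :* (t :* r :* y) := n :* r :* (t :* y)) refl (ι N) (rcp 3) (rcp N) (h + 1ℚ) ⟩
    ι N * rcp N * (rcp 3 * (h + 1ℚ))      ≡⟨ trans (cong (_* (rcp 3 * (h + 1ℚ))) (ι*rcp N)) (*-identityˡ (rcp 3 * (h + 1ℚ))) ⟩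
    rcp 3 * (h + 1ℚ) ∎
  scaled : ι N * (rcp (3 ℕ.* N) * (h + 1ℚ)) ≤ ι N * (A * (h - ι 12) - O * (ι 2 + h))
  scaled = begin
    ι N * (rcp (3 ℕ.* N) * (h + 1ℚ))                      ≡⟨ third ⟩
    rcp 3 * (h + 1ℚ)                                      ≡⟨ cong (_* (h + 1ℚ)) (rcp-inv 2) ⟩
    ℤ.+ 1 / 3 * (h + 1ℚ)                                  ≤⟨ last ⟩
    c₀ * h - (ι 12 * ι 4 + ι 2 * ι 4)
      ≤⟨ +-mono-≤ (mulʳ h (0≤H (suc k)) sur) (neg-antimono-≤ (+-mono-≤ (mulˡ (ι 12) (0≤ι 12) (recipSq≤ N κ₀ κ₀≤)) (mulˡ (ι 2) (0≤ι 2) NO≤))) ⟩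
    ι N * (A - O) * h - (ι 12 * (ι N * A) + ι 2 * (ι N * O))
      ≡⟨ solve 6 (λ n a o h c d → n :* (a :- o) :* h :- (c :* (n :* a) :+ d :* (n :* o)) := n :* (a :* (h :- c) :- o :* (d :+ h))) refl
           (ι N) A O h (ι 12) (ι 2) ⟩
    ι N * (A * (h - ι 12) - O * (ι 2 + h)) ∎
    where
    last : ℤ.+ 1 / 3 * (h + 1ℚ) ≤ c₀ * h - ι 56
    last = begin
      ℤ.+ 1 / 3 * (h + 1ℚ)                                      ≡⟨ *-distribˡ-+ (ℤ.+ 1 / 3) h 1ℚ ⟩
      ℤ.+ 1 / 3 * h + ℤ.+ 1 / 3 * 1ℚ
        ≤⟨ +-monoʳ-≤ (ℤ.+ 1 / 3 * h) (≤-trans (from-yes (ℤ.+ 1 / 3 * 1ℚ ≤? ℤ.+ 1 / 500 * ι 29000 - ι 56))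
             (+-monoˡ-≤ (- ι 56) (mulˡ (ℤ.+ 1 / 500) (<⇒≤ (positive⁻¹ (ℤ.+ 1 / 500))) big))) ⟩
      ℤ.+ 1 / 3 * h + (ℤ.+ 1 / 500 * h - ι 56)
        ≡⟨ solve 4 (λ a b h c → a :* h :+ (b :* h :- c) := (a :+ b) :* h :- c) refl (ℤ.+ 1 / 3) (ℤ.+ 1 / 500) h (ι 56) ⟩
      c₀ * h - ι 56 ∎

-- Residues and Bonferroni's inequality

%≡⇒∣-+ : ∀ d r o → .{{_ : ℕ.NonZero d}} → (r ℕ.+ o) ℕ.% d ≡ r ℕ.% d → d ℕ.∣ o
%≡⇒∣-+ d r o e = ℕ.∣m+n∣m⇒∣n {d} {r ℕ./ d ℕ.* d} (ℕ.divides ((r ℕ.+ o) ℕ./ d) (ℕ.+-cancelˡ-≡ (r ℕ.% d) _ _ (begin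
  r ℕ.% d ℕ.+ (r ℕ./ d ℕ.* d ℕ.+ o)                     ≡⟨ sym (ℕ.+-assoc (r ℕ.% d) (r ℕ./ d ℕ.* d) o) ⟩
  r ℕ.% d ℕ.+ r ℕ./ d ℕ.* d ℕ.+ o                       ≡⟨ cong (ℕ._+ o) (sym (ℕ.m≡m%n+[m/n]*n r d)) ⟩
  r ℕ.+ o                                               ≡⟨ ℕ.m≡m%n+[m/n]*n (r ℕ.+ o) d ⟩
  (r ℕ.+ o) ℕ.% d ℕ.+ (r ℕ.+ o) ℕ./ d ℕ.* d             ≡⟨ cong (ℕ._+ (r ℕ.+ o) ℕ./ d ℕ.* d) e ⟩
  r ℕ.% d ℕ.+ (r ℕ.+ o) ℕ./ d ℕ.* d ∎))) (ℕ.n∣m*n (r ℕ./ d))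
  where open ≡-Reasoning

%≡⇒∣ : ∀ d r s → .{{_ : ℕ.NonZero d}} → r ℕ.% d ≡ s ℕ.% d → d ℕ.∣ ℕ.∣ r - s ∣
%≡⇒∣ d r s e with ℕ.≤-total r s
... | inj₁ r≤s with ℕ.m≤n⇒∃[o]m+o≡n r≤s
...   | o , refl = subst (d ℕ.∣_) (sym (ℕ.∣m-m+n∣≡n r o)) (%≡⇒∣-+ d r o (sym e))
%≡⇒∣ d r s e | inj₂ s≤r with ℕ.m≤n⇒∃[o]m+o≡n s≤r
...   | o , refl = subst (d ℕ.∣_) (sym (trans (ℕ.∣-∣-comm (s ℕ.+ o) s) (ℕ.∣m-m+n∣≡n s o))) (%≡⇒∣-+ d s o e)

∣⇒%≡ : ∀ d r s → .{{_ : ℕ.NonZero d}} → d ℕ.∣ ℕ.∣ r - s ∣ → r ℕ.% d ≡ s ℕ.% d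
∣⇒%≡ d r s h with ℕ.≤-total r s
... | inj₁ r≤s with ℕ.m≤n⇒∃[o]m+o≡n r≤s
...   | o , refl = sym (ℕ.%-remove-+ʳ r (subst (d ℕ.∣_) (ℕ.∣m-m+n∣≡n r o) h))
∣⇒%≡ d r s h | inj₂ s≤r with ℕ.m≤n⇒∃[o]m+o≡n s≤r
...   | o , refl = ℕ.%-remove-+ʳ s (subst (d ℕ.∣_) (trans (ℕ.∣-∣-comm (s ℕ.+ o) s) (ℕ.∣m-m+n∣≡n s o)) h)

∣+m-+n∣ : ∀ m n → ℤ.∣ ℤ.+ m ℤ.- ℤ.+ n ∣ ≡ ℕ.∣ m - n ∣
∣+m-+n∣ m n with ℕ.≤-total m n
... | inj₁ m≤n = trans (cong ℤ.∣_∣ (ℤ.m-n≡m⊖n m n)) (trans (ℤ.∣⊖∣-≤ m≤n) (sym (ℕ.m≤n⇒∣m-n∣≡n∸m m≤n)))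
... | inj₂ n≤m = trans (cong ℤ.∣_∣ (ℤ.m-n≡m⊖n m n)) (trans (ℤ.∣m⊖n∣≡∣n⊖m∣ m n) (trans (ℤ.∣⊖∣-≤ n≤m) (sym (ℕ.m≤n⇒∣n-m∣≡n∸m n≤m))))

≡mod⇒%≡ : ∀ d m n → .{{_ : ℕ.NonZero d}} → ℤ.+ m ≡ ℤ.+ n [mod d ] → m ℕ.% d ≡ n ℕ.% d
≡mod⇒%≡ d m n h = ∣⇒%≡ d m n (subst (d ℕ.∣_) (∣+m-+n∣ m n) (ℤ.∣⇒∣ᵤ h))

%≡⇒≡mod : ∀ d m n → .{{_ : ℕ.NonZero d}} → m ℕ.% d ≡ n ℕ.% d → ℤ.+ m ≡ ℤ.+ n [mod d ]
%≡⇒≡mod d m n e = ℤ.∣ᵤ⇒∣ (subst (d ℕ.∣_) (sym (∣+m-+n∣ m n)) (%≡⇒∣ d m n e))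

weierstrass : ∀ k (u : ℕ → ℚ) → (∀ i → 0ℚ ≤ u i) → (∀ i → u i ≤ 1ℚ) → 1ℚ - Σ[i< k ] u ≤ Π[i< k ] (λ i → 1ℚ - u i)
weierstrass zero u _ _ = ≤-refl
weierstrass (suc k) u u≥0 u≤1 = begin
  1ℚ - (S + u k)
    ≤⟨ subst (_≤ 1ℚ - (S + u k) + S * u k) (+-identityʳ (1ℚ - (S + u k))) (+-monoʳ-≤ (1ℚ - (S + u k)) (0≤* (Σ-≥0 k λ i _ → u≥0 i) (u≥0 k))) ⟩
  1ℚ - (S + u k) + S * u k
    ≡⟨ solve 2 (λ s x → con 1ℚ :- (s :+ x) :+ s :* x := (con 1ℚ :- s) :* (con 1ℚ :- x)) refl S (u k) ⟩
  (1ℚ - S) * (1ℚ - u k)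
    ≤⟨ mulʳ (1ℚ - u k) (0≤-gap (u≤1 k)) (weierstrass k u u≥0 u≤1) ⟩
  Π[i< suc k ] (λ i → 1ℚ - u i) ∎
  where
  open ≤-Reasoning
  S = Σ[i< k ] u

-- Expanding the last factor subtracts `Π * u k`, and `weierstrass` bounds that product from below.
bonferroni : ∀ k (u : ℕ → ℚ) → (∀ i → 0ℚ ≤ u i) → (∀ i → u i ≤ 1ℚ) → Π[i< k ] (λ i → 1ℚ - u i) ≤ 1ℚ - Σ[i< k ] u + PS k u
bonferroni zero u _ _ = ≤-refl
bonferroni (suc k) u u≥0 u≤1 = begin
  Π * (1ℚ - u k)
    ≡⟨ solve 2 (λ p x → p :* (con 1ℚ :- x) := p :- p :* x) refl Π (u k) ⟩
  Π - Π * u k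
    ≤⟨ +-mono-≤ (bonferroni k u u≥0 u≤1) (neg-antimono-≤ (mulʳ (u k) (u≥0 k) (weierstrass k u u≥0 u≤1))) ⟩
  1ℚ - S + PS k u - (1ℚ - S) * u k
    ≡⟨ solve 3 (λ s p x → con 1ℚ :- s :+ p :- (con 1ℚ :- s) :* x := con 1ℚ :- (s :+ x) :+ (p :+ x :* s)) refl S (PS k u) (u k) ⟩
  1ℚ - Σ[i< suc k ] u + PS (suc k) u ∎
  where
  open ≤-Reasoning
  S = Σ[i< k ] u
  Π = Π[i< k ] (λ i → 1ℚ - u i)

Σ-residue : ∀ d X c → .{{_ : ℕ.NonZero d}} → c ℕ.< d → Σ[i< X ℕ.* d ] (λ r → 𝟙 (r ℕ.% d ℕ.≟ c)) ≡ ι X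
Σ-residue d X c c<d = trans (Σ-block X d (λ r → 𝟙 (r ℕ.% d ℕ.≟ c)))
  (trans (Σ-cong X λ a _ → trans (Σ-cong d λ i i<d → cong (λ n → 𝟙 (n ℕ.≟ c))
      (trans (cong (ℕ._% d) (ℕ.+-comm (a ℕ.* d) i)) (trans (ℕ.[m+kn]%n≡m%n i a d) (ℕ.m<n⇒m%n≡m i<d)))) (Σ-delta d c c<d))
    (trans (Σ-const X 1ℚ) (*-identityʳ (ι X))))

-- A residue system on the moduli N + 1, N + 2, … with residue c i for N + 1 + i.
module _ (N : ℕ) (c : ℕ → ℕ) (c< : ∀ i → c i ℕ.< suc (N ℕ.+ i)) where

  private
    d : ℕ → ℕ
    d i = suc (N ℕ.+ i)

  -- The indicator that `d i` divides n and class `i` contains the whole residue class r mod n.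
  hit : ℕ → ℕ → ℕ → ℚ
  hit n r i = 𝟙 (d i ℕ.∣? n) * 𝟙 (r ℕ.% d i ℕ.≟ c i)

  0≤hit : ∀ n r i → 0ℚ ≤ hit n r i
  0≤hit n r i = 0≤* (0≤𝟙 (d i ℕ.∣? n)) (0≤𝟙 (r ℕ.% d i ℕ.≟ c i))

  hit≤1 : ∀ n r i → hit n r i ≤ 1ℚ
  hit≤1 n r i = mul (<⇒≤ 0<1) (0≤𝟙 (r ℕ.% d i ℕ.≟ c i)) (𝟙≤1 (d i ℕ.∣? n)) (𝟙≤1 (r ℕ.% d i ℕ.≟ c i))

  unhit : ℕ → ℕ → ℕ → ℚ
  unhit k n r = Π[i< k ] (λ i → 1ℚ - hit n r i)

  private
    ι-quotient : ∀ q m → .{{ℕ.NonZero m}} → ι q ≡ ι (q ℕ.* m) * (1ℚ * rcp m)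
    ι-quotient q m = sym (trans (cong₂ _*_ (ι-* q m) (*-identityˡ (rcp m))) (trans (*-assoc (ι q) (ι m) (rcp m))
      (trans (cong (ι q *_) (ι*rcp m)) (*-identityʳ (ι q)))))

  Σ-hit : ∀ n i → Σ[i< n ] (λ r → hit n r i) ≡ ι n * (𝟙 (d i ℕ.∣? n) * rcp (d i))
  Σ-hit n i with d i ℕ.∣? n
  ... | no _ = trans (Σ-0 n λ r _ → *-zeroˡ (𝟙 (r ℕ.% d i ℕ.≟ c i)))
    (sym (trans (cong (ι n *_) (*-zeroˡ (rcp (d i)))) (*-zeroʳ (ι n))))
  ... | yes (ℕ.divides-refl q) = trans (Σ-cong (q ℕ.* d i) λ r _ → *-identityˡ (𝟙 (r ℕ.% d i ℕ.≟ c i)))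
    (trans (Σ-residue (d i) q (c i) (c< i)) (ι-quotient q (d i)))

  -- Two classes that meet do so in a single residue class mod the lcm, represented by any common
  -- element `s`. Classes that do not meet contribute 0, hence only an inequality.
  Σ-hit-pair : ∀ n i j → Σ[i< n ] (λ r → hit n r i * hit n r j) ≤ ι n * (𝟙 (ℕ.lcm (d i) (d j) ℕ.∣? n) * rcp (ℕ.lcm (d i) (d j)))
  Σ-hit-pair n i j with ℕ.lcm (d i) (d j) ℕ.∣? n
  ... | no l∤n = ≤-reflexive (trans (Σ-0 n λ r _ → zero-pair r)
    (sym (trans (cong (ι n *_) (*-zeroˡ (rcp (ℕ.lcm (d i) (d j))))) (*-zeroʳ (ι n)))))
    where
    miss : ∀ r i → ¬ d i ℕ.∣ n → hit n r i ≡ 0ℚ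
    miss r i ∤n = trans (cong (_* 𝟙 (r ℕ.% d i ℕ.≟ c i)) (𝟙-no (d i ℕ.∣? n) ∤n)) (*-zeroˡ (𝟙 (r ℕ.% d i ℕ.≟ c i)))
    zero-pair : ∀ r → hit n r i * hit n r j ≡ 0ℚ
    zero-pair r = go (d i ℕ.∣? n)
      where
      go : Dec (d i ℕ.∣ n) → hit n r i * hit n r j ≡ 0ℚ
      go (no ∤n) = trans (cong (_* hit n r j) (miss r i ∤n)) (*-zeroˡ (hit n r j))
      go (yes ∣n) = trans (cong (hit n r i *_) (miss r j λ ∣n′ → l∤n (ℕ.lcm-least ∣n ∣n′))) (*-zeroʳ (hit n r i))
  ... | yes (ℕ.divides-refl q) = ≤-trans (Σ-mono (q ℕ.* l) λ r _ → pair≤ r) (go (ℕ.anyUpTo? both? (q ℕ.* l)))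
    where
    l = ℕ.lcm (d i) (d j)
    instance
      l≢0 : ℕ.NonZero l
      l≢0 = ℕ.>-nonZero (ℕ.≤-trans (s≤s z≤n) (lcm-lower (d i) (d j)))
    Both : ℕ → Set
    Both r = r ℕ.% d i ≡ c i × r ℕ.% d j ≡ c j
    both? : ∀ r → Dec (Both r)
    both? r = (r ℕ.% d i ℕ.≟ c i) ×-dec (r ℕ.% d j ℕ.≟ c j)
    pair≤ : ∀ r → hit (q ℕ.* l) r i * hit (q ℕ.* l) r j ≤ 𝟙 (both? r)
    pair≤ r = ≤-trans (mul (0≤𝟙 (r ℕ.% d i ℕ.≟ c i)) (0≤hit (q ℕ.* l) r j) (drop i) (drop j)) (≤-reflexive eq)
      where
      drop : ∀ i → hit (q ℕ.* l) r i ≤ 𝟙 (r ℕ.% d i ℕ.≟ c i)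
      drop i = ≤-trans (mulʳ (𝟙 (r ℕ.% d i ℕ.≟ c i)) (0≤𝟙 (r ℕ.% d i ℕ.≟ c i)) (𝟙≤1 (d i ℕ.∣? (q ℕ.* l)))) (≤-reflexive (*-identityˡ (𝟙 (r ℕ.% d i ℕ.≟ c i))))
      eq : 𝟙 (r ℕ.% d i ℕ.≟ c i) * 𝟙 (r ℕ.% d j ℕ.≟ c j) ≡ 𝟙 (both? r)
      eq with r ℕ.% d i ℕ.≟ c i | r ℕ.% d j ℕ.≟ c j
      ... | yes _ | yes _ = refl
      ... | yes _ | no _ = refl
      ... | no _ | yes _ = refl
      ... | no _ | no _ = refl
    go : Dec (∃ λ r → r ℕ.< q ℕ.* l × Both r) → Σ[i< q ℕ.* l ] (λ r → 𝟙 (both? r)) ≤ ι (q ℕ.* l) * (1ℚ * rcp l)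
    go (no none) = ≤-trans (≤-reflexive (Σ-0 (q ℕ.* l) λ r r< → 𝟙-no (both? r) λ b → none (r , r< , b)))
      (0≤* (0≤ι (q ℕ.* l)) (0≤* (<⇒≤ 0<1) (0≤rcp l)))
    go (yes (s , _ , si , sj)) = ≤-trans
      (Σ-mono (q ℕ.* l) λ r _ → 𝟙-mono (both? r) (r ℕ.% l ℕ.≟ s ℕ.% l) λ (ri , rj) →
        ∣⇒%≡ l r s (ℕ.lcm-least (%≡⇒∣ (d i) r s (trans ri (sym si))) (%≡⇒∣ (d j) r s (trans rj (sym sj)))))
      (≤-reflexive (trans (Σ-residue l q (s ℕ.% l) (ℕ.m%n<n s l)) (ι-quotient q l)))

  Σ-unhit : ∀ k n → Σ[i< n ] (unhit k n) ≤ ι n * (1ℚ - gain N k n)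
  Σ-unhit k n = begin
    Σ[i< n ] (unhit k n)
      ≤⟨ Σ-mono n (λ r _ → bonferroni k (hit n r) (0≤hit n r) (hit≤1 n r)) ⟩
    Σ[i< n ] (λ r → 1ℚ - Σ[i< k ] (hit n r) + PS k (hit n r))
      ≡⟨ trans (Σ-+ n (λ r → 1ℚ - Σ[i< k ] (hit n r)) (λ r → PS k (hit n r)))
           (cong (_+ Σ[i< n ] (λ r → PS k (hit n r))) (trans (Σ-- n (λ _ → 1ℚ) (λ r → Σ[i< k ] (hit n r)))
             (cong (_- Σ[i< n ] (λ r → Σ[i< k ] (hit n r))) (Σ-const n 1ℚ)))) ⟩
    ι n * 1ℚ - Σ[i< n ] (λ r → Σ[i< k ] (hit n r)) + Σ[i< n ] (λ r → PS k (hit n r))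
      ≤⟨ +-mono-≤ (≤-reflexive (cong (λ x → ι n * 1ℚ - x) singles)) pairs ⟩
    ι n * 1ℚ - ι n * P + ι n * Q
      ≡⟨ solve 4 (λ n o p q → n :* o :- n :* p :+ n :* q := n :* (o :- (p :- q))) refl (ι n) 1ℚ P Q ⟩
    ι n * (1ℚ - gain N k n) ∎
    where
    open ≤-Reasoning
    P = Σ[i< k ] (λ i → 𝟙 (d i ℕ.∣? n) * rcp (d i))
    Q = Σ[i< k ] (λ i → Σ[i< i ] (λ j → 𝟙 (ℕ.lcm (d i) (d j) ℕ.∣? n) * rcp (ℕ.lcm (d i) (d j))))
    singles : Σ[i< n ] (λ r → Σ[i< k ] (hit n r)) ≡ ι n * P
    singles = trans (Σ-swap n k (hit n)) (trans (Σ-cong k λ i _ → Σ-hit n i) (Σ-*ˡ k (ι n) (λ i → 𝟙 (d i ℕ.∣? n) * rcp (d i))))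
    pairs : Σ[i< n ] (λ r → PS k (hit n r)) ≤ ι n * Q
    pairs = begin
      Σ[i< n ] (λ r → PS k (hit n r))
        ≡⟨ Σ-swap n k (λ r i → hit n r i * Σ[i< i ] (hit n r)) ⟩
      Σ[i< k ] (λ i → Σ[i< n ] (λ r → hit n r i * Σ[i< i ] (hit n r)))
        ≡⟨ Σ-cong k (λ i _ → trans (Σ-cong n λ r _ → sym (Σ-*ˡ i (hit n r i) (hit n r))) (Σ-swap n i (λ r j → hit n r i * hit n r j))) ⟩
      Σ[i< k ] (λ i → Σ[i< i ] (λ j → Σ[i< n ] (λ r → hit n r i * hit n r j)))
        ≤⟨ Σ-mono k (λ i _ → Σ-mono i λ j _ → Σ-hit-pair n i j) ⟩
      Σ[i< k ] (λ i → Σ[i< i ] (λ j → ι n * (𝟙 (ℕ.lcm (d i) (d j) ℕ.∣? n) * rcp (ℕ.lcm (d i) (d j)))))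
        ≡⟨ trans (Σ-cong k λ i _ → Σ-*ˡ i (ι n) (λ j → 𝟙 (ℕ.lcm (d i) (d j) ℕ.∣? n) * rcp (ℕ.lcm (d i) (d j))))
             (Σ-*ˡ k (ι n) (λ i → Σ[i< i ] (λ j → 𝟙 (ℕ.lcm (d i) (d j) ℕ.∣? n) * rcp (ℕ.lcm (d i) (d j))))) ⟩
      ι n * Q ∎

  0≤unhit : ∀ k n r → 0ℚ ≤ unhit k n r
  0≤unhit k n r = Π-≥0 k λ i → 0≤-gap (hit≤1 n r i)

-- As `gain` depends on the moduli alone, any residues will do in `Σ-unhit`; all are taken to be 0.
-- The number of unhit residues is nonnegative.
gain≤1 : ∀ N k n → .{{ℕ.NonZero n}} → gain N k n ≤ 1ℚ
gain≤1 N k n = gap-≤ (*-cancelʳ-ι n (subst₂ _≤_ (sym (*-zeroˡ (ι n))) (*-comm (ι n) (1ℚ - gain N k n))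
  (≤-trans (Σ-≥0 n λ r _ → 0≤unhit N (λ _ → 0) (λ _ → s≤s z≤n) k n r) (Σ-unhit N (λ _ → 0) (λ _ → s≤s z≤n) k n))))

relativeGain≤1 : ∀ N k t → relativeGain N k t ≤ 1ℚ
relativeGain≤1 N k t with k ℕ.≤? t
... | no _ = subst (_≤ 1ℚ) (sym (*-zeroˡ (gain N k (suc (N ℕ.+ t)) * rcp (N ℕ.+ t)))) (<⇒≤ 0<1)
... | yes _ = subst (_≤ 1ℚ) (sym (*-identityˡ (gain N k (suc (N ℕ.+ t)) * rcp (N ℕ.+ t))))
  (≤-trans (mulʳ (rcp (N ℕ.+ t)) (0≤rcp (N ℕ.+ t)) (gain≤1 N k (suc (N ℕ.+ t))))
    (≤-trans (≤-reflexive (*-identityˡ (rcp (N ℕ.+ t)))) (rcp≤1 (N ℕ.+ t))))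

-- The greedy residue system

argmax : (ℕ → ℚ) → ℕ → ℕ
argmax f zero = 0
argmax f (suc n) with f (argmax f n) ≤? f n
... | yes _ = n
... | no _ = argmax f n

argmax≤ : ∀ f n → argmax f n ℕ.≤ ℕ.pred n
argmax≤ f zero = z≤n
argmax≤ f (suc n) with f (argmax f n) ≤? f n
... | yes _ = ℕ.≤-refl
... | no _ = ℕ.≤-trans (argmax≤ f n) ℕ.pred[n]≤n

argmax-max : ∀ (f : ℕ → ℚ) n i → i ℕ.< n → f i ≤ f (argmax f n)
argmax-max f (suc n) i i≤n with f (argmax f n) ≤? f n | i ℕ.≟ n
... | yes _ | yes refl = ≤-refl
... | yes h | no i≢n = ≤-trans (argmax-max f n i (ℕ.≤∧≢⇒< (ℕ.≤-pred i≤n) i≢n)) h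
... | no h | yes refl = <⇒≤ (≰⇒> h)
... | no h | no i≢n = argmax-max f n i (ℕ.≤∧≢⇒< (ℕ.≤-pred i≤n) i≢n)

-- Residues must be positive while `r` may be 0, hence the shift by the modulus.
residueClass : ℕ → ℕ → ResidueClass
residueClass m r = record { modulus = suc m ; residue = suc m ℕ.+ r }

free : ResidueSystem → ℕ → ℚ
free C x = 𝟙 (R? C (ℤ.+ x))

0≤free : ∀ C x → 0ℚ ≤ free C x
0≤free C x = 0≤𝟙 (R? C (ℤ.+ x))

residueClass⇒% : ∀ m r x → r ℕ.≤ m → ℤ.+ x ≡ ℤ.+ (suc m ℕ.+ r) [mod suc m ] → x ℕ.% suc m ≡ r
residueClass⇒% m r x r≤m h = trans (≡mod⇒%≡ (suc m) x (suc m ℕ.+ r) h)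
  (trans (ℕ.%-remove-+ˡ r (ℕ.∣-refl {suc m})) (ℕ.m≤n⇒m%n≡m r≤m))

%⇒residueClass : ∀ m r x → r ℕ.≤ m → x ℕ.% suc m ≡ r → ℤ.+ x ≡ ℤ.+ (suc m ℕ.+ r) [mod suc m ]
%⇒residueClass m r x r≤m e = %≡⇒≡mod (suc m) x (suc m ℕ.+ r)
  (trans e (sym (trans (ℕ.%-remove-+ˡ r (ℕ.∣-refl {suc m})) (ℕ.m≤n⇒m%n≡m r≤m))))

free-∷ : ∀ m r C x → r ℕ.≤ m → free (residueClass m r ∷ C) x ≡ free C x - free C x * 𝟙 (x ℕ.% suc m ℕ.≟ r)
free-∷ m r C x r≤m = go (R? C (ℤ.+ x)) (x ℕ.% suc m ℕ.≟ r)
  where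
  c = residueClass m r
  go : (p : Dec (R C (ℤ.+ x))) (q : Dec (x ℕ.% suc m ≡ r)) → free (c ∷ C) x ≡ 𝟙 p - 𝟙 p * 𝟙 q
  go (yes p) (yes q) = 𝟙-no (R? (c ∷ C) (ℤ.+ x)) λ { (¬q ∷ _) → ¬q (%⇒residueClass m r x r≤m q) }
  go (yes p) (no ¬q) = 𝟙-yes (R? (c ∷ C) (ℤ.+ x)) ((λ q → ¬q (residueClass⇒% m r x r≤m q)) ∷ p)
  go (no ¬p) q = trans (𝟙-no (R? (c ∷ C) (ℤ.+ x)) λ { (_ ∷ p) → ¬p p })
    (sym (trans (cong (λ y → 0ℚ - y) (*-zeroˡ (𝟙 q))) refl))

module Greedy (N L : ℕ) where

  total : ResidueSystem → ℚ
  total C = Σ[i< L ] (free C)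

  mass : ResidueSystem → ℕ → ℕ → ℚ
  mass C m r = Σ[i< L ] (λ x → free C x * 𝟙 (x ℕ.% suc m ℕ.≟ r))

  best : ResidueSystem → ℕ → ℕ
  best C m = argmax (mass C m) (suc m)

  greedy : ℕ → ResidueSystem
  greedy zero = []
  greedy (suc k) = residueClass (N ℕ.+ k) (best (greedy k) (N ℕ.+ k)) ∷ greedy k

  residues : ℕ → ℕ
  residues i = best (greedy i) (N ℕ.+ i)

  residues≤ : ∀ i → residues i ℕ.≤ N ℕ.+ i
  residues≤ i = argmax≤ (mass (greedy i) (N ℕ.+ i)) (suc (N ℕ.+ i))

  avoids : ∀ k i x → i ℕ.< k → R (greedy k) (ℤ.+ x) → ¬ x ℕ.% suc (N ℕ.+ i) ≡ residues i
  avoids (suc k) i x i≤k (h ∷ r) e with i ℕ.≟ k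
  ... | yes refl = h (%⇒residueClass (N ℕ.+ k) (residues k) x (residues≤ k) e)
  ... | no i≢k = avoids k i x (ℕ.≤∧≢⇒< (ℕ.≤-pred i≤k) i≢k) r e

  total-step : ∀ k → total (greedy (suc k)) ≡ total (greedy k) - mass (greedy k) (N ℕ.+ k) (residues k)
  total-step k = trans (Σ-cong L λ x _ → free-∷ (N ℕ.+ k) (residues k) (greedy k) x (residues≤ k))
    (Σ-- L (free (greedy k)) (λ x → free (greedy k) x * 𝟙 (x ℕ.% suc (N ℕ.+ k) ℕ.≟ residues k)))

  0≤total : ∀ C → 0ℚ ≤ total C
  0≤total C = Σ-≥0 L λ x _ → 0≤free C x

  0≤mass : ∀ C m r → 0ℚ ≤ mass C m r
  0≤mass C m r = Σ-≥0 L λ x _ → 0≤* (0≤free C x) (0≤𝟙 (x ℕ.% suc m ℕ.≟ r))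

  Σ-mass : ∀ C m → Σ[i< suc m ] (mass C m) ≡ total C
  Σ-mass C m = trans (Σ-swap (suc m) L (λ r x → free C x * 𝟙 (x ℕ.% suc m ℕ.≟ r)))
    (Σ-cong L λ x _ → trans (Σ-*ˡ (suc m) (free C x) (λ r → 𝟙 (x ℕ.% suc m ℕ.≟ r)))
      (trans (cong (free C x *_) (trans
          (Σ-cong (suc m) λ r _ → 𝟙-cong (x ℕ.% suc m ℕ.≟ r) (r ℕ.≟ x ℕ.% suc m) sym sym)
          (Σ-delta (suc m) (x ℕ.% suc m) (ℕ.m%n<n x (suc m)))))
        (*-identityʳ (free C x))))

  residues< : ∀ i → residues i ℕ.< suc (N ℕ.+ i)
  residues< i = s≤s (residues≤ i)

  -- If x ≡ r mod n and d divides n, then x and r agree mod d, so a hit of r by class `i` would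
  -- cover x.
  free-hit : ∀ k i x r → i ℕ.< k →
    free (greedy k) x * 𝟙 (x ℕ.% suc (N ℕ.+ k) ℕ.≟ r) * hit N residues residues< (suc (N ℕ.+ k)) r i ≡ 0ℚ
  free-hit k i x r i<k = go (R? (greedy k) (ℤ.+ x)) (x ℕ.% n ℕ.≟ r) (d ℕ.∣? n) (r ℕ.% d ℕ.≟ residues i)
    where
    n = suc (N ℕ.+ k)
    d = suc (N ℕ.+ i)
    go : (p : Dec (R (greedy k) (ℤ.+ x))) (q : Dec (x ℕ.% n ≡ r)) (s : Dec (d ℕ.∣ n)) (t : Dec (r ℕ.% d ≡ residues i)) →
      𝟙 p * 𝟙 q * (𝟙 s * 𝟙 t) ≡ 0ℚ
    go (yes p) (yes refl) (yes s) (yes t) = contradiction (trans (sym (ℕ.m∣n⇒o%n%m≡o%m d n x s)) t) (avoids k i x i<k p)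
    go (no _) q s t = trans (cong (_* (𝟙 s * 𝟙 t)) (*-zeroˡ (𝟙 q))) (*-zeroˡ (𝟙 s * 𝟙 t))
    go (yes _) (no _) s t = *-zeroˡ (𝟙 s * 𝟙 t)
    go (yes _) (yes _) (no _) t = trans (cong (1ℚ *_) (*-zeroˡ (𝟙 t))) refl
    go (yes _) (yes _) (yes _) (no _) = refl

  -- A residue already hit contains no uncovered integer, so its mass is 0. The factors of `unhit`
  -- are introduced one at a time by `free-hit`.
  mass-unhit : ∀ k j r → j ℕ.≤ k →
    mass (greedy k) (N ℕ.+ k) r ≡ mass (greedy k) (N ℕ.+ k) r * unhit N residues residues< j (suc (N ℕ.+ k)) r
  mass-unhit k j r j≤k = trans (Σ-cong L λ x _ → pointwise x j j≤k)
    (Σ-*ʳ L (unhit N residues residues< j n r) (λ x → free (greedy k) x * 𝟙 (x ℕ.% n ℕ.≟ r)))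
    where
    n = suc (N ℕ.+ k)
    w : ℕ → ℚ
    w x = free (greedy k) x * 𝟙 (x ℕ.% n ℕ.≟ r)
    h : ℕ → ℚ
    h = hit N residues residues< n r
    pointwise : ∀ x j → j ℕ.≤ k → w x ≡ w x * unhit N residues residues< j n r
    pointwise x zero _ = sym (*-identityʳ (w x))
    pointwise x (suc j) j<k = begin
      w x                        ≡⟨ pointwise x j (ℕ.<⇒≤ j<k) ⟩
      w x * u                    ≡⟨ solve 3 (λ w u h → w :* u := w :* (u :* (con 1ℚ :- h)) :+ w :* h :* u) refl (w x) u (h j) ⟩
      w x * (u * (1ℚ - h j)) + w x * h j * u
        ≡⟨ cong (w x * (u * (1ℚ - h j)) +_) (trans (cong (_* u) (free-hit k j x r j<k)) (*-zeroˡ u)) ⟩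
      w x * (u * (1ℚ - h j)) + 0ℚ
        ≡⟨ +-identityʳ (w x * (u * (1ℚ - h j))) ⟩
      w x * (u * (1ℚ - h j)) ∎
      where
      open ≡-Reasoning
      u = unhit N residues residues< j n r

  -- Only unhit residues carry mass. There are at most n(1 - γ) of them, and none carries more than
  -- the chosen one.
  total≤mass : ∀ k j → j ℕ.≤ k → let n = suc (N ℕ.+ k) in
    total (greedy k) ≤ mass (greedy k) (N ℕ.+ k) (residues k) * (ι n * (1ℚ - gain N j n))
  total≤mass k j j≤k = begin
    total (greedy k)
      ≡⟨ sym (Σ-mass (greedy k) (N ℕ.+ k)) ⟩
    Σ[i< n ] (mass (greedy k) (N ℕ.+ k))
      ≤⟨ Σ-mono n (λ r r<n → ≤-trans (≤-reflexive (mass-unhit k j r j≤k))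
           (mulʳ (unhit N residues residues< j n r) (0≤unhit N residues residues< j n r) (argmax-max (mass (greedy k) (N ℕ.+ k)) n r r<n))) ⟩
    Σ[i< n ] (λ r → μ * unhit N residues residues< j n r)
      ≡⟨ Σ-*ˡ n μ (unhit N residues residues< j n) ⟩
    μ * Σ[i< n ] (unhit N residues residues< j n)
      ≤⟨ mulˡ μ (0≤mass (greedy k) (N ℕ.+ k) (residues k)) (Σ-unhit N residues residues< j n) ⟩
    μ * (ι n * (1ℚ - gain N j n)) ∎
    where
    open ≤-Reasoning
    n = suc (N ℕ.+ k)
    μ = mass (greedy k) (N ℕ.+ k) (residues k)

  -- The inequality (1 - γ)(1 + γ) ≤ 1 replaces division by 1 - γ. The sign of 1 + γ is not known;
  -- if it is not positive, the left side is at most 0.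
  mass-lower : ∀ k j → j ℕ.≤ k → let n = suc (N ℕ.+ k) in
    total (greedy k) * (1ℚ + gain N j n) ≤ mass (greedy k) (N ℕ.+ k) (residues k) * ι n
  mass-lower k j j≤k = go (≤-total 0ℚ (1ℚ + γ))
    where
    open ≤-Reasoning
    n = suc (N ℕ.+ k)
    γ = gain N j n
    μ = mass (greedy k) (N ℕ.+ k) (residues k)
    μ≥0 = 0≤mass (greedy k) (N ℕ.+ k) (residues k)
    S = total (greedy k)
    go : 0ℚ ≤ 1ℚ + γ ⊎ 1ℚ + γ ≤ 0ℚ → S * (1ℚ + γ) ≤ μ * ι n
    go (inj₁ h) = begin
      S * (1ℚ + γ)                        ≤⟨ mulʳ (1ℚ + γ) h (total≤mass k j j≤k) ⟩
      μ * (ι n * (1ℚ - γ)) * (1ℚ + γ)     ≡⟨ solve 3 (λ m n g → m :* (n :* (con 1ℚ :- g)) :* (con 1ℚ :+ g) := m :* n :- m :* n :* (g :* g)) refl μ (ι n) γ ⟩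
      μ * ι n - μ * ι n * (γ * γ)
        ≤⟨ +-monoʳ-≤ (μ * ι n) (neg-antimono-≤ (0≤* (0≤* μ≥0 (0≤ι n)) (0≤p² γ))) ⟩
      μ * ι n - 0ℚ                        ≡⟨ +-identityʳ (μ * ι n) ⟩
      μ * ι n ∎
    go (inj₂ h) = begin
      S * (1ℚ + γ)    ≤⟨ mulˡ S (0≤total (greedy k)) h ⟩
      S * 0ℚ          ≡⟨ *-zeroʳ S ⟩
      0ℚ              ≤⟨ 0≤* μ≥0 (0≤ι n) ⟩
      μ * ι n ∎

  total-decay : ∀ k j → j ℕ.≤ k →
    total (greedy (suc k)) * ι (suc (N ℕ.+ k)) ≤ total (greedy k) * (ι (N ℕ.+ k) - gain N j (suc (N ℕ.+ k)))
  total-decay k j j≤k = begin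
    total (greedy (suc k)) * ι n       ≡⟨ cong (_* ι n) (total-step k) ⟩
    (S - μ) * ι n                      ≡⟨ solve 3 (λ s m n → (s :- m) :* n := s :* n :- m :* n) refl S μ (ι n) ⟩
    S * ι n - μ * ι n                  ≤⟨ +-monoʳ-≤ (S * ι n) (neg-antimono-≤ (mass-lower k j j≤k)) ⟩
    S * ι n - S * (1ℚ + γ)             ≡⟨ cong (λ z → S * z - S * (1ℚ + γ)) (ι-suc (N ℕ.+ k)) ⟩
    S * (1ℚ + ι (N ℕ.+ k)) - S * (1ℚ + γ)
      ≡⟨ solve 4 (λ s o m g → s :* (o :+ m) :- s :* (o :+ g) := s :* (m :- g)) refl S 1ℚ (ι (N ℕ.+ k)) γ ⟩
    S * (ι (N ℕ.+ k) - γ) ∎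
    where
    open ≤-Reasoning
    n = suc (N ℕ.+ k)
    γ = gain N j n
    μ = mass (greedy k) (N ℕ.+ k) (residues k)
    S = total (greedy k)

  -- The factors (n - 1)/n telescope to N/(N + k), written here with denominators cleared.
  total-bound : ∀ κ₀ k → .{{ℕ.NonZero N}} →
    total (greedy k) * ι (N ℕ.+ k) ≤ ι L * ι N * Π[i< k ] (λ t → 1ℚ - relativeGain N κ₀ t)
  total-bound κ₀ zero = ≤-reflexive (trans (cong₂ _*_ (trans (Σ-const L 1ℚ) (*-identityʳ (ι L))) (cong ι (ℕ.+-identityʳ N)))
    (sym (*-identityʳ (ι L * ι N))))
  total-bound κ₀ (suc k) = begin
    total (greedy (suc k)) * ι (N ℕ.+ suc k)      ≡⟨ cong (λ n → total (greedy (suc k)) * ι n) (ℕ.+-suc N k) ⟩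
    total (greedy (suc k)) * ι (suc m)            ≤⟨ step (κ₀ ℕ.≤? k) ⟩
    S * (ι m * (1ℚ - relativeGain N κ₀ k))        ≡⟨ sym (*-assoc S (ι m) (1ℚ - relativeGain N κ₀ k)) ⟩
    S * ι m * (1ℚ - relativeGain N κ₀ k)
      ≤⟨ mulʳ (1ℚ - relativeGain N κ₀ k) (0≤-gap (relativeGain≤1 N κ₀ k)) (total-bound κ₀ k) ⟩
    ι L * ι N * P * (1ℚ - relativeGain N κ₀ k)    ≡⟨ *-assoc (ι L * ι N) P (1ℚ - relativeGain N κ₀ k) ⟩
    ι L * ι N * Π[i< suc k ] (λ t → 1ℚ - relativeGain N κ₀ t) ∎
    where
    open ≤-Reasoning
    m = N ℕ.+ k
    S = total (greedy k)
    P = Π[i< k ] (λ t → 1ℚ - relativeGain N κ₀ t)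
    instance
      m≢0 : ℕ.NonZero m
      m≢0 = ℕ.>-nonZero (ℕ.≤-trans (ℕ.>-nonZero⁻¹ N) (ℕ.m≤m+n N k))
    step : Dec (κ₀ ℕ.≤ k) → total (greedy (suc k)) * ι (suc m) ≤ S * (ι m * (1ℚ - relativeGain N κ₀ k))
    step (yes h) = ≤-trans (total-decay k κ₀ h) (≤-reflexive (cong (S *_) (sym (trans
      (cong (λ y → ι m * (1ℚ - y * (γ * rcp m))) (𝟙-yes (κ₀ ℕ.≤? k) h))
      (trans (solve 3 (λ a g r → a :* (con 1ℚ :- con 1ℚ :* (g :* r)) := a :- a :* r :* g) refl (ι m) γ (rcp m))
        (cong (λ y → ι m - y) (trans (cong (_* γ) (ι*rcp m)) (*-identityˡ γ))))))))
      where γ = gain N κ₀ (suc m)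
    -- Inside the initial interval `j` is 0, the gain vanishes, and the decay is the plain (n -
    -- 1)/n.
    step (no h) = ≤-trans (total-decay k 0 z≤n) (≤-reflexive (cong (S *_) (sym (trans
      (cong (λ y → ι m * (1ℚ - y * (γ * rcp m))) (𝟙-no (κ₀ ℕ.≤? k) h))
      (trans (cong (λ y → ι m * (1ℚ - y)) (*-zeroˡ (γ * rcp m))) (trans (*-identityʳ (ι m)) (sym (+-identityʳ (ι m)))))))))
      where γ = gain N κ₀ (suc m)

  greedy-range : ∀ k → All (λ c → N ℕ.< modulus c × modulus c ℕ.≤ N ℕ.+ k) (greedy k)
  greedy-range zero = []
  greedy-range (suc k) = (s≤s (ℕ.m≤m+n N k) , ℕ.≤-reflexive (sym (ℕ.+-suc N k)))
    ∷ All.map (λ (l , u) → l , ℕ.≤-trans u (ℕ.+-monoʳ-≤ N (ℕ.n≤1+n k))) (greedy-range k)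

  greedy-distinct : ∀ k → DistinctModuli (greedy k)
  greedy-distinct zero = []
  greedy-distinct (suc k) = All.map⁺ (All.map (λ (_ , u) e → ℕ.1+n≰n (ℕ.≤-trans (ℕ.≤-reflexive e) u)) (greedy-range k)) ∷ greedy-distinct k

-- From counts over a period to the density, and the conclusion

count-free : ∀ C a n → ι (count (R? C) (ℤ.+ a) n) ≡ Σ[i< n ] (λ i → free C (a ℕ.+ i))
count-free C a zero = refl
count-free C a (suc n) = begin
  ι (count (R? C) (ℤ.+ a) (suc n))
    ≡⟨ trans (cong ι (Counting.count-∷ (R? C) (ℤ.+ a) n)) (ι-+ (count (R? C) (ℤ.+ a) 1) (count (R? C) (ℤ.+ suc a) n)) ⟩
  ι (count (R? C) (ℤ.+ a) 1) + ι (count (R? C) (ℤ.+ suc a) n)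
    ≡⟨ cong₂ _+_ (trans one (cong (free C) (sym (ℕ.+-identityʳ a))))
         (trans (count-free C (suc a) n) (Σ-cong n λ i _ → cong (free C) (sym (ℕ.+-suc a i)))) ⟩
  free C (a ℕ.+ 0) + Σ[i< n ] (λ i → free C (a ℕ.+ suc i))
    ≡⟨ sym (Σ-first n (λ i → free C (a ℕ.+ i))) ⟩
  Σ[i< suc n ] (λ i → free C (a ℕ.+ i)) ∎
  where
  open ≡-Reasoning
  one : ι (count (R? C) (ℤ.+ a) 1) ≡ free C a
  one with R? C (ℤ.+ a)
  ... | yes _ = refl
  ... | no _ = refl

∣! : ∀ {m n} → .{{ℕ.NonZero m}} → m ℕ.≤ n → m ℕ.∣ n !
∣! {suc m} h = ℕ.∣-trans (ℕ.m∣m*n (m !)) (ℕ.m≤n⇒m!∣n! h)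

-- The proportion over one full period is the limit, and the proportion in [-X, X] differs from it
-- by at most (l + 1)/(X + 1).
δ-upper : ∀ C l → (∀ {c} → c ∈ C → ℤ.+ modulus c ℤ.∣ ℤ.+ suc l) →
  ∀ X → approx (δ C) X ≤ Σ[i< suc l ] (free C) * rcp (suc l) + ι (suc l) * inv X
δ-upper C l h X = ≤-trans
  (-≤⇒≤+ {approx (δ C) X} {S /ₙ suc l} (≤-trans (p≤∣p∣ (approx (δ C) X - S /ₙ suc l))
    (≤-trans (density-close (ℤ.- ℤ.+ X) (2 ℕ.* X)) (/ₙ-rate X X ℕ.≤-refl))))
  (≤-reflexive (cong (_+ ι (suc l) * inv X) (trans (sym S≡) (cong₂ _*_ (count-free C 0 (suc l)) (sym (rcp-inv l))))))
  where
  sh = R-shift C (ℤ.+ suc l) h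
  open Counting.Periodic (R? C) l (λ {a} → proj₁ sh {a}) (λ {a} → proj₂ sh {a})
  S≡ : ι S * inv l ≡ S /ₙ suc l
  S≡ = trans (/-*-/ S 0 1 l) (/-cross (S ℕ.* 1) (l ℕ.+ 0) S l
    (cong₂ ℕ._*_ (ℕ.*-identityʳ S) (cong suc (sym (ℕ.+-identityʳ l)))))

module _ (N k : ℕ) .{{_ : ℕ.NonZero N}} where

  private
    K = suc k
    T = k ℕ.* N
    -- Every modulus divides (KN)!. The predecessor is taken because periods have the form `suc l`.
    l = ℕ.pred ((K ℕ.* N) !)
    L≡ : suc l ≡ (K ℕ.* N) !
    L≡ = ℕ.suc-pred ((K ℕ.* N) !) {{ℕ._!≢0 (K ℕ.* N)}}
  open Greedy N (suc l)

  greedyCover : ResidueSystem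
  greedyCover = greedy T

  private
    moduli∣ : ∀ {c} → c ∈ greedyCover → ℤ.+ modulus c ℤ.∣ ℤ.+ suc l
    moduli∣ {c} c∈ = ℤ.∣ᵤ⇒∣ (subst (modulus c ℕ.∣_) (sym L≡)
      (∣! {{ℕ.>-nonZero (ℕ.≤-trans (s≤s z≤n) (proj₁ (All.lookup (greedy-range T) c∈)))}} (proj₂ (All.lookup (greedy-range T) c∈))))

  total≤ : ∀ κ₀ → total greedyCover * rcp (suc l) ≤ rcp K * Π[i< T ] (λ t → 1ℚ - relativeGain N κ₀ t)
  total≤ κ₀ = *-cancelʳ-ι (K ℕ.* N) {{ℕ.m*n≢0 K N}} (begin
    total greedyCover * rcp (suc l) * ι (K ℕ.* N)
      ≡⟨ solve 3 (λ s r n → s :* r :* n := s :* n :* r) refl (total greedyCover) (rcp (suc l)) (ι (K ℕ.* N)) ⟩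
    total greedyCover * ι (K ℕ.* N) * rcp (suc l)
      -- `N + T` is `K * N` by definition, so the telescoped factor N/(N + T) is 1/K.
      ≤⟨ mulʳ (rcp (suc l)) (0≤rcp (suc l)) (total-bound κ₀ T) ⟩
    ι (suc l) * ι N * P * rcp (suc l)
      ≡⟨ solve 4 (λ m n p r → m :* n :* p :* r := m :* r :* (n :* p)) refl (ι (suc l)) (ι N) P (rcp (suc l)) ⟩
    ι (suc l) * rcp (suc l) * (ι N * P)
      ≡⟨ cong (_* (ι N * P)) (trans (ι*rcp (suc l)) (sym (ι*rcp K))) ⟩
    ι K * rcp K * (ι N * P)
      ≡⟨ solve 4 (λ a b c d → a :* b :* (c :* d) := b :* d :* (a :* c)) refl (ι K) (rcp K) (ι N) P ⟩
    rcp K * P * (ι K * ι N)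
      ≡⟨ cong (rcp K * P *_) (sym (ι-* K N)) ⟩
    rcp K * P * ι (K ℕ.* N) ∎)
    where
    open ≤-Reasoning
    P = Π[i< T ] (λ t → 1ℚ - relativeGain N κ₀ t)

  -- One half of ε covers the difference between [-X, X] and full periods, the other the limit in
  -- `P≲`, which the factor 1/K ≤ 1 does not enlarge.
  δ-greedy : ∀ κ₀ q → 0ℚ ≤ q → q * (H K + 1ℚ) ≤ Σ[i< T ] (relativeGain N κ₀) →
    δ greedyCover ≤ᵣ (ℤ.+ 1 / K) · exp (-ᵣ (q · log K))
  δ-greedy κ₀ q q≥0 hq ε ε>0 = M₁ ℕ.+ M₂ , bound
    where
    P = Π[i< T ] (λ t → 1ℚ - relativeGain N κ₀ t)
    ε/2>0 : 0ℚ < ½ * ε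
    ε/2>0 = 0<* {½} {ε} (positive⁻¹ ½) ε>0
    y : ℕ → ℚ
    y n = q * logSum k n
    P≲ : P ≲ (λ n → expSum (- y n) n)
    P≲ = Π≲exp-neg T (relativeGain N κ₀) y (relativeGain≤1 N κ₀) (λ n → 0≤* q≥0 (0≤logSum k n))
      (λ n → ≤-trans (mulˡ q q≥0 (logSum≤H k n)) hq)
    M₁ = proj₁ (P≲ (½ * ε) ε/2>0)
    M₂ = proj₁ (/-small (ι (suc l)) (½ * ε) ε/2>0)
    bound : ∀ n → M₁ ℕ.+ M₂ ℕ.≤ n → approx (δ greedyCover) n ≤ (ℤ.+ 1 / K) * expSum (- y n) n + ε
    bound n M≤n = begin
      approx (δ greedyCover) n
        ≤⟨ δ-upper greedyCover l moduli∣ n ⟩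
      total greedyCover * rcp (suc l) + ι (suc l) * inv n
        ≤⟨ +-mono-≤ (total≤ κ₀) (<⇒≤ (proj₂ (/-small (ι (suc l)) (½ * ε) ε/2>0) n (ℕ.m+n≤o⇒n≤o M₁ M≤n))) ⟩
      rcp K * P + ½ * ε
        ≤⟨ +-monoˡ-≤ (½ * ε) (mulˡ (rcp K) (0≤rcp K) (proj₂ (P≲ (½ * ε) ε/2>0) n (ℕ.m+n≤o⇒m≤o M₁ M≤n))) ⟩
      rcp K * (E + ½ * ε) + ½ * ε
        ≡⟨ cong (_+ ½ * ε) (*-distribˡ-+ (rcp K) E (½ * ε)) ⟩
      rcp K * E + rcp K * (½ * ε) + ½ * ε
        ≤⟨ +-monoˡ-≤ (½ * ε) (+-mono-≤ (≤-reflexive (cong (_* E) (rcp-inv k))) (≤-trans (mulʳ (½ * ε) (<⇒≤ ε/2>0) (rcp≤1 K)) (≤-reflexive (*-identityˡ (½ * ε))))) ⟩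
      (ℤ.+ 1 / K) * E + ½ * ε + ½ * ε
        ≡⟨ trans (+-assoc ((ℤ.+ 1 / K) * E) (½ * ε) (½ * ε)) (cong ((ℤ.+ 1 / K) * E +_) (½+½ ε)) ⟩
      (ℤ.+ 1 / K) * E + ε ∎
      where
      open ≤-Reasoning
      E = expSum (- y n) n

theorem6 : ∃ λ (K₀ : ℕ) → ∀ (N K : ℕ) .{{_ : ℕ.NonZero N}} .{{_ : ℕ.NonZero K}} → K₀ ℕ.≤ K →
    ∃ λ (C : ResidueSystem) →
    DistinctModuli C × ModuliFrom⟨ N , K ℕ.* N ] C ×
    (δ C ≤ᵣ (ℤ.+ 1 / K) · exp (-ᵣ (_÷ₙ_ (log K) (3 ℕ.* N) {{ℕ.m*n≢0 3 N}})))
theorem6 = proj₁ large , λ N K → bound N K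
  where
  large : ∃ λ K → 5 ℕ.≤ K × ι 29000 ≤ H K
  large = H-unbounded (ι 29000)
  bound : ∀ (N K : ℕ) .{{_ : ℕ.NonZero N}} .{{_ : ℕ.NonZero K}} → proj₁ large ℕ.≤ K →
    ∃ λ (C : ResidueSystem) →
    DistinctModuli C × ModuliFrom⟨ N , K ℕ.* N ] C ×
    (δ C ≤ᵣ (ℤ.+ 1 / K) · exp (-ᵣ (_÷ₙ_ (log K) (3 ℕ.* N) {{ℕ.m*n≢0 3 N}})))
  bound N K@(suc k) K₀≤K = greedyCover N k , Greedy.greedy-distinct N _ (k ℕ.* N) , Greedy.greedy-range N _ (k ℕ.* N) ,
    δ-greedy N k κ₀ q (subst (0ℚ ≤_) (sym q≡) (0≤rcp (3 ℕ.* N)))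
      (subst (λ r → r * (H K + 1ℚ) ≤ Σ[i< k ℕ.* N ] (relativeGain N κ₀)) (sym q≡)
        (Σ-relativeGain≥log N k κ₀ (ℕ.≤-pred (ℕ.≤-trans (proj₁ (proj₂ large)) K₀≤K)) (proj₁ (proj₂ sur)) (proj₂ (proj₂ sur))
          (≤-trans (proj₂ (proj₂ large)) (H-mono K₀≤K))))
    where
    instance
      3N≢0 : ℕ.NonZero (3 ℕ.* N)
      3N≢0 = ℕ.m*n≢0 3 N
    sur = surplus N
    κ₀ = proj₁ sur
    q = ℤ.+ 1 / (3 ℕ.* N)
    q≡ : q ≡ rcp (3 ℕ.* N)
    q≡ = /-rcp (3 ℕ.* N)
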